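{- Let $M \in (\mathbf{QP}_{\gg 0})^{k \times s}$, i.e. a $k \times s$ matrix whose entries lie in $\mathbf{QP}_{\gg 0}$. Define the matrix function $D$ by letting $D(n) \in \mathbf{Z}^{k \times s}$ be the Smith normal form of the integer matrix $M(n)$. Then $D \in (\mathbf{QP}_{\gg 0})^{k \times s}$, and there exist $U \in (\mathbf{QP}_{\gg 0})^{k \times k}$ and $V \in (\mathbf{QP}_{\gg 0})^{s \times s}$ such that $U(n)$ and $V(n)$ are unimodular for $n \gg 0$ and $U(n)M(n)V(n) = D(n)$ for $n \gg 0$.
   Context: A function $f$ with integer values defined on all sufficiently large integers is eventually a quasi-polynomial if there exist a positive integer $s$ and polynomials $f_0,\dots,f_{s-1} \in \mathbf{Q}[t]$ such that $f(n) = f_i(n)$ for all sufficiently large $n$ with $n \equiv i \pmod s$; $\mathbf{QP}_{\gg 0}$ denotes the ring of such functions. An integer square matrix is unimodular if its determinant is $\pm 1$. The Smith normal form of an integer matrix $M \in \mathbf{Z}^{k\times s}$ is the unique matrix $D = (\operatorname{diag}(d_1,\dots,d_r,0,\dots,0) \mid \mathbf{0})$ with positive integers $d_i$ satisfying $d_i \mid d_{i+1}$ such that $UMV = D$ for some unimodular integer matrices $U, V$. -}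

module Defs where

open import Data.Nat as ℕ using (ℕ; zero; suc)
open import Data.Integer as ℤ using (ℤ; +_; -[1+_])
open import Data.Integer.Divisibility using () renaming (_∣_ to _∣ℤ_)
open import Data.Rational as ℚ using (ℚ)
open import Data.Fin using (Fin; zero; suc; toℕ; punchIn)
open import Data.List using (List; []; _∷_)
open import Data.Product using (Σ; _×_; ∃)
open import Data.Sum using (_⊎_)
open import Relation.Binary.PropositionalEquality using (_≡_)
open import Relation.Nullary using (¬_)

Eventually : (ℕ → Set) → Set
Eventually P = Σ ℕ λ N → ∀ n → N ℕ.≤ n → P n

-- Polynomials in Q[t] as coefficient lists (constant term first)
Poly : Set
Poly = List ℚ

ℤ→ℚ : ℤ → ℚ
ℤ→ℚ z = z ℚ./ 1

evalPoly : Poly → ℚ → ℚ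
evalPoly []       x = ℚ.0ℚ
evalPoly (c ∷ cs) x = c ℚ.+ x ℚ.* evalPoly cs x

-- f is eventually a quasi-polynomial (f is an integer-valued function on
-- integers; only its values for n ≫ 0 matter, so it is modelled on ℕ).
IsQP : (ℕ → ℤ) → Set
IsQP f =
  Σ ℕ λ s → Σ (1 ℕ.≤ s) λ s≥1 →
  Σ (Fin s → Poly) λ polys →
  Eventually λ n →
    ℤ→ℚ (f n) ≡ evalPoly (polys (Data.Fin.fromℕ< (Data.Nat.DivMod.m%n<n n s {{ℕ.>-nonZero s≥1}}))) (ℤ→ℚ (+ n))
  where import Data.Nat.DivMod; import Data.Fin

Mat : ℕ → ℕ → Set
Mat k s = Fin k → Fin s → ℤ

sumℤ : ∀ {n} → (Fin n → ℤ) → ℤ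
sumℤ {zero}  f = + 0
sumℤ {suc n} f = f zero ℤ.+ sumℤ (λ i → f (suc i))

_·_ : ∀ {a b c} → Mat a b → Mat b c → Mat a c
(A · B) i j = sumℤ λ l → A i l ℤ.* B l j

_≈M_ : ∀ {a b} → Mat a b → Mat a b → Set
A ≈M B = ∀ i j → A i j ≡ B i j

sign : ℕ → ℤ
sign zero = + 1
sign (suc zero) = -[1+ 0 ]
sign (suc (suc n)) = sign n

det : ∀ {n} → Mat n n → ℤ
det {zero}  A = + 1
det {suc n} A = sumℤ λ j → sign (toℕ j) ℤ.* (A zero j ℤ.* det (λ a b → A (suc a) (punchIn j b)))

Unimodular : ∀ {n} → Mat n n → Set
Unimodular A = det A ≡ + 1 ⊎ det A ≡ -[1+ 0 ]

IsSmithForm : ∀ {k s} → Mat k s → Set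
IsSmithForm {k} {s} D =
  Σ ℕ λ r → (r ℕ.≤ k) × (r ℕ.≤ s) ×
  Σ (ℕ → ℤ) λ d →
    (∀ i → i ℕ.< r → + 0 ℤ.< d i) ×
    (∀ i → suc i ℕ.< r → d i ∣ℤ d (suc i)) ×
    (∀ (i : Fin k) (j : Fin s) → toℕ i ≡ toℕ j → toℕ i ℕ.< r → D i j ≡ d (toℕ i)) ×
    (∀ (i : Fin k) (j : Fin s) → ¬ (toℕ i ≡ toℕ j × toℕ i ℕ.< r) → D i j ≡ + 0)

IsSNFOf : ∀ {k s} → Mat k s → Mat k s → Set
IsSNFOf {k} {s} M D =
  IsSmithForm D ×
  Σ (Mat k k) λ U → Σ (Mat s s) λ V →
    Unimodular U × Unimodular V × ((U · M) · V) ≈M D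

IsQPMat : ∀ {k s} → (ℕ → Mat k s) → Set
IsQPMat M = ∀ i j → IsQP (λ n → M n i j)

{-# OPTIONS --safe #-}

-- On suitable residue classes every entry of M becomes an integer polynomial in a new variable, so one
-- works with matrices over ℤ[t], where the substitutions t ↦ S t + i for i in a complete residue system
-- may be made at any moment. Polynomials can then be divided: if deg b > deg a, substituting
-- t ↦ |lead a| t + i allows the leading term of b to be cancelled, and if deg b = deg a, the Euclidean
-- algorithm on the leading coefficients applies. The usual Smith algorithm need not terminate here, since
-- substitutions enlarge the leading coefficients (t = 2 m, m = 2 m′, …). Therefore the degree of the
-- pivot a is lowered until a divides all entries over ℚ[t]. Then M = (a / v) u with an integer v and u
-- having the constant v as pivot, and for constant pivots the usual algorithm terminates.
--
-- The diagonal form so obtained agrees with the given D by uniqueness of the Smith normal form. If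
-- P · diag e = diag d · Q with P unimodular, then d p divides e p * P i l for all l ≤ p ≤ i; each
-- term of the Laplace expansion of det P contains such an entry, so d p divides e p * det P = ± e p.
module Submission where

open import Defs
open import Data.Nat as ℕ using (ℕ; zero; suc)
import Data.Nat.Properties as ℕₚ
open import Data.Integer using (ℤ; +_; -[1+_]; 0ℤ; 1ℤ; -1ℤ; _+_; _*_; _-_; -_; _^_; ∣_∣)
import Data.Integer as ℤ
import Data.Integer.Properties as ℤₚ
open import Data.Integer.Tactic.RingSolver using (solve-∀)
open import Data.Product using (Σ; _×_; _,_; proj₁; proj₂; map₂)
open import Data.Sum using (_⊎_; inj₁; inj₂)
open import Data.Empty using (⊥-elim)
import Data.Fin as Fin
open import Data.Fin using (Fin; zero; suc; toℕ; punchIn; inject₁)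
open import Data.Fin.Properties using (toℕ-inject₁; toℕ-fromℕ<; toℕ-injective; toℕ<n)
open import Data.Integer.Divisibility.Signed using (_∣_; divides; ∣m∣n⇒∣m+n; ∣n⇒∣m*n; ∣m⇒∣m*n; *-monoˡ-∣; ∣-refl; ∣-trans; ∣m⇒∣-m; ∣⇒∣ᵤ; ∣ᵤ⇒∣)
open import Relation.Nullary using (¬_; yes; no)
open import Relation.Binary.PropositionalEquality using (_≡_; _≢_; refl; sym; trans; cong; cong₂; subst; module ≡-Reasoning)
open import Relation.Binary.Definitions using (tri<; tri≈; tri>)
open import Data.Nat.Induction using (<-wellFounded)
open import Induction.WellFounded using (Acc; acc)
import Data.Integer.DivMod as ℤ%
open import Data.Nat.Tactic.RingSolver renaming (solve-∀ to solveℕ-∀) using ()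
open import Data.Nat.DivMod using (_/_; _%_; _mod_; m≡m%n+[m/n]*n; m%n<n; m*n/n≡m; /-monoˡ-≤; [m+kn]%n≡m%n; m<n⇒m%n≡m; m<n⇒m/n≡0; +-distrib-/-∣ʳ)
open import Data.Nat.Divisibility as ℕ∣ using (divides-refl)
open import Data.Unit using (⊤; tt)
import Data.Rational as ℚ
import Data.Rational.Properties as ℚₚ
import Data.Rational.Solver
import Data.Rational.Unnormalised as ℚᵘ
open import Data.Rational.Unnormalised using (mkℚᵘ)
import Data.Rational.Unnormalised.Properties as ℚᵘₚ
open import Data.List using ([]; _∷_)

-- Integer polynomials as functions

-- Substitutions t ↦ S t + i preserve degrees and constants, but multiply leading coefficients.
-- Hence degrees and constant pivots are the two measures that can drive a recursion whose
-- splittings are not known in advance. The pivoting argument is proved once, for any measure stable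
-- under substitution, and used for both. The factor a / v need not be integral. But the operations
-- that reduce u reduce M as well, and afterwards the pivot of M divides all entries over ℤ[t].
-- Polynomials are functions on ℕ together with a proof of a degree bound, so that substitution is
-- composition and identities are pointwise ones for the ring solver. Invertible matrices are built
-- as products of elementary ones, whereas the given normal form comes with matrices of determinant
-- ±1 only; the algorithm itself, run on a constant matrix, closes this gap. Finally the matrices
-- found on finitely many progressions are glued to functions on ℕ.

data Deg< : ℕ → (ℕ → ℤ) → Set where
  null : ∀ {f} → (∀ n → f n ≡ 0ℤ) → Deg< 0 f
  lead : ∀ {d f} c g → Deg< d g → (∀ n → f n ≡ c * (+ n) ^ d + g n) → Deg< (suc d) f

-- The coefficient `c` may vanish, so that the cancellation of a leading term can be expressed as
-- `Lead d 0ℤ f`; only `HasDegree` excludes this.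
record Lead (d : ℕ) (c : ℤ) (f : ℕ → ℤ) : Set where
  constructor mkLead
  field
    rest     : ℕ → ℤ
    rest-deg : Deg< d rest
    expand   : ∀ n → f n ≡ c * (+ n) ^ d + rest n

IsPoly : (ℕ → ℤ) → Set
IsPoly f = Σ ℕ λ d → Deg< d f

HasDegree : ℕ → (ℕ → ℤ) → Set
HasDegree d f = Σ ℤ λ c → c ≢ 0ℤ × Lead d c f

Lead⇒Deg< : ∀ {d c f} → Lead d c f → Deg< (suc d) f
Lead⇒Deg< {c = c} (mkLead g p e) = lead c g p e

Lead⇒IsPoly : ∀ {d c f} → Lead d c f → IsPoly f
Lead⇒IsPoly l = _ , Lead⇒Deg< l

Deg<-cong : ∀ {d f g} → (∀ n → g n ≡ f n) → Deg< d f → Deg< d g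
Deg<-cong e (null z)        = null λ n → trans (e n) (z n)
Deg<-cong e (lead c h p eq) = lead c h p λ n → trans (e n) (eq n)

Lead-cong : ∀ {d c f g} → (∀ n → g n ≡ f n) → Lead d c f → Lead d c g
Lead-cong e (mkLead h p eq) = mkLead h p λ n → trans (e n) (eq n)

IsPoly-cong : ∀ {f g} → (∀ n → g n ≡ f n) → IsPoly f → IsPoly g
IsPoly-cong e (d , p) = d , Deg<-cong e p

Deg<-suc : ∀ {d f} → Deg< d f → Deg< (suc d) f
Deg<-suc {d} {f} p = lead 0ℤ f p λ n → sym (ℤₚ.+-identityˡ (f n))

Deg<-≤ : ∀ {d e f} → d ℕ.≤ e → Deg< d f → Deg< e f
Deg<-≤ {d} {e} {f} d≤e p = subst (λ x → Deg< x f) (ℕₚ.m∸n+n≡m d≤e) (go (e ℕ.∸ d))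
  where
  go : ∀ k → Deg< (k ℕ.+ d) f
  go zero    = p
  go (suc k) = Deg<-suc (go k)

private
  linear-lead : ∀ a b x u v s → (a * x + u) + s * (b * x + v) ≡ (a + s * b) * x + (u + s * v)
  linear-lead = solve-∀

Deg<-linear : ∀ {d f g} s → Deg< d f → Deg< d g → Deg< d (λ n → f n + s * g n)
Deg<-linear s (null z) (null z′) =
  null λ n → trans (cong₂ (λ x y → x + s * y) (z n) (z′ n)) (trans (ℤₚ.+-identityˡ _) (ℤₚ.*-zeroʳ s))
Deg<-linear {suc d} s (lead a u p e) (lead b v q e′) =
  lead (a + s * b) _ (Deg<-linear s p q) λ n →
    trans (cong₂ (λ x y → x + s * y) (e n) (e′ n)) (linear-lead a b ((+ n) ^ d) (u n) (v n) s)

Lead-linear : ∀ {d a b f g} s → Lead d a f → Lead d b g → Lead d (a + s * b) (λ n → f n + s * g n)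
Lead-linear {d} {a} {b} s (mkLead u p e) (mkLead v q e′) = mkLead _ (Deg<-linear s p q) λ n →
    trans (cong₂ (λ x y → x + s * y) (e n) (e′ n)) (linear-lead a b ((+ n) ^ d) (u n) (v n) s)

Deg<-0 : ∀ d → Deg< d (λ _ → 0ℤ)
Deg<-0 d = Deg<-≤ (ℕ.z≤n {d}) (null λ _ → refl)

Deg<-scale : ∀ {d f} s → Deg< d f → Deg< d (λ n → s * f n)
Deg<-scale {d} s p = Deg<-cong (λ n → sym (ℤₚ.+-identityˡ _)) (Deg<-linear s (Deg<-0 d) p)

Deg<-+ : ∀ {d f g} → Deg< d f → Deg< d g → Deg< d (λ n → f n + g n)
Deg<-+ {f = f} {g} p q = Deg<-cong (λ n → cong (λ x → f n + x) (sym (ℤₚ.*-identityˡ (g n)))) (Deg<-linear 1ℤ p q)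

Lead-scale : ∀ {d a f} s → Lead d a f → Lead d (s * a) (λ n → s * f n)
Lead-scale {d} {a} s (mkLead u p e) = mkLead _ (Deg<-scale s p) λ n →
    trans (cong (s *_) (e n)) (trans (ℤₚ.*-distribˡ-+ s _ _) (cong (_+ s * u n) (sym (ℤₚ.*-assoc s a ((+ n) ^ d)))))

Lead-+Deg< : ∀ {d a f g} → Lead d a f → Deg< d g → Lead d a (λ n → f n + g n)
Lead-+Deg< {d} {a} {g = g} (mkLead u p e) q = mkLead _ (Deg<-+ p q) λ n →
  trans (cong (_+ g n) (e n)) (ℤₚ.+-assoc (a * (+ n) ^ d) (u n) (g n))

private
  shift-lead : ∀ c x y g → x * (c * y + g) ≡ c * (x * y) + x * g
  shift-lead = solve-∀

Deg<-shift : ∀ {d f} → Deg< d f → Deg< (suc d) (λ n → + n * f n)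
Deg<-shift (null z) = Deg<-suc (null λ n → trans (cong (+ n *_) (z n)) (ℤₚ.*-zeroʳ (+ n)))
Deg<-shift {suc d} (lead c g p e) = lead c _ (Deg<-shift p) λ n →
  trans (cong (+ n *_) (e n)) (shift-lead c (+ n) ((+ n) ^ d) (g n))

Lead-shift : ∀ {d c f} → Lead d c f → Lead (suc d) c (λ n → + n * f n)
Lead-shift {d} {c} (mkLead g p e) = mkLead _ (Deg<-shift p) λ n →
  trans (cong (+ n *_) (e n)) (shift-lead c (+ n) ((+ n) ^ d) (g n))

Lead-monomial : ∀ k {d c f} → Lead d c f → Lead (k ℕ.+ d) c (λ n → (+ n) ^ k * f n)
Lead-monomial zero    {f = f} l = Lead-cong (λ n → ℤₚ.*-identityˡ (f n)) l
Lead-monomial (suc k) {f = f} l = Lead-cong (λ n → ℤₚ.*-assoc (+ n) ((+ n) ^ k) (f n)) (Lead-shift (Lead-monomial k l))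

Lead-const : ∀ c → Lead 0 c (λ _ → c)
Lead-const c = mkLead (λ _ → 0ℤ) (null λ _ → refl) λ n → sym (trans (ℤₚ.+-identityʳ _) (ℤₚ.*-identityʳ c))

Lead-pow : ∀ d → Lead d 1ℤ (λ n → (+ n) ^ d)
Lead-pow d = mkLead (λ _ → 0ℤ) (Deg<-0 d) λ n → sym (trans (ℤₚ.+-identityʳ _) (ℤₚ.*-identityˡ _))

IsPoly-const : ∀ c → IsPoly (λ _ → c)
IsPoly-const c = Lead⇒IsPoly (Lead-const c)

IsPoly-+ : ∀ {f g} → IsPoly f → IsPoly g → IsPoly (λ n → f n + g n)
IsPoly-+ (d , p) (e , q) = d ℕ.+ e , Deg<-+ (Deg<-≤ (ℕₚ.m≤m+n d e) p) (Deg<-≤ (ℕₚ.m≤n+m e d) q)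

IsPoly-scale : ∀ {f} s → IsPoly f → IsPoly (λ n → s * f n)
IsPoly-scale s (d , p) = d , Deg<-scale s p

IsPoly-neg : ∀ {f} → IsPoly f → IsPoly (λ n → - f n)
IsPoly-neg {f} p = IsPoly-cong (λ n → sym (ℤₚ.-1*i≡-i (f n))) (IsPoly-scale -1ℤ p)

IsPoly-pow : ∀ d → IsPoly (λ n → (+ n) ^ d)
IsPoly-pow d = Lead⇒IsPoly (Lead-pow d)

IsPoly-monomial* : ∀ k {f} → IsPoly f → IsPoly (λ n → (+ n) ^ k * f n)
IsPoly-monomial* zero    {f} p = IsPoly-cong (λ n → ℤₚ.*-identityˡ (f n)) p
IsPoly-monomial* (suc k) {f} p with IsPoly-monomial* k p
... | d , q = suc d , Deg<-cong (λ n → ℤₚ.*-assoc (+ n) ((+ n) ^ k) (f n)) (Deg<-shift q)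

IsPoly-* : ∀ {f g} → IsPoly f → IsPoly g → IsPoly (λ n → f n * g n)
IsPoly-* {f} {g} (_ , p) q = go p
  where
  id : ∀ c x r y → (c * x + r) * y ≡ c * (x * y) + r * y
  id = solve-∀
  go : ∀ {d f} → Deg< d f → IsPoly (λ n → f n * g n)
  go (null z) = IsPoly-cong (λ n → cong (_* g n) (z n)) (IsPoly-const 0ℤ)
  go {suc d} (lead c r p e) = IsPoly-cong (λ n → trans (cong (_* g n) (e n)) (id c ((+ n) ^ d) (r n) (g n)))
    (IsPoly-+ (IsPoly-scale c (IsPoly-monomial* d q)) (go p))

IsPoly-sum : ∀ {m} {f : ℕ → Fin m → ℤ} → (∀ i → IsPoly (λ n → f n i)) → IsPoly (λ n → sumℤ (f n))
IsPoly-sum {zero}  p = IsPoly-const 0ℤ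
IsPoly-sum {suc m} p = IsPoly-+ (p zero) (IsPoly-sum (λ i → p (suc i)))

pos-affine : ∀ S n N → + (S ℕ.* n ℕ.+ N) ≡ + S * + n + + N
pos-affine S n N = trans (ℤₚ.pos-+ (S ℕ.* n) N) (cong (_+ + N) (ℤₚ.pos-* S n))

Lead-affine-pow : ∀ S N d → Lead d ((+ S) ^ d) (λ n → (+ (S ℕ.* n ℕ.+ N)) ^ d)
Lead-affine-pow S N zero    = Lead-const 1ℤ
Lead-affine-pow S N (suc d) with Lead-affine-pow S N d
... | mkLead g p e = mkLead _
  (Deg<-+ (Deg<-scale (+ S) (Deg<-shift p)) (Deg<-scale (+ N) (lead ((+ S) ^ d) g p λ n → refl)))
  λ n → trans (cong₂ _*_ (pos-affine S n N) (e n)) (id (+ S) (+ n) (+ N) ((+ S) ^ d) ((+ n) ^ d) (g n))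
  where
  id : ∀ s x n t y g → (s * x + n) * (t * y + g) ≡ s * t * (x * y) + (s * (x * g) + n * (t * y + g))
  id = solve-∀

Deg<-affine : ∀ S N {d f} → Deg< d f → Deg< d (λ n → f (S ℕ.* n ℕ.+ N))
Deg<-affine S N (null z)           = null λ n → z _
Deg<-affine S N {suc d} (lead c g p e) = Deg<-cong (λ n → e _)
  (Deg<-+ (Deg<-scale c (Lead⇒Deg< (Lead-affine-pow S N d))) (Deg<-suc (Deg<-affine S N p)))

Lead-affine : ∀ S N {d c f} → Lead d c f → Lead d (c * (+ S) ^ d) (λ n → f (S ℕ.* n ℕ.+ N))
Lead-affine S N {d} {c} (mkLead g p e) =
  Lead-cong (λ n → e _) (Lead-+Deg< (Lead-scale c (Lead-affine-pow S N d)) (Deg<-affine S N p))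

IsPoly-affine : ∀ S N {f} → IsPoly f → IsPoly (λ n → f (S ℕ.* n ℕ.+ N))
IsPoly-affine S N (d , p) = d , Deg<-affine S N p

pow-nonzero : ∀ {s} d → s ≢ 0ℤ → s ^ d ≢ 0ℤ
pow-nonzero     zero    s≢0 ()
pow-nonzero {s} (suc d) s≢0 e with ℤₚ.i*j≡0⇒i≡0∨j≡0 s e
... | inj₁ z = s≢0 z
... | inj₂ z = pow-nonzero d s≢0 z

*-nonzero : ∀ {a b} → a ≢ 0ℤ → b ≢ 0ℤ → a * b ≢ 0ℤ
*-nonzero {a} a≢0 b≢0 e with ℤₚ.i*j≡0⇒i≡0∨j≡0 a e
... | inj₁ z = a≢0 z
... | inj₂ z = b≢0 z

*-cancelˡ : ∀ {a b c} → a ≢ 0ℤ → a * b ≡ a * c → b ≡ c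
*-cancelˡ {a} {b} {c} a≢0 = ℤₚ.*-cancelˡ-≡ a b c {{ℤ.≢-nonZero a≢0}}

HasDegree-affine : ∀ S N {d f} → HasDegree d f → HasDegree d (λ n → f (suc S ℕ.* n ℕ.+ N))
HasDegree-affine S N {d} (c , c≢0 , l) = _ , *-nonzero c≢0 (pow-nonzero {+ suc S} d λ ()) , Lead-affine (suc S) N l

-- Taylor expansion: the nonconstant coefficients of f (K t + i) are divisible by K.
affine-expansion : ∀ K i {f} → IsPoly f →
  Σ (ℕ → ℤ) λ h → IsPoly h × (∀ n → f (K ℕ.* n ℕ.+ i) ≡ f i + + K * h n)
affine-expansion K i (_ , p) = go p
  where
  pow : ∀ d → Σ (ℕ → ℤ) λ h → IsPoly h × (∀ n → (+ (K ℕ.* n ℕ.+ i)) ^ d ≡ (+ i) ^ d + + K * h n)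
  pow zero = (λ _ → 0ℤ) , IsPoly-const 0ℤ , λ n → sym (cong (λ x → 1ℤ + x) (ℤₚ.*-zeroʳ (+ K)))
  pow (suc d) with pow d
  ... | h , p , e = (λ n → (+ i) ^ d * + n + + (K ℕ.* n ℕ.+ i) * h n) ,
    IsPoly-+ (IsPoly-scale ((+ i) ^ d) (IsPoly-cong (λ n → sym (ℤₚ.*-identityʳ (+ n))) (IsPoly-pow 1)))
      (IsPoly-* (IsPoly-cong (λ n → sym (ℤₚ.*-identityʳ (+ (K ℕ.* n ℕ.+ i)))) (Lead⇒IsPoly (Lead-affine-pow K i 1))) p) ,
    λ n → trans (cong (+ (K ℕ.* n ℕ.+ i) *_) (e n))
      (trans (cong (λ x → x * ((+ i) ^ d + + K * h n)) (pos-affine K n i))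
      (trans (id (+ K) (+ n) (+ i) ((+ i) ^ d) (h n))
        (cong (λ x → + i * (+ i) ^ d + + K * ((+ i) ^ d * + n + x * h n)) (sym (pos-affine K n i)))))
    where
    id : ∀ k n i y h → (k * n + i) * (y + k * h) ≡ i * y + k * (y * n + (k * n + i) * h)
    id = solve-∀
  id₂ : ∀ c x k h y g → c * (x + k * h) + (y + k * g) ≡ c * x + y + k * (c * h + g)
  id₂ = solve-∀
  go : ∀ {d f} → Deg< d f → Σ (ℕ → ℤ) λ h → IsPoly h × (∀ n → f (K ℕ.* n ℕ.+ i) ≡ f i + + K * h n)
  go (null z) = (λ _ → 0ℤ) , IsPoly-const 0ℤ , λ n →
    trans (z _) (sym (cong₂ _+_ (z i) (ℤₚ.*-zeroʳ (+ K))))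
  go {suc d} (lead c g p e) with pow d | go p
  ... | h , q , e₁ | k , r , e₂ = _ , IsPoly-+ (IsPoly-scale c q) r , λ n →
    trans (e _) (trans (cong₂ (λ x y → c * x + y) (e₁ n) (e₂ n))
      (trans (id₂ c ((+ i) ^ d) (+ K) (h n) (g i) (k n)) (cong (_+ _) (sym (e i)))))

-- Degree and sign for large arguments

degree? : ∀ {d f} → Deg< d f → (∀ n → f n ≡ 0ℤ) ⊎ Σ ℕ λ e → e ℕ.< d × HasDegree e f
degree? (null z) = inj₁ z
degree? {suc d} (lead c g p e) with c ℤ.≟ 0ℤ
... | no c≢0 = inj₂ (d , ℕₚ.≤-refl , c , c≢0 , mkLead g p e)
... | yes refl with degree? (Deg<-cong (λ n → trans (e n) (ℤₚ.+-identityˡ (g n))) p)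
...   | inj₁ z              = inj₁ z
...   | inj₂ (d′ , lt , h)  = inj₂ (d′ , ℕₚ.m<n⇒m<1+n lt , h)

0≤pow : ∀ n d → 0ℤ ℤ.≤ (+ n) ^ d
0≤pow n zero    = ℤ.+≤+ ℕ.z≤n
0≤pow n (suc d) = subst (ℤ._≤ + n * (+ n) ^ d) (ℤₚ.*-zeroʳ (+ n)) (ℤₚ.*-monoˡ-≤-nonNeg (+ n) (0≤pow n d))

-∣i∣≤i : ∀ i → - (+ ∣ i ∣) ℤ.≤ i
-∣i∣≤i (+ zero)  = ℤₚ.≤-refl
-∣i∣≤i (+ suc n) = ℤ.-≤+
-∣i∣≤i -[1+ n ]  = ℤₚ.≤-refl

-- B is the sum of the absolute values of the coefficients. The factor n on the right replaces the
-- exponent d - 1, which would exclude d = 0.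
Deg<-lower-bound : ∀ {d f} → Deg< d f → Σ ℕ λ B → ∀ n → - (+ B) * (+ n) ^ d ℤ.≤ + n * f n
Deg<-lower-bound (null z) = 0 , λ n → ℤₚ.≤-reflexive (sym (trans (cong (+ n *_) (z n)) (ℤₚ.*-zeroʳ (+ n))))
Deg<-lower-bound {suc d} {f} (lead c g p e) with Deg<-lower-bound p
... | B , bd = ∣ c ∣ ℕ.+ B , λ n → begin
    - (+ (∣ c ∣ ℕ.+ B)) * (+ n) ^ suc d
      ≡⟨ trans (cong (λ x → - x * (+ n) ^ suc d) (ℤₚ.pos-+ ∣ c ∣ B)) (id₁ (+ ∣ c ∣) (+ B) ((+ n) ^ suc d)) ⟩
    - (+ ∣ c ∣) * (+ n) ^ suc d + - (+ B) * (+ n) ^ suc d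
      ≤⟨ ℤₚ.+-mono-≤ (mulpow (suc d) n (-∣i∣≤i c)) (B-bound n) ⟩
    c * (+ n) ^ suc d + + n * g n
      ≡⟨ id₂ c (+ n) ((+ n) ^ d) (g n) ⟩
    + n * (c * (+ n) ^ d + g n)
      ≡⟨ cong (+ n *_) (sym (e n)) ⟩
    + n * f n ∎
  where
  open ℤₚ.≤-Reasoning
  id₁ : ∀ a b x → - (a + b) * x ≡ - a * x + - b * x
  id₁ = solve-∀
  id₂ : ∀ c n x g → c * (n * x) + n * g ≡ n * (c * x + g)
  id₂ = solve-∀
  mulpow : ∀ d n {a b} → a ℤ.≤ b → a * (+ n) ^ d ℤ.≤ b * (+ n) ^ d
  mulpow d n le = ℤₚ.*-monoʳ-≤-nonNeg ((+ n) ^ d) {{ℤ.nonNegative (0≤pow n d)}} le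
  B-bound : ∀ n → - (+ B) * (+ n) ^ suc d ℤ.≤ + n * g n
  B-bound zero = ℤₚ.≤-reflexive (ℤₚ.*-zeroʳ (- (+ B)))
  B-bound n@(suc _) = ℤₚ.≤-trans (ℤₚ.*-monoˡ-≤-nonPos (- (+ B)) {{ℤ.nonPositive (ℤₚ.neg-mono-≤ (ℤ.+≤+ ℕ.z≤n))}}
    (subst (ℤ._≤ (+ n) ^ suc d) (ℤₚ.*-identityˡ _) (mulpow d n {1ℤ} {+ n} (ℤ.+≤+ (ℕ.s≤s ℕ.z≤n))))) (bd n)

-- Since c ≥ 1, n f(n) is at least n^(d+1) - B n^d = (n - B) n^d, which is positive for n > B.
Lead-eventually-positive : ∀ {d c f} → 0ℤ ℤ.< c → Lead d c f → Eventually λ n → 0ℤ ℤ.< f n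
Lead-eventually-positive {d} {c} {f} 0<c (mkLead g p e) with Deg<-lower-bound p
... | B , bd = suc B , λ where
    n@(suc m) B<n → ℤₚ.*-cancelˡ-<-nonNeg (+ n) (subst (ℤ._< + n * f n) (sym (ℤₚ.*-zeroʳ (+ n))) (begin-strict
      0ℤ ≡⟨ sym (ℤₚ.*-zeroˡ ((+ n) ^ d)) ⟩
      0ℤ * (+ n) ^ d <⟨ ℤₚ.*-monoʳ-<-pos ((+ n) ^ d) {{ℤ.positive (0<pow m d)}} (0<n-B B<n) ⟩
      (+ n - + B) * (+ n) ^ d ≡⟨ id₁ (+ n) (+ B) ((+ n) ^ d) ⟩
      1ℤ * (+ n) ^ suc d + - (+ B) * (+ n) ^ d
        ≤⟨ ℤₚ.+-mono-≤ (ℤₚ.*-monoʳ-≤-nonNeg ((+ n) ^ suc d) {{ℤ.nonNegative (0≤pow n (suc d))}} (ℤₚ.i<j⇒suc[i]≤j 0<c)) (bd n) ⟩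
      c * (+ n) ^ suc d + + n * g n ≡⟨ id₂ c (+ n) ((+ n) ^ d) (g n) ⟩
      + n * (c * (+ n) ^ d + g n) ≡⟨ cong (+ n *_) (sym (e n)) ⟩
      + n * f n ∎))
  where
  open ℤₚ.≤-Reasoning
  id₁ : ∀ n b x → (n - b) * x ≡ 1ℤ * (n * x) + - b * x
  id₁ = solve-∀
  id₂ : ∀ c n x g → c * (n * x) + n * g ≡ n * (c * x + g)
  id₂ = solve-∀
  0<n-B : ∀ {n} → B ℕ.< n → 0ℤ ℤ.< + n - + B
  0<n-B {n} B<n = subst (ℤ._< + n - + B) (ℤₚ.+-inverseʳ (+ B)) (ℤₚ.+-monoˡ-< (- (+ B)) (ℤ.+<+ B<n))
  0<pow : ∀ m d → 0ℤ ℤ.< (+ suc m) ^ d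
  0<pow m zero    = ℤ.+<+ (ℕ.s≤s ℕ.z≤n)
  0<pow m (suc d) = subst (ℤ._< + suc m * (+ suc m) ^ d) (ℤₚ.*-zeroʳ (+ suc m)) (ℤₚ.*-monoˡ-<-pos (+ suc m) (0<pow m d))

sign-eventually-constant : ∀ {f} → IsPoly f →
  Eventually (λ n → 0ℤ ℤ.≤ f n) ⊎ Eventually (λ n → 0ℤ ℤ.≤ - f n)
sign-eventually-constant {f} (d , p) with degree? p
... | inj₁ z = inj₁ (0 , λ n _ → ℤₚ.≤-reflexive (sym (z n)))
... | inj₂ (e , _ , c , c≢0 , l) with ℤₚ.<-cmp 0ℤ c
...   | tri< 0<c _ _ = inj₁ (map₂ (λ h n le → ℤₚ.<⇒≤ (h n le)) (Lead-eventually-positive 0<c l))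
...   | tri≈ _ 0≡c _ = ⊥-elim (c≢0 (sym 0≡c))
...   | tri> _ _ c<0 = inj₂ (map₂ (λ h n le → subst (0ℤ ℤ.≤_) (ℤₚ.-1*i≡-i (f n)) (ℤₚ.<⇒≤ (h n le)))
        (Lead-eventually-positive (subst (0ℤ ℤ.<_) (sym (ℤₚ.-1*i≡-i c)) (ℤₚ.neg-mono-< c<0)) (Lead-scale -1ℤ l)))

HasDegree⇒nonzero : ∀ {d f} → HasDegree d f → ¬ (∀ n → f n ≡ 0ℤ)
HasDegree⇒nonzero (c , c≢0 , l) z with ℤₚ.<-cmp 0ℤ c
... | tri< 0<c _ _ with Lead-eventually-positive 0<c l
...   | N , h = ℤₚ.<-irrefl (sym (z N)) (h N ℕₚ.≤-refl)
HasDegree⇒nonzero (c , c≢0 , l) z | tri≈ _ 0≡c _ = c≢0 (sym 0≡c)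
HasDegree⇒nonzero (c , c≢0 , l) z | tri> _ _ c<0
  with Lead-eventually-positive (subst (0ℤ ℤ.<_) (sym (ℤₚ.-1*i≡-i c)) (ℤₚ.neg-mono-< c<0)) (Lead-scale -1ℤ l)
...   | N , h = ℤₚ.<-irrefl (sym (trans (cong (-1ℤ *_) (z N)) (ℤₚ.*-zeroʳ -1ℤ))) (h N ℕₚ.≤-refl)

-- If d < e, then f - f would have degree e: the subtracted copy, read through the first expansion,
-- has degree at most d and leaves the leading term of the other one intact.
HasDegree-≤ : ∀ {d e f} → HasDegree d f → HasDegree e f → e ℕ.≤ d
HasDegree-≤ {d} {e} {f} (_ , _ , l) (c , c≢0 , l′) with e ℕ.≤? d
... | yes e≤d = e≤d
... | no e≰d = ⊥-elim (HasDegree⇒nonzero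
  (c , c≢0 , Lead-+Deg< l′ (Deg<-≤ (ℕₚ.≰⇒> e≰d) (Deg<-scale -1ℤ (Lead⇒Deg< l))))
  λ n → trans (cong (λ x → f n + x) (ℤₚ.-1*i≡-i (f n))) (ℤₚ.+-inverseʳ (f n)))

-- In `degree-combine` only an integer multiple of the new pivot has a visible leading term.
HasDegree-unscale : ∀ {v d f} → v ≢ 0ℤ → IsPoly f → HasDegree d (λ n → v * f n) → HasDegree d f
HasDegree-unscale {v} {d} {f} v≢0 (_ , p) h with degree? p
... | inj₁ z = ⊥-elim (HasDegree⇒nonzero h λ n → trans (cong (v *_) (z n)) (ℤₚ.*-zeroʳ v))
... | inj₂ (e , _ , hf@(c , c≢0 , l)) = subst (λ x → HasDegree x f)
  (ℕₚ.≤-antisym (HasDegree-≤ h vh) (HasDegree-≤ vh h)) hf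
  where vh = v * c , *-nonzero v≢0 c≢0 , Lead-scale v l

-- Sums and matrices

sum-cong : ∀ {n} {f g : Fin n → ℤ} → (∀ i → f i ≡ g i) → sumℤ f ≡ sumℤ g
sum-cong {zero}  e = refl
sum-cong {suc n} e = cong₂ _+_ (e zero) (sum-cong (λ i → e (suc i)))

sum-zero : ∀ {n} {f : Fin n → ℤ} → (∀ i → f i ≡ 0ℤ) → sumℤ f ≡ 0ℤ
sum-zero {zero}  e = refl
sum-zero {suc n} e = cong₂ _+_ (e zero) (sum-zero (λ i → e (suc i)))

sum-linear : ∀ {n} c (f g : Fin n → ℤ) → sumℤ (λ i → f i + c * g i) ≡ sumℤ f + c * sumℤ g
sum-linear {zero}  c f g = sym (trans (ℤₚ.+-identityˡ _) (ℤₚ.*-zeroʳ c))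
sum-linear {suc n} c f g = trans (cong (λ x → f zero + c * g zero + x) (sum-linear c (λ i → f (suc i)) (λ i → g (suc i))))
  (id (f zero) (g zero) c (sumℤ (λ i → f (suc i))) (sumℤ (λ i → g (suc i))))
  where
  id : ∀ f g c s t → f + c * g + (s + c * t) ≡ f + s + c * (g + t)
  id = solve-∀

sum-+ : ∀ {n} (f g : Fin n → ℤ) → sumℤ (λ i → f i + g i) ≡ sumℤ f + sumℤ g
sum-+ f g = trans (sum-cong λ i → cong (λ x → f i + x) (sym (ℤₚ.*-identityˡ (g i))))
  (trans (sum-linear 1ℤ f g) (cong (λ x → sumℤ f + x) (ℤₚ.*-identityˡ (sumℤ g))))

sum-*ˡ : ∀ {n} c (f : Fin n → ℤ) → sumℤ (λ i → c * f i) ≡ c * sumℤ f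
sum-*ˡ {zero}  c f = sym (ℤₚ.*-zeroʳ c)
sum-*ˡ {suc n} c f = trans (cong (λ x → c * f zero + x) (sum-*ˡ c (λ i → f (suc i)))) (sym (ℤₚ.*-distribˡ-+ c (f zero) (sumℤ (λ i → f (suc i)))))

sum-*ʳ : ∀ {n} c (f : Fin n → ℤ) → sumℤ (λ i → f i * c) ≡ sumℤ f * c
sum-*ʳ c f = trans (sum-cong (λ i → ℤₚ.*-comm (f i) c)) (trans (sum-*ˡ c f) (ℤₚ.*-comm c (sumℤ f)))

sum-swap : ∀ {m n} (f : Fin m → Fin n → ℤ) → sumℤ (λ i → sumℤ (λ j → f i j)) ≡ sumℤ (λ j → sumℤ (λ i → f i j))
sum-swap {zero} {n} f = sym (sum-zero {n} {λ j → 0ℤ} λ j → refl)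
sum-swap {suc m} f = trans (cong (λ x → sumℤ (f zero) + x) (sum-swap (λ i → f (suc i))))
  (sym (sum-+ (f zero) (λ j → sumℤ (λ i → f (suc i) j))))

diag : ∀ {k s} → (ℕ → ℤ) → Mat k s
diag d zero    zero    = d 0
diag d zero    (suc j) = 0ℤ
diag d (suc i) zero    = 0ℤ
diag d (suc i) (suc j) = diag (λ p → d (suc p)) i j

δ : ∀ {n} → Mat n n
δ = diag (λ _ → 1ℤ)

δ-refl : ∀ {n} (i : Fin n) → δ i i ≡ 1ℤ
δ-refl zero    = refl
δ-refl (suc i) = δ-refl i

δ-sym : ∀ {n} (i j : Fin n) → δ i j ≡ δ j i
δ-sym zero    zero    = refl
δ-sym zero    (suc j) = refl
δ-sym (suc i) zero    = refl
δ-sym (suc i) (suc j) = δ-sym i j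

δ-≢ : ∀ {n} {i j : Fin n} → i ≢ j → δ i j ≡ 0ℤ
δ-≢ {i = zero}  {zero}  i≢j = ⊥-elim (i≢j refl)
δ-≢ {i = zero}  {suc j} i≢j = refl
δ-≢ {i = suc i} {zero}  i≢j = refl
δ-≢ {i = suc i} {suc j} i≢j = δ-≢ λ e → i≢j (cong suc e)

sum-δˡ : ∀ {n} (i : Fin n) (f : Fin n → ℤ) → sumℤ (λ l → δ i l * f l) ≡ f i
sum-δˡ zero    f = trans (cong₂ _+_ (ℤₚ.*-identityˡ (f zero)) (sum-zero {f = λ l → 0ℤ * f (suc l)} λ l → refl)) (ℤₚ.+-identityʳ (f zero))
sum-δˡ (suc i) f = trans (ℤₚ.+-identityˡ _) (sum-δˡ i (λ l → f (suc l)))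

infix 4 _≈_
_≈_ : ∀ {a b} → Mat a b → Mat a b → Set
_≈_ = _≈M_

≈-sym : ∀ {a b} {A B : Mat a b} → A ≈ B → B ≈ A
≈-sym e i j = sym (e i j)

≈-trans : ∀ {a b} {A B C : Mat a b} → A ≈ B → B ≈ C → A ≈ C
≈-trans e f i j = trans (e i j) (f i j)

·-congˡ : ∀ {a b c} (A : Mat a b) {B B′ : Mat b c} → B ≈ B′ → (A · B) ≈ (A · B′)
·-congˡ A f i j = sum-cong λ l → cong (A i l *_) (f l j)

·-congʳ : ∀ {a b c} (B : Mat b c) {A A′ : Mat a b} → A ≈ A′ → (A · B) ≈ (A′ · B)
·-congʳ B e i j = sum-cong λ l → cong (_* B l j) (e i l)

·-assoc : ∀ {a b c d} (A : Mat a b) (B : Mat b c) (C : Mat c d) → ((A · B) · C) ≈ (A · (B · C))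
·-assoc A B C i j = begin
  sumℤ (λ l → sumℤ (λ m → A i m * B m l) * C l j)
    ≡⟨ sum-cong (λ l → sym (sum-*ʳ (C l j) (λ m → A i m * B m l))) ⟩
  sumℤ (λ l → sumℤ (λ m → A i m * B m l * C l j))
    ≡⟨ sum-swap (λ l m → A i m * B m l * C l j) ⟩
  sumℤ (λ m → sumℤ (λ l → A i m * B m l * C l j))
    ≡⟨ sum-cong (λ m → trans (sum-cong λ l → ℤₚ.*-assoc (A i m) (B m l) (C l j)) (sum-*ˡ (A i m) (λ l → B m l * C l j))) ⟩
  sumℤ (λ m → A i m * sumℤ (λ l → B m l * C l j)) ∎
  where open ≡-Reasoning

·-identityˡ : ∀ {a b} (A : Mat a b) → (δ · A) ≈ A
·-identityˡ A i j = sum-δˡ i (λ l → A l j)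

·-identityʳ : ∀ {a b} (A : Mat a b) → (A · δ) ≈ A
·-identityʳ A i j = trans (sum-cong λ l → trans (ℤₚ.*-comm (A i l) (δ l j)) (cong (_* A i l) (δ-sym l j))) (sum-δˡ j (A i))

infix 25 _ᵀ
_ᵀ : ∀ {a b} → Mat a b → Mat b a
(A ᵀ) i j = A j i

·-ᵀ : ∀ {a b c} (A : Mat a b) (B : Mat b c) → ((A · B) ᵀ) ≈ (B ᵀ · A ᵀ)
·-ᵀ A B i j = sum-cong λ l → ℤₚ.*-comm (A j l) (B l i)

-- For i = j and c = -2 this negates row i.
rowAdd : ∀ {a b} → Fin a → Fin a → ℤ → Mat a b → Mat a b
rowAdd i j c A p q = A p q + δ p i * (c * A j q)

rowAdd-same : ∀ {a b} (i j : Fin a) c (A : Mat a b) q → rowAdd i j c A i q ≡ A i q + c * A j q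
rowAdd-same i j c A q = cong (λ x → A i q + x) (trans (cong (_* (c * A j q)) (δ-refl i)) (ℤₚ.*-identityˡ (c * A j q)))

rowAdd-other : ∀ {a b} {i p : Fin a} (j : Fin a) c (A : Mat a b) q → p ≢ i → rowAdd i j c A p q ≡ A p q
rowAdd-other {p = p} j c A q p≢i = trans (cong (λ x → A p q + x * (c * A j q)) (δ-≢ p≢i)) (ℤₚ.+-identityʳ (A p q))

rowAdd-cong : ∀ {a b} (i j : Fin a) c {A B : Mat a b} → A ≈ B → rowAdd i j c A ≈ rowAdd i j c B
rowAdd-cong i j c e p q = cong₂ (λ x y → x + δ p i * (c * y)) (e p q) (e j q)

rowAdd-· : ∀ {a b c} (i j : Fin a) x (A : Mat a b) (B : Mat b c) → (rowAdd i j x A · B) ≈ rowAdd i j x (A · B)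
rowAdd-· i j x A B p q = begin
  sumℤ (λ l → (A p l + δ p i * (x * A j l)) * B l q)
    ≡⟨ sum-cong (λ l → id (A p l) (δ p i) x (A j l) (B l q)) ⟩
  sumℤ (λ l → A p l * B l q + δ p i * x * (A j l * B l q))
    ≡⟨ sum-linear (δ p i * x) (λ l → A p l * B l q) (λ l → A j l * B l q) ⟩
  (A · B) p q + δ p i * x * (A · B) j q
    ≡⟨ cong (λ y → (A · B) p q + y) (ℤₚ.*-assoc (δ p i) x ((A · B) j q)) ⟩
  rowAdd i j x (A · B) p q ∎
  where
  open ≡-Reasoning
  id : ∀ a d x b y → (a + d * (x * b)) * y ≡ a * y + d * x * (b * y)
  id = solve-∀

rowAdd-δ : ∀ {a b} (i j : Fin a) c (A : Mat a b) → (rowAdd i j c δ · A) ≈ rowAdd i j c A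
rowAdd-δ i j c A = ≈-trans (rowAdd-· i j c δ A) (rowAdd-cong i j c (·-identityˡ A))

-- Determinants

minor : ∀ {m n} → Fin (suc n) → Mat (suc m) (suc n) → Mat m n
minor j A a b = A (suc a) (punchIn j b)

det-cong : ∀ {n} {A B : Mat n n} → A ≈ B → det A ≡ det B
det-cong {zero}  e = refl
det-cong {suc n} e = sum-cong λ j → cong₂ (λ x y → sign (toℕ j) * (x * y)) (e zero j) (det-cong λ a b → e (suc a) (punchIn j b))

det-linear : ∀ {n} (i : Fin n) c {A B C : Mat n n} →
  (∀ a → a ≢ i → ∀ b → A a b ≡ B a b) → (∀ a → a ≢ i → ∀ b → C a b ≡ B a b) →
  (∀ b → A i b ≡ B i b + c * C i b) → det A ≡ det B + c * det C
det-linear {suc n} i c {A} {B} {C} AB CB eᵢ = begin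
  sumℤ (term A) ≡⟨ sum-cong (row i AB CB eᵢ) ⟩
  sumℤ (λ j → term B j + c * term C j) ≡⟨ sum-linear c (term B) (term C) ⟩
  sumℤ (term B) + c * sumℤ (term C) ∎
  where
  open ≡-Reasoning
  term : Mat (suc n) (suc n) → Fin (suc n) → ℤ
  term X j = sign (toℕ j) * (X zero j * det (minor j X))
  id₀ : ∀ s x c y m → s * ((x + c * y) * m) ≡ s * (x * m) + c * (s * (y * m))
  id₀ = solve-∀
  id₁ : ∀ s x c m m′ → s * (x * (m + c * m′)) ≡ s * (x * m) + c * (s * (x * m′))
  id₁ = solve-∀
  row : ∀ i → (∀ a → a ≢ i → ∀ b → A a b ≡ B a b) → (∀ a → a ≢ i → ∀ b → C a b ≡ B a b) →
    (∀ b → A i b ≡ B i b + c * C i b) → ∀ j → term A j ≡ term B j + c * term C j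
  row zero AB CB e j = begin
    term A j
      ≡⟨ cong₂ (λ x y → sign (toℕ j) * (x * y)) (e j) (det-cong λ a b → AB (suc a) (λ ()) (punchIn j b)) ⟩
    sign (toℕ j) * ((B zero j + c * C zero j) * det (minor j B))
      ≡⟨ id₀ (sign (toℕ j)) (B zero j) c (C zero j) (det (minor j B)) ⟩
    term B j + c * (sign (toℕ j) * (C zero j * det (minor j B)))
      ≡⟨ cong (λ y → term B j + c * (sign (toℕ j) * (C zero j * y))) (det-cong λ a b → sym (CB (suc a) (λ ()) (punchIn j b))) ⟩
    term B j + c * term C j ∎
  row (suc i) AB CB e j = begin
    term A j
      ≡⟨ cong₂ (λ x y → sign (toℕ j) * (x * y)) (AB zero (λ ()) j)
           (det-linear i c {minor j A} {minor j B} {minor j C}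
             (λ a a≢ b → AB (suc a) (λ { refl → a≢ refl }) (punchIn j b))
             (λ a a≢ b → CB (suc a) (λ { refl → a≢ refl }) (punchIn j b)) (λ b → e (punchIn j b))) ⟩
    sign (toℕ j) * (B zero j * (det (minor j B) + c * det (minor j C)))
      ≡⟨ id₁ (sign (toℕ j)) (B zero j) c (det (minor j B)) (det (minor j C)) ⟩
    term B j + c * (sign (toℕ j) * (B zero j * det (minor j C)))
      ≡⟨ cong (λ x → term B j + c * (sign (toℕ j) * (x * det (minor j C)))) (sym (CB zero (λ ()) j)) ⟩
    term B j + c * term C j ∎

-- A pair (j, k) stands for the ordered pair of distinct columns j and `punchIn j k`. For j ≤ k,
-- (`inject₁ j`, k) and (`suc k`, j) are the columns j and k + 1 in the two possible orders, so the
-- terms cancel in pairs. The induction removes `G zero k` together with `G (suc k) zero`.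
antisymmetric-sum : ∀ {n} (G : Fin (suc n) → Fin n → ℤ) →
  (∀ (j k : Fin n) → toℕ j ℕ.≤ toℕ k → G (inject₁ j) k + G (suc k) j ≡ 0ℤ) →
  sumℤ (λ j → sumℤ (G j)) ≡ 0ℤ
antisymmetric-sum {zero}  G h = refl
antisymmetric-sum {suc n} G h = begin
  sumℤ (G zero) + sumℤ (λ j → G (suc j) zero + sumℤ (λ k → G (suc j) (suc k)))
    ≡⟨ cong (λ x → sumℤ (G zero) + x) (sum-+ (λ j → G (suc j) zero) (λ j → sumℤ (λ k → G (suc j) (suc k)))) ⟩
  sumℤ (G zero) + (sumℤ (λ j → G (suc j) zero) + sumℤ (λ j → sumℤ (λ k → G (suc j) (suc k))))
    ≡⟨ cong (λ x → sumℤ (G zero) + (sumℤ (λ j → G (suc j) zero) + x))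
         (antisymmetric-sum (λ j k → G (suc j) (suc k)) λ j k j≤k → h (suc j) (suc k) (ℕ.s≤s j≤k)) ⟩
  sumℤ (G zero) + (sumℤ (λ j → G (suc j) zero) + 0ℤ)
    ≡⟨ cong (λ x → sumℤ (G zero) + x) (ℤₚ.+-identityʳ (sumℤ (λ j → G (suc j) zero))) ⟩
  sumℤ (G zero) + sumℤ (λ j → G (suc j) zero)
    ≡⟨ sym (sum-+ (G zero) (λ j → G (suc j) zero)) ⟩
  sumℤ (λ k → G zero k + G (suc k) zero)
    ≡⟨ sum-zero (λ k → h zero k ℕ.z≤n) ⟩
  0ℤ ∎
  where open ≡-Reasoning

punchIn-inject₁ : ∀ {n} (j k : Fin n) → toℕ j ℕ.≤ toℕ k → punchIn (inject₁ j) k ≡ suc k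
punchIn-inject₁ zero    k       _           = refl
punchIn-inject₁ (suc j) (suc k) (ℕ.s≤s j≤k) = cong suc (punchIn-inject₁ j k j≤k)

punchIn-suc : ∀ {n} (j k : Fin n) → toℕ j ℕ.≤ toℕ k → punchIn (suc k) j ≡ inject₁ j
punchIn-suc zero    k       _           = refl
punchIn-suc (suc j) (suc k) (ℕ.s≤s j≤k) = cong suc (punchIn-suc j k j≤k)

punchIn-punchIn : ∀ {n} (j k : Fin (suc n)) b → toℕ j ℕ.≤ toℕ k →
  punchIn (inject₁ j) (punchIn k b) ≡ punchIn (suc k) (punchIn j b)
punchIn-punchIn zero    k       b       _           = refl
punchIn-punchIn (suc j) (suc k) zero    _           = refl
punchIn-punchIn (suc j) (suc k) (suc b) (ℕ.s≤s j≤k) = cong suc (punchIn-punchIn j k b j≤k)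

sign-suc : ∀ n → sign (suc n) ≡ - sign n
sign-suc zero          = refl
sign-suc (suc zero)    = refl
sign-suc (suc (suc n)) = sign-suc n

-- Expansion along both rows gives a sum over ordered pairs of columns. Exchanging the two columns
-- preserves the remaining minor and, the rows being equal, the product of the two entries, but
-- reverses the sign.
det-equal-first-rows : ∀ {n} (A : Mat (suc (suc n)) (suc (suc n))) → (∀ b → A zero b ≡ A (suc zero) b) → det A ≡ 0ℤ
det-equal-first-rows {n} A eq = trans (sum-cong λ j → trans (cong (sign (toℕ j) *_) (sym (sum-*ˡ (A zero j) (λ k → inner j k))))
    (sym (sum-*ˡ (sign (toℕ j)) (λ k → A zero j * inner j k)))) (antisymmetric-sum G antisym)
  where
  M : Fin (suc (suc n)) → Fin (suc n) → ℤ
  M j k = det (minor k (minor j A))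
  inner : Fin (suc (suc n)) → Fin (suc n) → ℤ
  inner j k = sign (toℕ k) * (A (suc zero) (punchIn j k) * M j k)
  G : Fin (suc (suc n)) → Fin (suc n) → ℤ
  G j k = sign (toℕ j) * (A zero j * inner j k)
  id : ∀ s t x y m → s * (x * (t * (y * m))) + - t * (y * (s * (x * m))) ≡ 0ℤ
  id = solve-∀
  antisym : ∀ j k → toℕ j ℕ.≤ toℕ k → G (inject₁ j) k + G (suc k) j ≡ 0ℤ
  antisym j k j≤k = trans (cong₂ _+_
    (cong₂ (λ s y → s * (A zero (inject₁ j) * (sign (toℕ k) * (y * M (inject₁ j) k))))
      (cong sign (toℕ-inject₁ j)) (trans (cong (A (suc zero)) (punchIn-inject₁ j k j≤k)) (sym (eq (suc k)))))
    (trans (cong₂ (λ s x → s * (A zero (suc k) * (sign (toℕ j) * (x * M (suc k) j))))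
      (sign-suc (toℕ k)) (trans (cong (A (suc zero)) (punchIn-suc j k j≤k)) (sym (eq (inject₁ j)))))
      (cong (λ m → - sign (toℕ k) * (A zero (suc k) * (sign (toℕ j) * (A zero (inject₁ j) * m))))
        (det-cong λ a b → cong (A (suc (suc a))) (sym (punchIn-punchIn j k b j≤k))))))
    (id (sign (toℕ j)) (sign (toℕ k)) (A zero (inject₁ j)) (A zero (suc k)) (M (inject₁ j) k))

-- The signed transposition (Rᵢ, Rⱼ) ↦ (Rⱼ, −Rᵢ).
rowSwap : ∀ {a b} → Fin a → Fin a → Mat a b → Mat a b
rowSwap i j A = rowAdd i j 1ℤ (rowAdd j i -1ℤ (rowAdd i j 1ℤ A))

rowSwap-fst : ∀ {a b} {i j : Fin a} → i ≢ j → (A : Mat a b) → ∀ q → rowSwap i j A i q ≡ A j q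
rowSwap-fst {i = i} {j} i≢j A q = begin
  rowAdd i j 1ℤ B i q ≡⟨ rowAdd-same i j 1ℤ B q ⟩
  B i q + 1ℤ * B j q ≡⟨ cong₂ (λ x y → x + 1ℤ * y) (rowAdd-other i -1ℤ C q i≢j) (rowAdd-same j i -1ℤ C q) ⟩
  C i q + 1ℤ * (C j q + -1ℤ * C i q) ≡⟨ id (C i q) (C j q) ⟩
  C j q ≡⟨ rowAdd-other j 1ℤ A q (λ e → i≢j (sym e)) ⟩
  A j q ∎
  where
  open ≡-Reasoning
  C = rowAdd i j 1ℤ A
  B = rowAdd j i -1ℤ C
  id : ∀ x y → x + 1ℤ * (y + -1ℤ * x) ≡ y
  id = solve-∀

rowSwap-snd : ∀ {a b} {i j : Fin a} → i ≢ j → (A : Mat a b) → ∀ q → rowSwap i j A j q ≡ - A i q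
rowSwap-snd {i = i} {j} i≢j A q = begin
  rowAdd i j 1ℤ B j q ≡⟨ rowAdd-other j 1ℤ B q j≢i ⟩
  B j q ≡⟨ rowAdd-same j i -1ℤ C q ⟩
  C j q + -1ℤ * C i q ≡⟨ cong₂ (λ x y → x + -1ℤ * y) (rowAdd-other j 1ℤ A q j≢i) (rowAdd-same i j 1ℤ A q) ⟩
  A j q + -1ℤ * (A i q + 1ℤ * A j q) ≡⟨ id (A j q) (A i q) ⟩
  - A i q ∎
  where
  open ≡-Reasoning
  j≢i : j ≢ i
  j≢i e = i≢j (sym e)
  C = rowAdd i j 1ℤ A
  B = rowAdd j i -1ℤ C
  id : ∀ y x → y + -1ℤ * (x + 1ℤ * y) ≡ - x
  id = solve-∀

rowSwap-other : ∀ {a b} {i j p : Fin a} → p ≢ i → p ≢ j → (A : Mat a b) → ∀ q → rowSwap i j A p q ≡ A p q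
rowSwap-other {i = i} {j} p≢i p≢j A q = trans (rowAdd-other j 1ℤ (rowAdd j i -1ℤ (rowAdd i j 1ℤ A)) q p≢i)
  (trans (rowAdd-other i -1ℤ (rowAdd i j 1ℤ A) q p≢j) (rowAdd-other j 1ℤ A q p≢i))

setRow : ∀ {a b} → Fin a → (Fin b → ℤ) → Mat a b → Mat a b
setRow zero    r A zero    = r
setRow zero    r A (suc p) = A (suc p)
setRow (suc i) r A zero    = A zero
setRow (suc i) r A (suc p) = setRow i r (λ x → A (suc x)) p

setRow-same : ∀ {a b} (i : Fin a) r (A : Mat a b) q → setRow i r A i q ≡ r q
setRow-same zero    r A q = refl
setRow-same (suc i) r A q = setRow-same i r (λ x → A (suc x)) q

setRow-other : ∀ {a b} (i : Fin a) r (A : Mat a b) p → p ≢ i → ∀ q → setRow i r A p q ≡ A p q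
setRow-other zero    r A zero    p≢i q = ⊥-elim (p≢i refl)
setRow-other zero    r A (suc p) p≢i q = refl
setRow-other (suc i) r A zero    p≢i q = refl
setRow-other (suc i) r A (suc p) p≢i q = setRow-other i r (λ x → A (suc x)) p (λ e → p≢i (cong suc e)) q

det-rowAdd-setRow : ∀ {n} (i j : Fin n) c (A : Mat n n) → det (rowAdd i j c A) ≡ det A + c * det (setRow i (A j) A)
det-rowAdd-setRow i j c A = det-linear i c
  (λ a a≢i b → rowAdd-other j c A b a≢i) (λ a a≢i b → setRow-other i (A j) A a a≢i b)
  (λ b → trans (rowAdd-same i j c A b) (cong (λ x → A i b + c * x) (sym (setRow-same i (A j) A b))))

mutual
  -- The mutual recursion descends in the size. Row operations that spare row 0 act on every minor
  -- of the expansion along row 0, so their invariance follows from the smaller size; they allow a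
  -- row equal to row 0 to be moved next to it, where `det-equal-first-rows` applies.
  det-equal-rows : ∀ {n} (A : Mat n n) i j → i ≢ j → (∀ b → A i b ≡ A j b) → det A ≡ 0ℤ
  det-equal-rows {suc n} A zero    zero    i≢j e = ⊥-elim (i≢j refl)
  det-equal-rows {suc n} A zero    (suc j) i≢j e = det-equal-row-zero A j e
  det-equal-rows {suc n} A (suc i) zero    i≢j e = det-equal-row-zero A i λ b → sym (e b)
  det-equal-rows {suc n} A (suc i) (suc j) i≢j e = sum-zero λ k → trans
    (cong (λ x → sign (toℕ k) * (A zero k * x)) (det-equal-rows (minor k A) i j (λ eq → i≢j (cong suc eq)) λ b → e (punchIn k b)))
    (trans (cong (sign (toℕ k) *_) (ℤₚ.*-zeroʳ (A zero k))) (ℤₚ.*-zeroʳ (sign (toℕ k))))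

  det-equal-row-zero : ∀ {n} (A : Mat (suc n) (suc n)) j → (∀ b → A zero b ≡ A (suc j) b) → det A ≡ 0ℤ
  det-equal-row-zero A zero    e = det-equal-first-rows A e
  det-equal-row-zero A (suc j) e = trans (sym (det-rowSwap-suc zero (suc j) A λ ()))
    (det-equal-first-rows (rowSwap (suc zero) (suc (suc j)) A) λ b →
      trans (rowSwap-other {i = suc zero} {suc (suc j)} (λ ()) (λ ()) A b)
        (trans (e b) (sym (rowSwap-fst {i = suc zero} {suc (suc j)} (λ ()) A b))))

  det-rowSwap-suc : ∀ {n} i j (A : Mat (suc n) (suc n)) → i ≢ j → det (rowSwap (suc i) (suc j) A) ≡ det A
  det-rowSwap-suc i j A i≢j =
    trans (det-rowAdd-suc i j 1ℤ (rowAdd (suc j) (suc i) -1ℤ (rowAdd (suc i) (suc j) 1ℤ A)) i≢j)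
      (trans (det-rowAdd-suc j i -1ℤ (rowAdd (suc i) (suc j) 1ℤ A) λ e → i≢j (sym e)) (det-rowAdd-suc i j 1ℤ A i≢j))

  det-rowAdd-suc : ∀ {n} i j c (A : Mat (suc n) (suc n)) → i ≢ j → det (rowAdd (suc i) (suc j) c A) ≡ det A
  det-rowAdd-suc i j c A i≢j = sum-cong λ k → cong₂ (λ x y → sign (toℕ k) * (x * y))
    (ℤₚ.+-identityʳ (A zero k)) (det-rowAdd i j c (minor k A) i≢j)

  det-rowAdd : ∀ {n} i j c (A : Mat n n) → i ≢ j → det (rowAdd i j c A) ≡ det A
  det-rowAdd i j c A i≢j = trans (det-rowAdd-setRow i j c A) (trans
    (cong (λ x → det A + c * x) (det-equal-rows (setRow i (A j) A) i j i≢j λ b →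
      trans (setRow-same i (A j) A b) (sym (setRow-other i (A j) A j (λ e → i≢j (sym e)) b))))
    (trans (cong (λ x → det A + x) (ℤₚ.*-zeroʳ c)) (ℤₚ.+-identityʳ (det A))))

det-negate-row : ∀ {n} (i : Fin n) (A : Mat n n) → det (rowAdd i i (- (+ 2)) A) ≡ - det A
det-negate-row i A = trans (det-rowAdd-setRow i i (- (+ 2)) A)
  (trans (cong (λ x → det A + - (+ 2) * x) (det-cong same)) (id (det A)))
  where
  id : ∀ x → x + - (+ 2) * x ≡ - x
  id = solve-∀
  same : setRow i (A i) A ≈ A
  same p q with p Fin.≟ i
  ... | yes refl = setRow-same i (A i) A q
  ... | no p≢i   = setRow-other i (A i) A p p≢i q

-- Scaled rows and divisibility of determinants

prodUpTo : ℕ → (ℕ → ℤ) → ℤ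
prodUpTo zero    e = 1ℤ
prodUpTo (suc n) e = e 0 * prodUpTo n (λ p → e (suc p))

det-scale-rows : ∀ {n} (e : ℕ → ℤ) (A : Mat n n) → det (λ i j → e (toℕ i) * A i j) ≡ prodUpTo n e * det A
det-scale-rows {zero}  e A = refl
det-scale-rows {suc n} e A = trans (sum-cong λ j → trans
    (cong (λ x → sign (toℕ j) * (e 0 * A zero j * x)) (det-scale-rows (λ p → e (suc p)) (minor j A)))
    (id (sign (toℕ j)) (e 0) (A zero j) (prodUpTo n (λ p → e (suc p))) (det (minor j A))))
  (sum-*ˡ (prodUpTo (suc n) e) (λ j → sign (toℕ j) * (A zero j * det (minor j A))))
  where
  id : ∀ s e a p m → s * (e * a * (p * m)) ≡ e * p * (s * (a * m))
  id = solve-∀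

∣-sum : ∀ {n m} {f : Fin n → ℤ} → (∀ i → m ∣ f i) → m ∣ sumℤ f
∣-sum {zero}  {m} h = divides 0ℤ refl
∣-sum {suc n} h = ∣m∣n⇒∣m+n (h zero) (∣-sum λ i → h (suc i))

private
  ∣-term : ∀ {m} e s a x → (m ∣ e * a) ⊎ (m ∣ e * x) → m ∣ e * (s * (a * x))
  ∣-term {m} e s a x (inj₁ h) = subst (m ∣_) (id e s a x) (∣n⇒∣m*n (s * x) h)
    where
    id : ∀ e s a x → s * x * (e * a) ≡ e * (s * (a * x))
    id = solve-∀
  ∣-term {m} e s a x (inj₂ h) = subst (m ∣_) (id e s a x) (∣n⇒∣m*n (s * a) h)
    where
    id : ∀ e s a x → s * a * (e * x) ≡ e * (s * (a * x))
    id = solve-∀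

∣-*sum : ∀ {n m} e (f : Fin n → ℤ) → (∀ i → m ∣ e * f i) → m ∣ e * sumℤ f
∣-*sum {m = m} e f h = subst (m ∣_) (sum-*ˡ e f) (∣-sum h)

-- Expansion along row 0 suffices although the hypothesis concerns a column: removing any other
-- column leaves the first column in the minor. The factor `e` is carried along because m need not
-- divide the entries themselves.
∣-det-column : ∀ {n m} e (A : Mat (suc n) (suc n)) → (∀ i → m ∣ e * A i zero) → m ∣ e * det A
∣-det-column {n} {m} e A h = ∣-*sum e (λ j → sign (toℕ j) * (A zero j * det (minor j A))) term
  where
  rest : ∀ {n} (j : Fin n) (A : Mat (suc n) (suc n)) → (∀ i → m ∣ e * A i zero) → m ∣ e * det (minor (suc j) A)
  rest {suc n} j A h = ∣-det-column e (minor (suc j) A) λ i → h (suc i)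
  term : ∀ j → m ∣ e * (sign (toℕ j) * (A zero j * det (minor j A)))
  term zero    = ∣-term e (sign 0) (A zero zero) (det (minor zero A)) (inj₁ (h zero))
  term (suc j) = ∣-term e (sign (suc (toℕ j))) (A zero (suc j)) (det (minor (suc j) A)) (inj₂ (rest j A h))

-- Frobenius–König: every transversal of A meets the block of rows ≥ p and columns ≤ p.
∣-det-block : ∀ {n m} e p (A : Mat n n) → p ℕ.< n →
  (∀ i j → p ℕ.≤ toℕ i → toℕ j ℕ.≤ p → m ∣ e * A i j) → m ∣ e * det A
∣-det-block {suc n} e zero    A _           h = ∣-det-column e A λ i → h i zero ℕ.z≤n ℕ.z≤n
∣-det-block {suc n} e (suc p) A (ℕ.s≤s p<n) h = ∣-*sum e (λ j → sign (toℕ j) * (A zero j * det (minor j A))) λ j →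
  ∣-term e (sign (toℕ j)) (A zero j) (det (minor j A)) (inj₂
    (∣-det-block e p (minor j A) p<n λ a b p≤a b≤p → h (suc a) (punchIn j b) (ℕ.s≤s p≤a)
      (ℕₚ.≤-trans (punchIn-≤ j b) (ℕ.s≤s b≤p))))
  where
  punchIn-≤ : ∀ {n} (j : Fin (suc n)) b → toℕ (punchIn j b) ℕ.≤ suc (toℕ b)
  punchIn-≤ zero    b       = ℕₚ.≤-refl
  punchIn-≤ (suc j) zero    = ℕ.z≤n
  punchIn-≤ (suc j) (suc b) = ℕ.s≤s (punchIn-≤ j b)

-- The general linear group

Elementary : ∀ {n} → Fin n → Fin n → ℤ → Set
Elementary i j c = i ≢ j ⊎ (i ≡ j × c ≡ - (+ 2))

-- With a factorisation into elementary matrices at hand, inverses, transposes and determinants are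
-- obtained by induction rather than from cofactors. The constructors are closed under `≈` because
-- matrices are functions and equal only pointwise.
data GL {n} : Mat n n → Set where
  identity : ∀ {A} → A ≈ δ → GL A
  rowOp    : ∀ {A B} i j c → Elementary i j c → GL A → B ≈ rowAdd i j c A → GL B

GL-cong : ∀ {n} {A B : Mat n n} → B ≈ A → GL A → GL B
GL-cong e (identity e′)       = identity (≈-trans e e′)
GL-cong e (rowOp i j c E g e′) = rowOp i j c E g (≈-trans e e′)

GL-rowAdd : ∀ {n} {i j : Fin n} {c} → Elementary i j c → GL (rowAdd i j c δ)
GL-rowAdd {i = i} {j} {c} E = rowOp i j c E (identity λ p q → refl) λ p q → refl

GL-· : ∀ {n} {A B : Mat n n} → GL A → GL B → GL (A · B)
GL-· {B = B} (identity e) h = GL-cong (≈-trans (·-congʳ B e) (·-identityˡ B)) h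
GL-· {B = B} (rowOp {A} i j c E g e) h = rowOp i j c E (GL-· g h) (≈-trans (·-congʳ B e) (rowAdd-· i j c A B))

-- The composite adds c + c′ + c c′ δ j i times row j to row i, where the last term appears only for
-- i = j. The sum vanishes for c′ = -c off the diagonal and for c = c′ = -2 on it, so one statement
-- inverts both kinds of operations.
rowAdd-cancel : ∀ {a b} (i j : Fin a) c c′ (A : Mat a b) → c + c′ + c * c′ * δ j i ≡ 0ℤ →
  rowAdd i j c (rowAdd i j c′ A) ≈ A
rowAdd-cancel i j c c′ A e p q = trans (id (A p q) (δ p i) c c′ (A j q) (δ j i))
  (trans (cong (λ x → A p q + x * (δ p i * A j q)) e) (ℤₚ.+-identityʳ (A p q)))
  where
  id : ∀ a d c c′ b d′ → a + d * (c′ * b) + d * (c * (b + d′ * (c′ * b))) ≡ a + (c + c′ + c * c′ * d′) * (d * b)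
  id = solve-∀

Elementary-inverse : ∀ {n} {i j : Fin n} {c} → Elementary i j c →
  Σ ℤ λ c′ → Elementary i j c′ × c + c′ + c * c′ * δ j i ≡ 0ℤ × c′ + c + c′ * c * δ j i ≡ 0ℤ
Elementary-inverse {i = i} {j} {c} (inj₁ i≢j) = - c , inj₁ i≢j ,
  trans (cong (λ x → c + - c + c * - c * x) δji) (id₁ c) , trans (cong (λ x → - c + c + - c * c * x) δji) (id₂ c)
  where
  δji : δ j i ≡ 0ℤ
  δji = δ-≢ λ e → i≢j (sym e)
  id₁ : ∀ c → c + - c + c * - c * 0ℤ ≡ 0ℤ
  id₁ = solve-∀
  id₂ : ∀ c → - c + c + - c * c * 0ℤ ≡ 0ℤ
  id₂ = solve-∀
Elementary-inverse {i = i} (inj₂ (refl , refl)) = - (+ 2) , inj₂ (refl , refl) ,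
  cong (λ x → - (+ 2) + - (+ 2) + - (+ 2) * - (+ 2) * x) (δ-refl i) ,
  cong (λ x → - (+ 2) + - (+ 2) + - (+ 2) * - (+ 2) * x) (δ-refl i)

GL-inverse : ∀ {n} {A : Mat n n} → GL A → Σ (Mat n n) λ B → GL B × (A · B) ≈ δ × (B · A) ≈ δ
GL-inverse {A = A} (identity e) = δ , identity (λ p q → refl) ,
  ≈-trans (·-identityʳ A) e , ≈-trans (·-identityˡ A) e
GL-inverse {A = A′} (rowOp {A} i j c E g e) with Elementary-inverse E | GL-inverse g
... | c′ , E′ , cc′ , c′c | B , h , AB , BA = B · F′ , GL-· h (GL-rowAdd E′) ,
  ≈-trans (·-congʳ (B · F′) e)
    (≈-trans (rowAdd-· i j c A (B · F′))
    (≈-trans (rowAdd-cong i j c (≈-trans (≈-sym (·-assoc A B F′)) (≈-trans (·-congʳ F′ AB) (·-identityˡ F′))))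
      (rowAdd-cancel i j c c′ δ cc′))) ,
  ≈-trans (·-congˡ (B · F′) e)
    (≈-trans (·-assoc B F′ (rowAdd i j c A))
    (≈-trans (·-congˡ B (≈-trans (rowAdd-δ i j c′ (rowAdd i j c A)) (rowAdd-cancel i j c′ c A c′c))) BA))
  where F′ = rowAdd i j c′ δ

rowAdd-δᵀ : ∀ {n} (i j : Fin n) c → rowAdd i j c δ ᵀ ≈ rowAdd j i c δ
rowAdd-δᵀ i j c p q = trans
  (cong₂ _+_ (δ-sym q p) (cong₂ (λ x y → x * (c * y)) (δ-sym q i) (δ-sym j p)))
  (cong (λ x → δ p q + x) (id (δ i q) c (δ p j)))
  where
  id : ∀ x c y → x * (c * y) ≡ y * (c * x)
  id = solve-∀

Elementary-sym : ∀ {n} {i j : Fin n} {c} → Elementary i j c → Elementary j i c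
Elementary-sym (inj₁ i≢j)       = inj₁ λ e → i≢j (sym e)
Elementary-sym (inj₂ (e , c≡-2)) = inj₂ (sym e , c≡-2)

GL-ᵀ : ∀ {n} {A : Mat n n} → GL A → GL (A ᵀ)
GL-ᵀ (identity e) = identity λ p q → trans (e q p) (δ-sym q p)
GL-ᵀ (rowOp {A} i j c E g e) = GL-cong
  (λ p q → trans (e q p) (trans (sym (rowAdd-δ i j c A q p)) (·-ᵀ (rowAdd i j c δ) A p q)))
  (GL-· (GL-ᵀ g) (GL-cong (rowAdd-δᵀ i j c) (GL-rowAdd (Elementary-sym E))))

det-δ : ∀ n → det (δ {n}) ≡ 1ℤ
det-δ zero    = refl
det-δ (suc n) = cong₂ _+_
  (trans (ℤₚ.*-identityˡ _) (trans (ℤₚ.*-identityˡ _) (det-δ n)))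
  (sum-zero {n} λ j → ℤₚ.*-zeroʳ (sign (suc (toℕ j))))

Unimodular-resp : ∀ {n} {A B : Mat n n} → det B ≡ det A ⊎ det B ≡ - det A → Unimodular A → Unimodular B
Unimodular-resp (inj₁ e) (inj₁ a) = inj₁ (trans e a)
Unimodular-resp (inj₁ e) (inj₂ a) = inj₂ (trans e a)
Unimodular-resp (inj₂ e) (inj₁ a) = inj₂ (trans e (cong -_ a))
Unimodular-resp (inj₂ e) (inj₂ a) = inj₁ (trans e (cong -_ a))

GL⇒Unimodular : ∀ {n} {A : Mat n n} → GL A → Unimodular A
GL⇒Unimodular {n} (identity e) = inj₁ (trans (det-cong e) (det-δ n))
GL⇒Unimodular (rowOp {A} {B} i j c (inj₁ i≢j) g e) =
  Unimodular-resp {A = A} {B} (inj₁ (trans (det-cong e) (det-rowAdd i j c A i≢j))) (GL⇒Unimodular g)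
GL⇒Unimodular (rowOp {A} {B} i .i c (inj₂ (refl , refl)) g e) =
  Unimodular-resp {A = A} {B} (inj₂ (trans (det-cong e) (det-negate-row i A))) (GL⇒Unimodular g)

block : ∀ {k s} → ℤ → Mat k s → Mat (suc k) (suc s)
block x A zero    zero    = x
block x A zero    (suc j) = 0ℤ
block x A (suc i) zero    = 0ℤ
block x A (suc i) (suc j) = A i j

block-· : ∀ {a b c} x y (A : Mat a b) (B : Mat b c) → (block x A · block y B) ≈ block (x * y) (A · B)
block-· {b = b} x y A B zero zero = trans (cong (λ z → x * y + z) (sum-zero {b} {λ l → 0ℤ * 0ℤ} λ l → refl)) (ℤₚ.+-identityʳ (x * y))
block-· {b = b} x y A B zero (suc j) = cong₂ _+_ (ℤₚ.*-zeroʳ x) (sum-zero {b} {λ l → 0ℤ * B l j} λ l → refl)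
block-· x y A B (suc i) zero = trans (ℤₚ.+-identityˡ _) (sum-zero λ l → ℤₚ.*-zeroʳ (A i l))
block-· x y A B (suc i) (suc j) = ℤₚ.+-identityˡ _

Elementary-suc : ∀ {n} {i j : Fin n} {c} → Elementary i j c → Elementary (suc i) (suc j) c
Elementary-suc (inj₁ i≢j)        = inj₁ λ { refl → i≢j refl }
Elementary-suc (inj₂ (e , c≡-2)) = inj₂ (cong suc e , c≡-2)

GL-block : ∀ {n} {A : Mat n n} → GL A → GL (block 1ℤ A)
GL-block {A = A} (identity e) = identity λ where
  zero    zero    → refl
  zero    (suc q) → refl
  (suc p) zero    → refl
  (suc p) (suc q) → e p q
GL-block (rowOp {A} i j c E g e) = rowOp (suc i) (suc j) c (Elementary-suc E) (GL-block g) λ where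
  zero    zero    → refl
  zero    (suc q) → refl
  (suc p) zero    → sym (trans (ℤₚ.+-identityˡ (δ p i * (c * 0ℤ))) (trans (cong (δ p i *_) (ℤₚ.*-zeroʳ c)) (ℤₚ.*-zeroʳ (δ p i))))
  (suc p) (suc q) → e p q

-- Equivalence of matrices over the integer polynomials

IsPolyMat : ∀ {k s} → (ℕ → Mat k s) → Set
IsPolyMat M = ∀ i j → IsPoly (λ n → M n i j)

IsPolyMat-· : ∀ {a b c} {A : ℕ → Mat a b} {B : ℕ → Mat b c} → IsPolyMat A → IsPolyMat B → IsPolyMat (λ n → A n · B n)
IsPolyMat-· p q i j = IsPoly-sum λ l → IsPoly-* (p i l) (q l j)

IsPolyMat-const : ∀ {k s} (A : Mat k s) → IsPolyMat (λ _ → A)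
IsPolyMat-const A i j = IsPoly-const (A i j)

infix 4 _~_
-- The matrices `U` and `V` are polynomial, but their factorisation into elementary matrices may
-- vary with n. The relation is only composed, never reversed, so polynomial inverses do not enter.
record _~_ {k s} (M N : ℕ → Mat k s) : Set where
  constructor mk~
  field
    {U}    : ℕ → Mat k k
    {V}    : ℕ → Mat s s
    U-poly : IsPolyMat U
    V-poly : IsPolyMat V
    U-GL   : ∀ n → GL (U n)
    V-GL   : ∀ n → GL (V n)
    equiv  : ∀ n → ((U n · M n) · V n) ≈ N n

~-poly : ∀ {k s} {M N : ℕ → Mat k s} → M ~ N → IsPolyMat M → IsPolyMat N
~-poly (mk~ pU pV _ _ e) p i j = IsPoly-cong (λ n → sym (e n i j)) (IsPolyMat-· (IsPolyMat-· pU p) pV i j)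

~-reflexive : ∀ {k s} {M N : ℕ → Mat k s} → (∀ n → M n ≈ N n) → M ~ N
~-reflexive {M = M} e = mk~ {U = λ _ → δ} {V = λ _ → δ} (IsPolyMat-const δ) (IsPolyMat-const δ)
  (λ n → identity λ p q → refl) (λ n → identity λ p q → refl)
  λ n → ≈-trans (·-identityʳ (δ · M n)) (≈-trans (·-identityˡ (M n)) (e n))

·-regroup : ∀ {k s} (U′ U : Mat k k) (M : Mat k s) (V V′ : Mat s s) →
  (((U′ · U) · M) · (V · V′)) ≈ ((U′ · ((U · M) · V)) · V′)
·-regroup U′ U M V V′ = ≈-trans (≈-sym (·-assoc ((U′ · U) · M) V V′))
  (·-congʳ V′ (≈-trans (·-congʳ V (·-assoc U′ U M)) (·-assoc U′ (U · M) V)))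

~-trans : ∀ {k s} {L M N : ℕ → Mat k s} → L ~ M → M ~ N → L ~ N
~-trans {L = L} (mk~ {U} {V} pU pV gU gV e) (mk~ {U′} {V′} pU′ pV′ gU′ gV′ e′) =
  mk~ {U = λ n → U′ n · U n} {V = λ n → V n · V′ n} (IsPolyMat-· pU′ pU) (IsPolyMat-· pV pV′)
    (λ n → GL-· (gU′ n) (gU n)) (λ n → GL-· (gV n) (gV′ n))
    λ n → ≈-trans (·-regroup (U′ n) (U n) (L n) (V n) (V′ n))
      (≈-trans (·-congʳ (V′ n) (·-congˡ (U′ n) (e n))) (e′ n))

~-ᵀ : ∀ {k s} {M N : ℕ → Mat k s} → M ~ N → (λ n → M n ᵀ) ~ (λ n → N n ᵀ)
~-ᵀ {M = M} (mk~ {U} {V} pU pV gU gV e) =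
  mk~ {U = λ n → V n ᵀ} {V = λ n → U n ᵀ} (λ i j → pV j i) (λ i j → pU j i) (λ n → GL-ᵀ (gV n)) (λ n → GL-ᵀ (gU n))
    λ n → ≈-trans (≈-sym (·-assoc-ᵀ n)) λ i j → e n j i
  where
  ·-assoc-ᵀ : ∀ n → (((U n · M n) · V n) ᵀ) ≈ ((V n ᵀ · M n ᵀ) · U n ᵀ)
  ·-assoc-ᵀ n = ≈-trans (·-ᵀ (U n · M n) (V n)) (≈-trans (·-congˡ (V n ᵀ) (·-ᵀ (U n) (M n)))
    (≈-sym (·-assoc (V n ᵀ) (M n ᵀ) (U n ᵀ))))

~-reindex : ∀ {k s} {M N : ℕ → Mat k s} → M ~ N → ∀ S T → (λ n → M (S ℕ.* n ℕ.+ T)) ~ (λ n → N (S ℕ.* n ℕ.+ T))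
~-reindex (mk~ {U} {V} pU pV gU gV e) S T =
  mk~ {U = λ n → U (S ℕ.* n ℕ.+ T)} {V = λ n → V (S ℕ.* n ℕ.+ T)}
    (λ i j → IsPoly-affine S T (pU i j)) (λ i j → IsPoly-affine S T (pV i j))
    (λ n → gU _) (λ n → gV _) λ n → e _

~-rowAdd : ∀ {k s} {M : ℕ → Mat k s} i j {c : ℕ → ℤ} → IsPoly c → (∀ n → Elementary i j (c n)) →
  M ~ (λ n → rowAdd i j (c n) (M n))
~-rowAdd {M = M} i j {c} p E = mk~ {U = λ n → rowAdd i j (c n) δ} {V = λ _ → δ}
  (λ a b → IsPoly-+ (IsPoly-const (δ a b)) (IsPoly-scale (δ a i) (IsPoly-* p (IsPoly-const (δ j b)))))
  (IsPolyMat-const δ) (λ n → GL-rowAdd (E n)) (λ n → identity λ p q → refl)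
  λ n → ≈-trans (·-identityʳ (rowAdd i j (c n) δ · M n)) (rowAdd-δ i j (c n) (M n))

~-rowSwap : ∀ {k s} {M : ℕ → Mat k s} {i j} → i ≢ j → M ~ (λ n → rowSwap i j (M n))
~-rowSwap {M = M} {i} {j} i≢j = ~-trans (~-rowAdd i j (IsPoly-const 1ℤ) λ _ → inj₁ i≢j)
  (~-trans (~-rowAdd j i (IsPoly-const -1ℤ) λ _ → inj₁ λ e → i≢j (sym e)) (~-rowAdd i j (IsPoly-const 1ℤ) λ _ → inj₁ i≢j))

~-block : ∀ {k s} {M N : ℕ → Mat k s} (x : ℕ → ℤ) → M ~ N → (λ n → block (x n) (M n)) ~ (λ n → block (x n) (N n))
~-block {M = M} {N} x (mk~ {U} {V} pU pV gU gV e) =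
  mk~ {U = λ n → block 1ℤ (U n)} {V = λ n → block 1ℤ (V n)} (block-poly pU) (block-poly pV)
    (λ n → GL-block (gU n)) (λ n → GL-block (gV n))
    λ n → ≈-trans (·-congʳ (block 1ℤ (V n)) (block-· 1ℤ (x n) (U n) (M n)))
      (≈-trans (block-· (1ℤ * x n) 1ℤ (U n · M n) (V n)) (block-cong (trans (ℤₚ.*-identityʳ (1ℤ * x n)) (ℤₚ.*-identityˡ (x n))) (e n)))
  where
  block-poly : ∀ {k s} {A : ℕ → Mat k s} → IsPolyMat A → IsPolyMat (λ n → block 1ℤ (A n))
  block-poly p zero    zero    = IsPoly-const 1ℤ
  block-poly p zero    (suc j) = IsPoly-const 0ℤ
  block-poly p (suc i) zero    = IsPoly-const 0ℤ
  block-poly p (suc i) (suc j) = p i j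
  block-cong : ∀ {k s} {x y} {A B : Mat k s} → x ≡ y → A ≈ B → block x A ≈ block y B
  block-cong e f zero    zero    = e
  block-cong e f zero    (suc j) = refl
  block-cong e f (suc i) zero    = refl
  block-cong e f (suc i) (suc j) = f i j

-- Splitting into residue classes

-- F splits into leaves satisfying Q: the leaves are the restrictions of F to arithmetic progressions
-- that cover all sufficiently large integers, each reparametrised by ℕ.
data Split {X : Set} (Q : (ℕ → X) → Set) : (ℕ → X) → Set where
  leaf : ∀ {F} → Q F → Split Q F
  node : ∀ {F} S N → (∀ (i : Fin (suc S)) → Split Q (λ m → F (suc S ℕ.* m ℕ.+ (N ℕ.+ toℕ i)))) → Split Q F

Stable : {X : Set} → ((ℕ → X) → Set) → Set
Stable H = ∀ F S N → H F → H (λ m → F (suc S ℕ.* m ℕ.+ N))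

module _ {X : Set} where

  -- `H` carries what is already known about F down to the leaves, where it is needed to continue;
  -- hence it must survive substitution.
  split-bind : ∀ {Q Q′ H : (ℕ → X) → Set} {F} → Stable H → H F → Split Q F →
    (∀ G → H G → Q G → Split Q′ G) → Split Q′ F
  split-bind st h (leaf q)     k = k _ h q
  split-bind st h (node S N t) k = node S N λ i → split-bind st (st _ S _ h) (t i) k

  split-map : ∀ {Q Q′ : (ℕ → X) → Set} {F} → (∀ G → Q G → Q′ G) → Split Q F → Split Q′ F
  split-map f (leaf q)     = leaf (f _ q)
  split-map f (node S N t) = node S N λ i → split-map f (t i)

  -- B is an early exit: once it holds, the remaining conditions E i are not imposed.
  split-all : ∀ {n} {H B : (ℕ → X) → Set} {E : Fin n → (ℕ → X) → Set} → Stable H → (∀ i → Stable (E i)) →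
    (∀ i F → H F → Split (λ G → B G ⊎ E i G) F) →
    ∀ F → H F → Split (λ G → B G ⊎ (∀ i → E i G)) F
  split-all {zero}  stH stE step F h = leaf (inj₂ λ ())
  split-all {suc n} {H} {B} {E} stH stE step F h = split-bind stH h (step zero F h) λ where
    G hG (inj₁ b) → leaf (inj₁ b)
    G hG (inj₂ e) → split-bind {H = λ K → H K × E zero K} (λ K S N (x , y) → stH K S N x , stE zero K S N y) (hG , e)
      (split-all stH (λ i → stE (suc i)) (λ i → step (suc i)) G hG) λ where
        K _ (inj₁ b)        → leaf (inj₁ b)
        K (_ , e₀) (inj₂ r) → leaf (inj₂ λ { zero → e₀ ; (suc i) → r i })

-- This lets the algorithm run on a modified family (transposed, bordered, rescaled, with rows
-- added) and its outcome be read for the original one: the same progressions split both, and `R`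
-- keeps them related.
split-transfer : ∀ {X Y : Set} {Q : (ℕ → X) → Set} {Q′ : (ℕ → Y) → Set} (R : (ℕ → X) → (ℕ → Y) → Set) →
  (∀ F G S N → R F G → R (λ m → F (suc S ℕ.* m ℕ.+ N)) (λ m → G (suc S ℕ.* m ℕ.+ N))) →
  (∀ F G → R F G → Q F → Q′ G) → ∀ {F G} → R F G → Split Q F → Split Q′ G
split-transfer R st f r (leaf q)     = leaf (f _ _ r q)
split-transfer R st f r (node S N t) = node S N λ i → split-transfer R st f (st _ _ S _ r) (t i)

-- Pivoting

corner : ∀ {k s} → (ℕ → Mat (suc k) (suc s)) → ℕ → ℤ
corner M n = M n zero zero

Progress : (ℕ → (ℕ → ℤ) → Set) → ∀ {k s} → ℕ → (ℕ → Mat (suc k) (suc s)) → Set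
Progress Piv m M = Σ _ λ M′ → M ~ M′ × Σ ℕ λ m′ → m′ ℕ.< m × Piv m′ (corner M′)

-- An abstract form of the pivoting argument of the Smith algorithm. Piv m a: the function a is
-- an admissible pivot of size m. Dv a b: the pivot a divides b, in a sense that may be weaker than
-- divisibility over ℤ[t].
record PivotTheory : Set₁ where
  field
    Piv         : ℕ → (ℕ → ℤ) → Set
    Piv-cong    : ∀ {m a b} → (∀ n → b n ≡ a n) → Piv m a → Piv m b
    Piv-stable  : ∀ m → Stable (Piv m)
    Dv          : (ℕ → ℤ) → (ℕ → ℤ) → Set
    Dv-cong     : ∀ {a b b′} → (∀ n → b′ n ≡ b n) → Dv a b → Dv a b′
    Dv-stable   : ∀ {a b} S N → Dv a b → Dv (λ m → a (suc S ℕ.* m ℕ.+ N)) (λ m → b (suc S ℕ.* m ℕ.+ N))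
    Dv-refl     : ∀ {a} → Dv a a
    Dv-trans    : ∀ {a b c} → Dv a b → Dv b c → Dv a c
    Dv-linear   : ∀ {a b c w} → IsPoly w → Dv a b → Dv a c → Dv a (λ n → b n + w n * c n)
    column-step : ∀ {k s m} (i : Fin k) (M : ℕ → Mat (suc k) (suc s)) → IsPolyMat M → Piv m (corner M) →
      Split (λ G → Progress Piv m G ⊎ Dv (corner G) (λ n → G n (suc i) zero)) M
    -- Adding row i to row 0 might destroy the pivot, for example by cancelling it; first adding a
    -- suitable multiple w of row 0 to row i keeps it admissible with the same m.
    combine     : ∀ {k s m} (i : Fin k) (M : ℕ → Mat (suc k) (suc s)) → IsPolyMat M → Piv m (corner M) →
      Dv (corner M) (λ n → M n (suc i) zero) →
      Split (λ G → Σ (ℕ → ℤ) λ w → IsPoly w × Piv m (λ n → corner G n + (G n (suc i) zero + w n * corner G n))) M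

IsPolyMat-stable : ∀ {k s} → Stable (IsPolyMat {k} {s})
IsPolyMat-stable F S N p i j = IsPoly-affine (suc S) N (p i j)

module Pivoting (T : PivotTheory) where
  open PivotTheory T

  Admissible : ∀ {k s} → ℕ → (ℕ → Mat (suc k) (suc s)) → Set
  Admissible m M = IsPolyMat M × Piv m (corner M)

  Admissible-stable : ∀ {k s} m → Stable (Admissible {k} {s} m)
  Admissible-stable m F S N (p , q) = IsPolyMat-stable F S N p , Piv-stable m (corner F) S N q

  Divides : ∀ {k s} → Fin (suc k) → Fin (suc s) → (ℕ → Mat (suc k) (suc s)) → Set
  Divides i j M = Dv (corner M) (λ n → M n i j)

  Divides-stable : ∀ {k s} i j → Stable (Divides {k} {s} i j)
  Divides-stable i j F S N = Dv-stable S N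

  Progress-~ : ∀ {k s m} {M N : ℕ → Mat (suc k) (suc s)} → M ~ N → Progress Piv m N → Progress Piv m M
  Progress-~ e (N′ , e′ , r) = N′ , ~-trans e e′ , r

  row-step : ∀ {k s m} (j : Fin s) (M : ℕ → Mat (suc k) (suc s)) → Admissible m M →
    Split (λ G → Progress Piv m G ⊎ Divides zero (suc j) G) M
  row-step {m = m} j M (p , q) = split-transfer (λ F G → F ≡ λ n → G n ᵀ) (λ { F G S N refl → refl })
    (λ { F G refl (inj₁ (M′ , e , r)) → inj₁ ((λ n → M′ n ᵀ) , ~-ᵀ e , r) ; F G refl (inj₂ d) → inj₂ d })
    refl (column-step j (λ n → M n ᵀ) (λ a b → p b a) q)

  -- Adding row i to row 0 brings the entry (i , j) into row 0.
  inner-step : ∀ {k s m} (i : Fin k) (j : Fin s) (M : ℕ → Mat (suc k) (suc s)) →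
    Admissible m M × Divides (suc i) zero M × Divides zero (suc j) M →
    Split (λ G → Progress Piv m G ⊎ Divides (suc i) (suc j) G) M
  inner-step {k} {s} {m} i j M h@((p , q) , c , r) =
    split-bind {H = λ G → Admissible m G × Divides (suc i) zero G × Divides zero (suc j) G}
      (λ F S N (x , y , z) → Admissible-stable m F S N x , Dv-stable S N y , Dv-stable S N z)
      h (combine i M p q c) λ where
        G (adm , dc , dr) (w , pw , piv) → split-transfer Rel Rel-stable finish (rel G dc dr w pw)
          (row-step j (sum-matrix w G) (~-poly (sum-equiv w pw) (proj₁ adm) ,
            Piv-cong (λ n → sum-entry w G zero n) piv))
    where
    sum-matrix : (ℕ → ℤ) → (ℕ → Mat (suc k) (suc s)) → ℕ → Mat (suc k) (suc s)
    sum-matrix w G n = rowAdd zero (suc i) 1ℤ (rowAdd (suc i) zero (w n) (G n))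
    sum-equiv : ∀ {G} w → IsPoly w → G ~ sum-matrix w G
    sum-equiv w pw = ~-trans (~-rowAdd (suc i) zero pw λ _ → inj₁ λ ()) (~-rowAdd zero (suc i) (IsPoly-const 1ℤ) λ _ → inj₁ λ ())
    sum-entry : ∀ w G q n → sum-matrix w G n zero q ≡ G n zero q + (G n (suc i) q + w n * G n zero q)
    sum-entry w G q n = trans (rowAdd-same zero (suc i) 1ℤ (rowAdd (suc i) zero (w n) (G n)) q)
      (cong₂ _+_ (rowAdd-other {i = suc i} zero (w n) (G n) q λ ())
        (trans (ℤₚ.*-identityˡ _) (rowAdd-same (suc i) zero (w n) (G n) q)))
    record Rel (F G : ℕ → Mat (suc k) (suc s)) : Set where
      eta-equality
      constructor mkRel
      field
        w        : ℕ → ℤ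
        w-poly   : IsPoly w
        equiv    : G ~ F
        dv-col   : Divides (suc i) zero G
        dv-row   : Divides zero (suc j) G
        entry    : ∀ q n → F n zero q ≡ G n zero q + (G n (suc i) q + w n * G n zero q)
    Rel-stable : ∀ F G S N → Rel F G → Rel (λ m → F (suc S ℕ.* m ℕ.+ N)) (λ m → G (suc S ℕ.* m ℕ.+ N))
    Rel-stable F G S N (mkRel w pw e dc dr ent) =
      mkRel _ (IsPoly-affine (suc S) N pw) (~-reindex e (suc S) N) (Dv-stable S N dc) (Dv-stable S N dr) λ q n → ent q _
    rel : ∀ G → Divides (suc i) zero G → Divides zero (suc j) G → ∀ w → IsPoly w → Rel (sum-matrix w G) G
    rel G dc dr w pw = mkRel w pw (sum-equiv w pw) dc dr (sum-entry w G)
    finish : ∀ F G → Rel F G → Progress Piv m F ⊎ Divides zero (suc j) F → Progress Piv m G ⊎ Divides (suc i) (suc j) G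
    finish F G (mkRel w pw e dc dr ent) (inj₁ pr) = inj₁ (Progress-~ e pr)
    -- With r and x the old entries (0, j) and (i, j), the new entry (0, j) is r + (x + w r). It is
    -- divisible by the new pivot, hence by the old one, and so is r; therefore so is x.
    finish F G (mkRel w pw e dc dr ent) (inj₂ d)  = inj₂
      (Dv-cong (λ n → trans (id (G n zero (suc j)) (G n (suc i) (suc j)) (w n))
                        (cong (λ x → x + (-1ℤ + - w n) * G n zero (suc j)) (sym (ent (suc j) n))))
        (Dv-linear {b = λ n → F n zero (suc j)} {c = λ n → G n zero (suc j)} (IsPoly-+ (IsPoly-const -1ℤ) (IsPoly-neg pw))
          (Dv-trans dv-corner d) dr))
      where
      id : ∀ r x w → x ≡ r + (x + w * r) + (-1ℤ + - w) * r
      id = solve-∀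
      dv-corner : Dv (corner G) (corner F)
      dv-corner = Dv-cong (λ n → trans (ent zero n) (id′ (corner G n) (G n (suc i) zero) (w n)))
        (Dv-linear {b = λ n → G n (suc i) zero} {c = corner G} (IsPoly-+ (IsPoly-const 1ℤ) pw) dc Dv-refl)
        where
        id′ : ∀ a b w → a + (b + w * a) ≡ b + (1ℤ + w) * a
        id′ = solve-∀

  -- The order column, row, interior is forced by `inner-step`, which presupposes that the pivot
  -- divides the entries in its column and row. Divisibilities already reached persist when later
  -- steps split further.
  all-step : ∀ {k s m} (M : ℕ → Mat (suc k) (suc s)) → Admissible m M →
    Split (λ G → Progress Piv m G ⊎ (∀ i j → Divides i j G)) M
  all-step {k} {s} {m} M adm =
    split-bind (Admissible-stable m) adm
      (split-all (Admissible-stable m) (λ i → Divides-stable (suc i) zero) (λ i F (p , q) → column-step i F p q) M adm) λ where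
        G a (inj₁ pr)  → leaf (inj₁ pr)
        G a (inj₂ col) → split-bind Col-stable (a , col)
          (split-all (Admissible-stable m) (λ j → Divides-stable zero (suc j)) row-step G a) λ where
            K b (inj₁ pr)         → leaf (inj₁ pr)
            K (b , col) (inj₂ row) → split-bind Cross-stable (b , col , row)
              (split-all Cross-stable (λ i F S N h j → Divides-stable (suc i) (suc j) F S N (h j)) inner K (b , col , row)) λ where
                L b (inj₁ pr)                → leaf (inj₁ pr)
                L (_ , col , row) (inj₂ inn) → leaf (inj₂ λ where
                  zero    zero    → Dv-refl
                  zero    (suc j) → row j
                  (suc i) zero    → col i
                  (suc i) (suc j) → inn i j)
    where
    Col Cross : (ℕ → Mat (suc k) (suc s)) → Set
    Col G   = Admissible m G × (∀ i → Divides (suc i) zero G)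
    Cross G = Admissible m G × (∀ i → Divides (suc i) zero G) × (∀ j → Divides zero (suc j) G)
    Col-stable : Stable Col
    Col-stable F S N (a , c) = Admissible-stable m F S N a , λ i → Dv-stable S N (c i)
    Cross-stable : Stable Cross
    Cross-stable F S N (a , c , r) = Admissible-stable m F S N a , (λ i → Dv-stable S N (c i)) , λ j → Dv-stable S N (r j)
    inner : ∀ i F → Cross F → Split (λ G → Progress Piv m G ⊎ (∀ j → Divides (suc i) (suc j) G)) F
    inner i = split-all Cross-stable (λ j → Divides-stable (suc i) (suc j)) λ j F (a , c , r) → inner-step i j F (a , c i , r j)

  Reduced : ∀ {k s} → (ℕ → Mat (suc k) (suc s)) → Set
  Reduced M = Σ _ λ M′ → M ~ M′ × (Σ ℕ λ m → Piv m (corner M′)) × (∀ i j → Divides i j M′)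

  -- `Piv-stable` keeps m through every splitting, so a smaller m′ found on some progression is
  -- smaller than the m at the root, and well-founded recursion on m can continue there.
  reduce : ∀ {k s m} (M : ℕ → Mat (suc k) (suc s)) → Admissible m M → Split Reduced M
  reduce {m = m} = go m (<-wellFounded m)
    where
    go : ∀ {k s} m → Acc ℕ._<_ m → (M : ℕ → Mat (suc k) (suc s)) → Admissible m M → Split Reduced M
    go m (acc rs) M adm = split-bind (Admissible-stable m) adm (all-step M adm) λ where
      G (p , q) (inj₂ d) → leaf (G , ~-reflexive (λ n i j → refl) , (m , q) , d)
      G (p , q) (inj₁ (G′ , e , m′ , m′<m , q′)) → split-transfer (λ F K → K ~ F) (λ F K S N r → ~-reindex r (suc S) N)
        (λ { F K r (F′ , e′ , rest) → F′ , ~-trans r e′ , rest }) e (go m′ (rs m′<m) G′ (~-poly e p , q′))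

-- Pivots ordered by degree

-- σ is the sign of c. The positive number `suc S` serves as the modulus of a substitution.
nonzero-abs : ∀ {c} → c ≢ 0ℤ → Σ ℕ λ S → Σ ℤ λ σ → c * σ ≡ + suc S
nonzero-abs {+ zero}   c≢0 = ⊥-elim (c≢0 refl)
nonzero-abs {+ suc S}  _   = S , 1ℤ , ℤₚ.*-identityʳ (+ suc S)
nonzero-abs { -[1+ S ]} _  = S , -1ℤ , trans (ℤₚ.*-comm -[1+ S ] -1ℤ) (ℤₚ.-1*i≡-i -[1+ S ])

-- Divisibility over ℚ[t] with quotient u / v, denominators cleared.
RatDv : (ℕ → ℤ) → (ℕ → ℤ) → Set
RatDv a b = Σ ℤ λ v → v ≢ 0ℤ × Σ (ℕ → ℤ) λ u → IsPoly u × (∀ n → v * b n ≡ u n * a n)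

RatDv-trans : ∀ {a b c} → RatDv a b → RatDv b c → RatDv a c
RatDv-trans {a} {b} {c} (v , v≢0 , u , pu , e) (v′ , v′≢0 , u′ , pu′ , e′) =
  v * v′ , *-nonzero v≢0 v′≢0 , _ , IsPoly-* pu′ pu , λ n → begin
    v * v′ * c n      ≡⟨ ℤₚ.*-assoc v v′ (c n) ⟩
    v * (v′ * c n)    ≡⟨ cong (v *_) (e′ n) ⟩
    v * (u′ n * b n)  ≡⟨ id v (u′ n) (b n) ⟩
    u′ n * (v * b n)  ≡⟨ cong (u′ n *_) (e n) ⟩
    u′ n * (u n * a n) ≡⟨ sym (ℤₚ.*-assoc (u′ n) (u n) (a n)) ⟩
    u′ n * u n * a n  ∎
  where
  open ≡-Reasoning
  id : ∀ x y z → x * (y * z) ≡ y * (x * z)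
  id = solve-∀

RatDv-linear : ∀ {a b c w} → IsPoly w → RatDv a b → RatDv a c → RatDv a (λ n → b n + w n * c n)
RatDv-linear {a} {b} {c} {w} pw (v , v≢0 , u , pu , e) (v′ , v′≢0 , u′ , pu′ , e′) =
  v * v′ , *-nonzero v≢0 v′≢0 , _ , IsPoly-+ (IsPoly-scale v′ pu) (IsPoly-* pw (IsPoly-scale v pu′)) , λ n → begin
    v * v′ * (b n + w n * c n) ≡⟨ id₁ v v′ (b n) (w n) (c n) ⟩
    v′ * (v * b n) + w n * v * (v′ * c n) ≡⟨ cong₂ (λ x y → v′ * x + w n * v * y) (e n) (e′ n) ⟩
    v′ * (u n * a n) + w n * v * (u′ n * a n) ≡⟨ id₂ v v′ (u n) (w n) (u′ n) (a n) ⟩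
    (v′ * u n + w n * (v * u′ n)) * a n ∎
  where
  open ≡-Reasoning
  id₁ : ∀ v v′ b w c → v * v′ * (b + w * c) ≡ v′ * (v * b) + w * v * (v′ * c)
  id₁ = solve-∀
  id₂ : ∀ v v′ u w u′ a → v′ * (u * a) + w * v * (u′ * a) ≡ (v′ * u + w * (v * u′)) * a
  id₂ = solve-∀

HasDegree-cong : ∀ {d f g} → (∀ n → g n ≡ f n) → HasDegree d f → HasDegree d g
HasDegree-cong e (c , c≢0 , l) = c , c≢0 , Lead-cong e l

module _ {k s : ℕ} (i : Fin k) where

  private
    Matrix : Set
    Matrix = ℕ → Mat (suc k) (suc s)
    entry : Matrix → ℕ → ℤ
    entry M n = M n (suc i) zero
    Deg↓ : ℕ → Matrix → Set
    Deg↓ = Progress HasDegree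

  addPivot : (ℕ → ℤ) → Matrix → Matrix
  addPivot w M n = rowAdd (suc i) zero (w n) (M n)

  addPivot-~ : ∀ {w} M → IsPoly w → M ~ addPivot w M
  addPivot-~ M pw = ~-rowAdd (suc i) zero pw λ _ → inj₁ λ ()

  addPivot-corner : ∀ w M n → corner (addPivot w M) n ≡ corner M n
  addPivot-corner w M n = rowAdd-other {i = suc i} zero (w n) (M n) zero λ ()

  addPivot-entry : ∀ w M n → entry (addPivot w M) n ≡ entry M n + w n * corner M n
  addPivot-entry w M n = rowAdd-same (suc i) zero (w n) (M n) zero

  swapPivot : Matrix → Matrix
  swapPivot M n = rowSwap zero (suc i) (M n)

  swapPivot-~ : ∀ M → M ~ swapPivot M
  swapPivot-~ M = ~-rowSwap λ ()

  swapPivot-corner : ∀ M n → corner (swapPivot M) n ≡ entry M n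
  swapPivot-corner M n = rowSwap-fst {i = zero} {suc i} (λ ()) (M n) zero

  swapPivot-entry : ∀ M n → entry (swapPivot M) n ≡ - corner M n
  swapPivot-entry M n = rowSwap-snd {i = zero} {suc i} (λ ()) (M n) zero

  -- Both factors are nonzero because the Euclidean step exchanges the roles of the two entries, so
  -- that `u` becomes the next `v`.
  ConstDv : Matrix → Set
  ConstDv M = Σ ℤ λ v → v ≢ 0ℤ × Σ ℤ λ u → u ≢ 0ℤ × (∀ n → v * entry M n ≡ u * corner M n)

  -- The Euclidean algorithm on the leading coefficients of two polynomials of the same degree.
  equal-degree : ∀ {d} la lb → Acc ℕ._<_ ∣ la ∣ → (M : Matrix) → la ≢ 0ℤ → lb ≢ 0ℤ →
    Lead d la (corner M) → Lead d lb (entry M) → Deg↓ d M ⊎ ConstDv M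
  equal-degree {d} la lb (acc rs) M la≢0 lb≢0 La Lb = by-remainder (lb ℤ.% la) refl
    where
    instance _ = ℤ.≢-nonZero la≢0
    q : ℤ
    q = lb ℤ./ la
    M₁ M₂ : Matrix
    M₁ = addPivot (λ _ → - q) M
    M₂ = swapPivot M₁
    M~M₁ : M ~ M₁
    M~M₁ = addPivot-~ M (IsPoly-const (- q))
    M~M₂ : M ~ M₂
    M~M₂ = ~-trans M~M₁ (swapPivot-~ M₁)
    quotient : ∀ n → entry M n ≡ entry M₁ n + q * corner M n
    quotient n = trans (id (entry M n) q (corner M n)) (cong (λ x → x + q * corner M n) (sym (addPivot-entry (λ _ → - q) M n)))
      where
      id : ∀ x q a → x ≡ x + - q * a + q * a
      id = solve-∀
    L₁ : ∀ r → lb ℤ.% la ≡ r → Lead d (+ r) (entry M₁)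
    L₁ r refl = subst (λ x → Lead d x (entry M₁))
      (trans (cong (λ x → x + - q * la) (ℤ%.a≡a%n+[a/n]*n lb la)) (id (+ (lb ℤ.% la)) q la))
      (Lead-cong (addPivot-entry (λ _ → - q) M) (Lead-linear (- q) Lb La))
      where
      id : ∀ r q a → r + q * a + - q * a ≡ r
      id = solve-∀
    exact : (∀ n → entry M₁ n ≡ 0ℤ) ⊎ (Σ ℕ λ e → e ℕ.< d × HasDegree e (entry M₁)) → Deg↓ d M ⊎ ConstDv M
    exact (inj₁ z) = inj₂ (1ℤ , (λ ()) , q , q≢0 , λ n → trans (ℤₚ.*-identityˡ (entry M n)) (multiple n))
      where
      multiple : ∀ n → entry M n ≡ q * corner M n
      multiple n = trans (quotient n) (trans (cong (λ x → x + q * corner M n) (z n)) (ℤₚ.+-identityˡ (q * corner M n)))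
      q≢0 : q ≢ 0ℤ
      q≢0 q≡0 = HasDegree⇒nonzero (lb , lb≢0 , Lb) λ n → trans (multiple n) (cong (_* corner M n) q≡0)
    exact (inj₂ (e , e<d , h)) = inj₁ (M₂ , M~M₂ , e , e<d , HasDegree-cong (swapPivot-corner M₁) h)
    inexact : Deg↓ d M₂ ⊎ ConstDv M₂ → Deg↓ d M ⊎ ConstDv M
    inexact (inj₁ (M′ , e , pr)) = inj₁ (M′ , ~-trans M~M₂ e , pr)
    -- With a = `corner M` and b = `entry M`, the relation v (-a) = u (b - q a) after the step gives
    -- u b = (-v + u q) a before it.
    inexact (inj₂ (v , v≢0 , u , u≢0 , eqn)) = inj₂ (u , u≢0 , - v + u * q , nz , multiple)
      where
      open ≡-Reasoning
      id₁ : ∀ u b q a → u * (b + q * a) ≡ u * b + u * q * a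
      id₁ = solve-∀
      id₂ : ∀ v a u q → v * - a + u * q * a ≡ (- v + u * q) * a
      id₂ = solve-∀
      multiple : ∀ n → u * entry M n ≡ (- v + u * q) * corner M n
      multiple n = begin
        u * entry M n                         ≡⟨ cong (u *_) (quotient n) ⟩
        u * (entry M₁ n + q * corner M n)     ≡⟨ id₁ u (entry M₁ n) q (corner M n) ⟩
        u * entry M₁ n + u * q * corner M n   ≡⟨ cong (λ x → u * x + u * q * corner M n) (sym (swapPivot-corner M₁ n)) ⟩
        u * corner M₂ n + u * q * corner M n  ≡⟨ cong (λ x → x + u * q * corner M n) (sym (eqn n)) ⟩
        v * entry M₂ n + u * q * corner M n
          ≡⟨ cong (λ x → v * x + u * q * corner M n) (trans (swapPivot-entry M₁ n) (cong -_ (addPivot-corner (λ _ → - q) M n))) ⟩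
        v * - corner M n + u * q * corner M n ≡⟨ id₂ v (corner M n) u q ⟩
        (- v + u * q) * corner M n            ∎
      nz : - v + u * q ≢ 0ℤ
      nz z = HasDegree⇒nonzero (lb , lb≢0 , Lb) λ n →
        *-cancelˡ u≢0 (trans (multiple n) (trans (cong (_* corner M n) z) (sym (ℤₚ.*-zeroʳ u))))
    by-remainder : ∀ r → lb ℤ.% la ≡ r → Deg↓ d M ⊎ ConstDv M
    -- The leading terms cancel exactly: the new entry vanishes or is a pivot of degree below d.
    -- Otherwise its leading coefficient is the remainder, which is smaller than |la|, and it
    -- becomes the pivot of the recursive call.
    by-remainder zero r≡0 = exact (degree? (Deg<-cong (λ n → trans (expand n) (ℤₚ.+-identityˡ (rest n))) rest-deg))
      where open Lead (L₁ zero r≡0)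
    by-remainder (suc r) eq = inexact (equal-degree (+ suc r) (-1ℤ * la)
      (rs (subst (ℕ._< ∣ la ∣) eq (ℤ%.n%d<d lb la))) M₂ (λ ()) (*-nonzero { -1ℤ} (λ ()) la≢0)
      (Lead-cong (swapPivot-corner M₁) (L₁ (suc r) eq))
      (Lead-cong (λ n → trans (swapPivot-entry M₁ n) (trans (cong -_ (addPivot-corner (λ _ → - q) M n)) (sym (ℤₚ.-1*i≡-i (corner M n)))))
        (Lead-scale -1ℤ La)))

  record AddedPivot (F G : Matrix) : Set where
    constructor mkAdded
    field
      w        : ℕ → ℤ
      w-poly   : IsPoly w
      equiv    : G ~ F
      corner-≡ : ∀ n → corner F n ≡ corner G n
      entry-≡  : ∀ n → entry F n ≡ entry G n + w n * corner G n

  AddedPivot-stable : ∀ F G S N → AddedPivot F G →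
    AddedPivot (λ m → F (suc S ℕ.* m ℕ.+ N)) (λ m → G (suc S ℕ.* m ℕ.+ N))
  AddedPivot-stable F G S N (mkAdded w pw e c r) =
    mkAdded _ (IsPoly-affine (suc S) N pw) (~-reindex e (suc S) N) (λ n → c _) (λ n → r _)

  addedPivot : ∀ {w} M → IsPoly w → AddedPivot (addPivot w M) M
  addedPivot {w} M pw = mkAdded w pw (addPivot-~ M pw) (addPivot-corner w M) (addPivot-entry w M)

  AddedPivot-RatDv : ∀ F G → AddedPivot F G → RatDv (corner F) (entry F) → RatDv (corner G) (entry G)
  AddedPivot-RatDv F G (mkAdded w pw _ c r) (v , v≢0 , u , pu , e) = v , v≢0 , _ ,
    IsPoly-+ pu (IsPoly-neg (IsPoly-scale v pw)) , λ n → begin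
      v * entry G n ≡⟨ id₁ v (entry G n) (w n) (corner G n) ⟩
      v * (entry G n + w n * corner G n) + - (v * w n) * corner G n ≡⟨ cong (λ x → v * x + - (v * w n) * corner G n) (sym (r n)) ⟩
      v * entry F n + - (v * w n) * corner G n ≡⟨ cong (λ x → x + - (v * w n) * corner G n) (trans (e n) (cong (u n *_) (c n))) ⟩
      u n * corner G n + - (v * w n) * corner G n ≡⟨ sym (ℤₚ.*-distribʳ-+ (corner G n) (u n) (- (v * w n))) ⟩
      (u n + - (v * w n)) * corner G n ∎
    where
    open ≡-Reasoning
    id₁ : ∀ v b w a → v * b ≡ v * (b + w * a) + - (v * w) * a
    id₁ = solve-∀

  -- The recursion is on the degree bound of the entry: a substitution leaves it alone, the
  -- subsequent cancellation lowers it, and the pivot retains its degree throughout.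
  degree-column-step : ∀ {d e} (M : Matrix) → IsPolyMat M → HasDegree d (corner M) → Deg< e (entry M) →
    Split (λ G → Deg↓ d G ⊎ RatDv (corner G) (entry G)) M
  degree-column-step M p h (null z) = leaf (inj₂ (1ℤ , (λ ()) , (λ _ → 0ℤ) , IsPoly-const 0ℤ ,
    λ n → trans (ℤₚ.*-identityˡ (entry M n)) (z n)))
  degree-column-step {d} {suc e} M p h@(la , la≢0 , La) (lead c g pg ex) with c ℤ.≟ 0ℤ
  ... | yes refl = degree-column-step M p h (Deg<-cong (λ n → trans (ex n) (ℤₚ.+-identityˡ (g n))) pg)
  ... | no c≢0 with ℕₚ.<-cmp e d
  ...   | tri< e<d _ _ = leaf (inj₁ (swapPivot M , swapPivot-~ M , e , e<d ,
            HasDegree-cong (swapPivot-corner M) (c , c≢0 , mkLead g pg ex)))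
  ...   | tri≈ _ refl _ with equal-degree la c (<-wellFounded ∣ la ∣) M la≢0 c≢0 La (mkLead g pg ex)
  ...     | inj₁ pr = leaf (inj₁ pr)
  ...     | inj₂ (v , v≢0 , u , _ , eqn) = leaf (inj₂ (v , v≢0 , (λ _ → u) , IsPoly-const u , eqn))
  degree-column-step {d} {suc e} M p h@(la , la≢0 , La) (lead c g pg ex) | no c≢0 | tri> _ _ d<e
    with nonzero-abs la≢0
  ... | S , σ , laσ = node S 0 λ t → cancel (toℕ t)
    where
    K : ℤ
    K = + suc S
    ℓ : ℕ
    ℓ = e ℕ.∸ suc d
    ℓ+1+d≡e : ℓ ℕ.+ suc d ≡ e
    ℓ+1+d≡e = ℕₚ.m∸n+n≡m d<e
    -- After the substitution the leading coefficients are c K^e and la K^d. Their quotient c K^(e -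
    -- d) / la is the integer c σ K^ℓ, because la σ = K and ℓ = e - d - 1.
    κ : ℤ
    κ = c * σ * K ^ ℓ
    w : ℕ → ℤ
    w n = - κ * (+ n) ^ suc ℓ
    pw : IsPoly w
    pw = IsPoly-scale (- κ) (IsPoly-pow (suc ℓ))
    cancel : ∀ t → Split (λ G → Deg↓ d G ⊎ RatDv (corner G) (entry G)) (λ m → M (suc S ℕ.* m ℕ.+ t))
    cancel t = split-transfer AddedPivot AddedPivot-stable finish (addedPivot M′ pw)
      (degree-column-step (addPivot w M′) (~-poly (addPivot-~ M′ pw) p′) h″ deg)
      where
      M′ : Matrix
      M′ m = M (suc S ℕ.* m ℕ.+ t)
      p′ : IsPolyMat M′
      p′ = IsPolyMat-stable M S t p
      h″ : HasDegree d (corner (addPivot w M′))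
      h″ = HasDegree-cong (addPivot-corner w M′) (HasDegree-affine S t h)
      finish : ∀ F G → AddedPivot F G → Deg↓ d F ⊎ RatDv (corner F) (entry F) → Deg↓ d G ⊎ RatDv (corner G) (entry G)
      finish F G r (inj₁ (F′ , e , pr)) = inj₁ (F′ , ~-trans (AddedPivot.equiv r) e , pr)
      finish F G r (inj₂ dv)            = inj₂ (AddedPivot-RatDv F G r dv)
      lead-cancels : c * K ^ e + - κ * (la * K ^ d) ≡ 0ℤ
      lead-cancels = begin
        c * K ^ e + - κ * (la * K ^ d)
          ≡⟨ cong (λ x → c * x + - κ * (la * K ^ d)) (trans (cong (K ^_) (sym ℓ+1+d≡e)) (ℤₚ.^-distribˡ-+-* K ℓ (suc d))) ⟩
        c * (K ^ ℓ * (K * K ^ d)) + - (c * σ * K ^ ℓ) * (la * K ^ d)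
          ≡⟨ id c (K ^ ℓ) K (K ^ d) σ la ⟩
        c * K ^ ℓ * K ^ d * (K - la * σ)
          ≡⟨ cong (c * K ^ ℓ * K ^ d *_) (ℤₚ.i≡j⇒i-j≡0 (sym laσ)) ⟩
        c * K ^ ℓ * K ^ d * 0ℤ ≡⟨ ℤₚ.*-zeroʳ (c * K ^ ℓ * K ^ d) ⟩
        0ℤ ∎
        where
        open ≡-Reasoning
        id : ∀ c x y z s a → c * (x * (y * z)) + - (c * s * x) * (a * z) ≡ c * x * z * (y - a * s)
        id = solve-∀
      L′ : Lead e 0ℤ (entry (addPivot w M′))
      L′ = subst (λ x → Lead e x (entry (addPivot w M′))) lead-cancels
        (Lead-cong (λ n → trans (addPivot-entry w M′ n) (cong (λ x → entry M′ n + x) (ℤₚ.*-assoc (- κ) ((+ n) ^ suc ℓ) (corner M′ n))))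
          (Lead-linear (- κ) (Lead-affine (suc S) t {c = c} (mkLead g pg ex))
            (subst (λ x → Lead x (la * K ^ d) (λ n → (+ n) ^ suc ℓ * corner M′ n)) (trans (sym (ℕₚ.+-suc ℓ d)) ℓ+1+d≡e)
              (Lead-monomial (suc ℓ) (Lead-affine (suc S) t La)))))
      deg : Deg< e (entry (addPivot w M′))
      deg = Deg<-cong (λ n → trans (Lead.expand L′ n) (ℤₚ.+-identityˡ (Lead.rest L′ n))) (Lead.rest-deg L′)

  -- Over ℚ[t] the entry is (u′ / K) a with K = |v|. On each class modulo K, u′ is a constant
  -- remainder r plus K times an integer polynomial, which w removes. The new pivot is then ((K + r)
  -- / K) a with r ≥ 0, so its degree is that of a.
  degree-combine : ∀ {d} (M : Matrix) → IsPolyMat M → HasDegree d (corner M) → RatDv (corner M) (entry M) →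
    Split (λ G → Σ (ℕ → ℤ) λ w → IsPoly w × HasDegree d (λ n → corner G n + (entry G n + w n * corner G n))) M
  degree-combine {d} M p h@(c , c≢0 , L) (v , v≢0 , u , pu , eqn) with nonzero-abs v≢0
  ... | S , σ , vσ = node S 0 λ t → leaf (shrink (toℕ t))
    where
    K : ℤ
    K = + suc S
    u′ : ℕ → ℤ
    u′ n = σ * u n
    eqn′ : ∀ n → K * entry M n ≡ u′ n * corner M n
    eqn′ n = trans (cong (_* entry M n) (sym vσ)) (trans (id v σ (entry M n)) (trans (cong (σ *_) (eqn n)) (sym (ℤₚ.*-assoc σ (u n) (corner M n)))))
      where
      id : ∀ v s b → v * s * b ≡ s * (v * b)
      id = solve-∀
    shrink : ∀ t → let G = λ m → M (suc S ℕ.* m ℕ.+ t) in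
      Σ (ℕ → ℤ) λ w → IsPoly w × HasDegree d (λ n → corner G n + (entry G n + w n * corner G n))
    shrink t with affine-expansion (suc S) t (IsPoly-scale σ pu)
    ... | H , pH , eH = w , pw , HasDegree-unscale {K} (λ ())
        (IsPoly-+ (pG zero zero) (IsPoly-+ (pG (suc i) zero) (IsPoly-* pw (pG zero zero))))
        (HasDegree-cong scaled ((K + + r) * c′ , *-nonzero {K + + r} (λ ()) c′≢0 , Lead-scale (K + + r) L′))
      where
      G : Matrix
      G m = M (suc S ℕ.* m ℕ.+ t)
      pG : IsPolyMat G
      pG = IsPolyMat-stable M S t p
      r : ℕ
      r = u′ t ℤ.%ℕ suc S
      q : ℤ
      q = u′ t ℤ./ℕ suc S
      w : ℕ → ℤ
      w n = - (q + H n)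
      pw : IsPoly w
      pw = IsPoly-neg (IsPoly-+ (IsPoly-const q) pH)
      hG : HasDegree d (corner G)
      hG = HasDegree-affine S t h
      c′ = proj₁ hG
      c′≢0 = proj₁ (proj₂ hG)
      L′ = proj₂ (proj₂ hG)
      open ≡-Reasoning
      id₁ : ∀ k a b w → k * (a + (b + w * a)) ≡ k * a + (k * b + k * w * a)
      id₁ = solve-∀
      id₂ : ∀ k a r q h → k * a + ((r + q * k + k * h) * a + k * - (q + h) * a) ≡ (k + r) * a
      id₂ = solve-∀
      scaled : ∀ n → K * (corner G n + (entry G n + w n * corner G n)) ≡ (K + + r) * corner G n
      scaled n = begin
        K * (corner G n + (entry G n + w n * corner G n)) ≡⟨ id₁ K (corner G n) (entry G n) (w n) ⟩
        K * corner G n + (K * entry G n + K * w n * corner G n)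
          ≡⟨ cong (λ x → K * corner G n + (x + K * w n * corner G n)) (trans (eqn′ (suc S ℕ.* n ℕ.+ t)) (cong (_* corner G n)
               (trans (eH n) (cong (λ x → x + K * H n) (ℤ%.a≡a%ℕn+[a/ℕn]*n (u′ t) (suc S)))))) ⟩
        K * corner G n + ((+ r + q * K + K * H n) * corner G n + K * w n * corner G n)
          ≡⟨ id₂ K (corner G n) (+ r) q (H n) ⟩
        (K + + r) * corner G n ∎

degreeTheory : PivotTheory
degreeTheory = record
  { Piv         = HasDegree
  ; Piv-cong    = HasDegree-cong
  ; Piv-stable  = λ d F S N → HasDegree-affine S N
  ; Dv          = RatDv
  ; Dv-cong     = λ { e (v , v≢0 , u , pu , eq) → v , v≢0 , u , pu , λ n → trans (cong (v *_) (e n)) (eq n) }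
  ; Dv-stable   = λ { S N (v , v≢0 , u , pu , eq) → v , v≢0 , _ , IsPoly-affine (suc S) N pu , λ n → eq _ }
  ; Dv-refl     = 1ℤ , (λ ()) , (λ _ → 1ℤ) , IsPoly-const 1ℤ , λ n → refl
  ; Dv-trans    = RatDv-trans
  ; Dv-linear   = RatDv-linear
  ; column-step = λ i M p h → degree-column-step i M p h (proj₂ (p (suc i) zero))
  ; combine     = λ i M → degree-combine i M
  }

-- Constant pivots

PolyDv : (ℕ → ℤ) → (ℕ → ℤ) → Set
PolyDv a b = Σ (ℕ → ℤ) λ w → IsPoly w × (∀ n → b n ≡ w n * a n)

ConstPivot : ℕ → (ℕ → ℤ) → Set
ConstPivot m a = 1 ℕ.≤ m × (∀ n → a n ≡ + m)

PolyDv-trans : ∀ {a b c} → PolyDv a b → PolyDv b c → PolyDv a c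
PolyDv-trans {a} (w , p , e) (w′ , p′ , e′) = _ , IsPoly-* p′ p , λ n →
  trans (e′ n) (trans (cong (w′ n *_) (e n)) (sym (ℤₚ.*-assoc (w′ n) (w n) (a n))))

PolyDv-linear : ∀ {a b c w} → IsPoly w → PolyDv a b → PolyDv a c → PolyDv a (λ n → b n + w n * c n)
PolyDv-linear {a} {w = w} pw (u , p , e) (u′ , p′ , e′) = _ , IsPoly-+ p (IsPoly-* pw p′) , λ n →
  trans (cong₂ (λ x y → x + w n * y) (e n) (e′ n)) (id (u n) (a n) (w n) (u′ n))
  where
  id : ∀ u a w v → u * a + w * (v * a) ≡ (u + w * v) * a
  id = solve-∀

-- The pivot m is its own modulus: under t ↦ m t + i the nonconstant coefficients of the entry
-- become divisible by m. Division by m therefore leaves a constant remainder, which is either 0 or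
-- a smaller positive pivot.
const-column-step : ∀ {k s m} (i : Fin k) (M : ℕ → Mat (suc k) (suc s)) → IsPolyMat M → ConstPivot m (corner M) →
  Split (λ G → Progress ConstPivot m G ⊎ PolyDv (corner G) (λ n → G n (suc i) zero)) M
const-column-step {k} {s} {suc S} i M p (_ , piv) = node S 0 λ t → leaf (divide (toℕ t))
  where
  K : ℤ
  K = + suc S
  divide : ∀ t → let G = λ m → M (suc S ℕ.* m ℕ.+ t) in
    Progress ConstPivot (suc S) G ⊎ PolyDv (corner G) (λ n → G n (suc i) zero)
  divide t = by-expansion (affine-expansion (suc S) t (p (suc i) zero))
    where
    G : ℕ → Mat (suc k) (suc s)
    G m = M (suc S ℕ.* m ℕ.+ t)
    b₀ : ℤ
    b₀ = M t (suc i) zero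
    r : ℕ
    r = b₀ ℤ.%ℕ suc S
    q : ℤ
    q = b₀ ℤ./ℕ suc S
    by-expansion : (Σ (ℕ → ℤ) λ h → IsPoly h × (∀ n → G n (suc i) zero ≡ b₀ + K * h n)) →
      Progress ConstPivot (suc S) G ⊎ PolyDv (corner G) (λ n → G n (suc i) zero)
    by-expansion (h , ph , eh) = by-remainder r refl
      where
      w : ℕ → ℤ
      w n = - (q + h n)
      p-quot : IsPoly (λ n → q + h n)
      p-quot = IsPoly-+ (IsPoly-const q) ph
      id₁ : ∀ r q k h → r + q * k + k * h ≡ r + (q + h) * k
      id₁ = solve-∀
      id₂ : ∀ r x k → r + x * k + - x * k ≡ r
      id₂ = solve-∀
      division : ∀ n → G n (suc i) zero ≡ + r + (q + h n) * corner G n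
      division n = trans (eh n) (trans (cong (λ x → x + K * h n) (ℤ%.a≡a%ℕn+[a/ℕn]*n b₀ (suc S)))
        (trans (id₁ (+ r) q K (h n)) (cong (λ x → + r + (q + h n) * x) (sym (piv (suc S ℕ.* n ℕ.+ t))))))
      by-remainder : ∀ r′ → r ≡ r′ → Progress ConstPivot (suc S) G ⊎ PolyDv (corner G) (λ n → G n (suc i) zero)
      by-remainder zero r≡0 = inj₂ ((λ n → q + h n) , p-quot , λ n →
        trans (division n) (trans (cong (λ x → + x + (q + h n) * corner G n) r≡0) (ℤₚ.+-identityˡ ((q + h n) * corner G n))))
      by-remainder (suc r′) eq = inj₁ (swapPivot i G′ , ~-trans (addPivot-~ i G (IsPoly-neg p-quot)) (swapPivot-~ i G′) ,
        suc r′ , subst (ℕ._< suc S) eq (ℤ%.n%ℕd<d b₀ (suc S)) , ℕ.s≤s ℕ.z≤n , λ n →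
          trans (swapPivot-corner i G′ n) (trans (addPivot-entry i w G n)
            (trans (cong (λ x → x + w n * corner G n) (division n))
              (trans (id₂ (+ r) (q + h n) (corner G n)) (cong +_ eq)))))
        where
        G′ : ℕ → Mat (suc k) (suc s)
        G′ = addPivot i w G

constTheory : PivotTheory
constTheory = record
  { Piv         = ConstPivot
  ; Piv-cong    = λ { e (p , a) → p , λ n → trans (e n) (a n) }
  ; Piv-stable  = λ { m F S N (p , a) → p , λ n → a _ }
  ; Dv          = PolyDv
  ; Dv-cong     = λ { e (w , p , eq) → w , p , λ n → trans (e n) (eq n) }
  ; Dv-stable   = λ { S N (w , p , eq) → _ , IsPoly-affine (suc S) N p , λ n → eq _ }
  ; Dv-refl     = λ {a} → (λ _ → 1ℤ) , IsPoly-const 1ℤ , λ n → sym (ℤₚ.*-identityˡ (a n))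
  ; Dv-trans    = PolyDv-trans
  ; Dv-linear   = PolyDv-linear
  ; column-step = const-column-step
  -- Subtracting the quotient times row 0 makes the first entry of row i zero, so the addition to
  -- row 0 does not change the pivot at all.
  ; combine     = λ { i M p (1≤m , a) (w , pw , eq) → leaf ((λ n → - w n) , IsPoly-neg pw , 1≤m , λ n →
      trans (cong (λ x → corner M n + (x + - w n * corner M n)) (eq n)) (trans (cancel (corner M n) (w n)) (a n))) }
  }
  where
  cancel : ∀ a w → a + (w * a + - w * a) ≡ a
  cancel = solve-∀

-- Extracting the pivot as a common factor

scalar-· : ∀ {k s} c a (U : Mat k k) (V : Mat s s) {A B : Mat k s} → (∀ i j → c * A i j ≡ B i j * a) →
  ∀ i j → c * ((U · A) · V) i j ≡ ((U · B) · V) i j * a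
scalar-· {k} {s} c a U V {A} {B} e i j = begin
  c * ((U · A) · V) i j
    ≡⟨ sym (sum-*ˡ c (λ l → (U · A) i l * V l j)) ⟩
  sumℤ (λ l → c * ((U · A) i l * V l j))
    ≡⟨ sum-cong (λ l → trans (sym (ℤₚ.*-assoc c ((U · A) i l) (V l j))) (trans (cong (_* V l j) (left l)) (swap ((U · B) i l) a (V l j)))) ⟩
  sumℤ (λ l → (U · B) i l * V l j * a)
    ≡⟨ sum-*ʳ a (λ l → (U · B) i l * V l j) ⟩
  ((U · B) · V) i j * a ∎
  where
  open ≡-Reasoning
  swap : ∀ x a v → x * a * v ≡ x * v * a
  swap = solve-∀
  comm : ∀ c u x → c * (u * x) ≡ u * (c * x)
  comm = solve-∀
  left : ∀ l → c * (U · A) i l ≡ (U · B) i l * a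
  left l = begin
    c * (U · A) i l
      ≡⟨ sym (sum-*ˡ c (λ m → U i m * A m l)) ⟩
    sumℤ (λ m → c * (U i m * A m l))
      ≡⟨ sum-cong (λ m → trans (comm c (U i m) (A m l)) (trans (cong (U i m *_) (e m l)) (sym (ℤₚ.*-assoc (U i m) (B m l) a)))) ⟩
    sumℤ (λ m → U i m * B m l * a)
      ≡⟨ sum-*ʳ a (λ m → U i m * B m l) ⟩
    (U · B) i l * a ∎

common-multiple : ∀ {n} {P : Fin n → ℤ → Set} → (∀ i v w → P i v → P i (w * v)) →
  (∀ i → Σ ℤ λ v → v ≢ 0ℤ × P i v) → Σ ℤ λ v → v ≢ 0ℤ × (∀ i → P i v)
common-multiple {zero}  mult h = 1ℤ , (λ ()) , λ ()
common-multiple {suc n} {P} mult h with h zero | common-multiple {P = λ i → P (suc i)} (λ i → mult (suc i)) (λ i → h (suc i))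
... | v , v≢0 , p | w , w≢0 , q = w * v , *-nonzero w≢0 v≢0 , λ where
  zero    → mult zero v w p
  (suc i) → subst (P (suc i)) (ℤₚ.*-comm v w) (mult (suc i) w v (q i))

-- The corner of `w` is required to be 1 separately, because the pivot may vanish at some n and then
-- the divisibility equation says nothing about it.
Divided : ∀ {k s} → (ℕ → Mat (suc k) (suc s)) → Set
Divided {k} {s} M = Σ (ℕ → Mat (suc k) (suc s)) λ M′ → M ~ M′ × Σ (ℕ → Mat (suc k) (suc s)) λ w → IsPolyMat w ×
  (∀ n → corner w n ≡ 1ℤ) × (∀ n i j → M′ n i j ≡ w n i j * corner M′ n)

module _ {k s : ℕ} where

  private
    Matrix : Set
    Matrix = ℕ → Mat (suc k) (suc s)

  -- G is the rational multiple a / c of F.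
  record Proportional (F G : Matrix) : Set where
    constructor mkProp
    field
      c      : ℤ
      c≢0    : c ≢ 0ℤ
      a      : ℕ → ℤ
      G-poly : IsPolyMat G
      prop   : ∀ n i j → c * G n i j ≡ F n i j * a n

  Proportional-stable : ∀ F G S N → Proportional F G →
    Proportional (λ m → F (suc S ℕ.* m ℕ.+ N)) (λ m → G (suc S ℕ.* m ℕ.+ N))
  Proportional-stable F G S N (mkProp c c≢0 a p e) = mkProp c c≢0 _ (IsPolyMat-stable G S N p) λ n → e _

  -- The operations that reduce F are applied to G. From U F V = m w and c G = a F follows c (U G V)
  -- = m a w. As w has corner 1, m a is c times the new pivot of G, and c cancels.
  Proportional-divided : ∀ F G → Proportional F G → Pivoting.Reduced constTheory F → Divided G
  Proportional-divided F G (mkProp c c≢0 a pG e) (F′ , mk~ {U} {V} pU pV gU gV eF , (m , 1≤m , piv) , dv) =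
    G′ , mk~ {U = U} {V} pU pV gU gV (λ n i j → refl) ,
    (λ n i j → proj₁ (dv i j) n) , (λ i j → proj₁ (proj₂ (dv i j))) , corner-one , divided
    where
    G′ : Matrix
    G′ n = (U n · G n) · V n
    m≢0 : + m ≢ 0ℤ
    m≢0 refl = ℕₚ.<-irrefl refl 1≤m
    w : ∀ i j → ℕ → ℤ
    w i j = proj₁ (dv i j)
    eq : ∀ n i j → F′ n i j ≡ w i j n * + m
    eq n i j = trans (proj₂ (proj₂ (dv i j)) n) (cong (w i j n *_) (piv n))
    corner-one : ∀ n → w zero zero n ≡ 1ℤ
    corner-one n = *-cancelˡ m≢0 (trans (ℤₚ.*-comm (+ m) (w zero zero n))
      (trans (sym (eq n zero zero)) (trans (piv n) (sym (ℤₚ.*-identityʳ (+ m))))))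
    prop′ : ∀ n i j → c * G′ n i j ≡ w i j n * + m * a n
    prop′ n i j = trans (scalar-· c (a n) (U n) (V n) {G n} {F n} (e n) i j) (cong (_* a n) (trans (eF n i j) (eq n i j)))
    id₁ : ∀ w m a → w * m * a ≡ w * (m * a)
    id₁ = solve-∀
    id₂ : ∀ w c g → w * (c * g) ≡ c * (w * g)
    id₂ = solve-∀
    pivot : ∀ n → c * corner G′ n ≡ + m * a n
    pivot n = trans (prop′ n zero zero) (cong (_* a n) (trans (cong (_* + m) (corner-one n)) (ℤₚ.*-identityˡ (+ m))))
    divided : ∀ n i j → G′ n i j ≡ w i j n * corner G′ n
    divided n i j = *-cancelˡ c≢0 (trans (prop′ n i j) (trans (id₁ (w i j n) (+ m) (a n))
      (trans (cong (w i j n *_) (sym (pivot n))) (id₂ (w i j n) c (corner G′ n)))))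

  divide-entries : ∀ {d} (M : Matrix) → IsPolyMat M → HasDegree d (corner M) → Split Divided M
  divide-entries M p h = split-bind IsPolyMat-stable p (Pivoting.reduce degreeTheory M (p , h)) λ where
      G pG (G′ , e , _ , dv) → split-transfer (λ F K → K ~ F) (λ F K S N r → ~-reindex r (suc S) N)
        (λ { F K r (F′ , e′ , rest) → F′ , ~-trans r e′ , rest }) e (rational G′ (~-poly e pG) dv)
    where
    Quotient : Matrix → Fin (suc k) → Fin (suc s) → ℤ → Set
    Quotient G i j v = Σ (ℕ → ℤ) λ u → IsPoly u × (∀ n → v * G n i j ≡ u n * corner G n)
    Quotient-mult : ∀ G i j v w → Quotient G i j v → Quotient G i j (w * v)
    Quotient-mult G i j v w (u , pu , e) = _ , IsPoly-scale w pu , λ n →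
      trans (ℤₚ.*-assoc w v (G n i j)) (trans (cong (w *_) (e n)) (sym (ℤₚ.*-assoc w (u n) (corner G n))))
    rational : ∀ G → IsPolyMat G → (∀ i j → RatDv (corner G) (λ n → G n i j)) → Split Divided G
    rational G pG dv = with-denominator (common-multiple (λ i v w q j → Quotient-mult G i j v w (q j))
      λ i → common-multiple (λ j v w → Quotient-mult G i j v w) (dv i))
      where
      with-denominator : (Σ ℤ λ v → v ≢ 0ℤ × (∀ i j → Quotient G i j v)) → Split Divided G
      with-denominator (v , v≢0 , quot) with nonzero-abs v≢0
      ... | S , σ , vσ = split-transfer Proportional Proportional-stable Proportional-divided
          (mkProp (+ suc S) (λ ()) (corner G) pG N-prop)
          (Pivoting.reduce constTheory N (N-poly , ℕ.s≤s ℕ.z≤n , λ n → refl))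
        where
        u : ∀ i j → ℕ → ℤ
        u i j = proj₁ (quot i j)
        -- `N` is |v| / a times `G`. Its corner is set to |v| outright, since the equation for the
        -- quotient at the corner determines it only where the pivot a is nonzero.
        N : Matrix
        N n zero    zero    = + suc S
        N n zero    (suc j) = σ * u zero (suc j) n
        N n (suc i) j       = σ * u (suc i) j n
        N-poly : IsPolyMat N
        N-poly zero    zero    = IsPoly-const (+ suc S)
        N-poly zero    (suc j) = IsPoly-scale σ (proj₁ (proj₂ (quot zero (suc j))))
        N-poly (suc i) j       = IsPoly-scale σ (proj₁ (proj₂ (quot (suc i) j)))
        id : ∀ v s g → v * s * g ≡ s * (v * g)
        id = solve-∀
        multiple : ∀ i j n → + suc S * G n i j ≡ σ * u i j n * corner G n
        multiple i j n = trans (cong (_* G n i j) (sym vσ)) (trans (id v σ (G n i j))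
          (trans (cong (σ *_) (proj₂ (proj₂ (quot i j)) n)) (sym (ℤₚ.*-assoc σ (u i j n) (corner G n)))))
        N-prop : ∀ n i j → + suc S * G n i j ≡ N n i j * corner G n
        N-prop n zero    zero    = refl
        N-prop n zero    (suc j) = multiple zero (suc j) n
        N-prop n (suc i) j       = multiple (suc i) j n

-- The Smith algorithm

NonNegDivided : ∀ {k s} → (ℕ → Mat (suc k) (suc s)) → Set
NonNegDivided {k} {s} M = Σ (ℕ → ℤ) λ h → (∀ n → 0ℤ ℤ.≤ h n) × Σ (ℕ → Mat (suc k) (suc s)) λ w → IsPolyMat w ×
  (∀ n → corner w n ≡ 1ℤ) × (M ~ λ n i j → w n i j * h n)

make-nonNeg : ∀ {k s} (M : ℕ → Mat (suc k) (suc s)) → IsPolyMat M → Divided M → Split NonNegDivided M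
make-nonNeg {k} {s} M pM (M′ , e , w , pw , w₁ , div) = by-sign (sign-eventually-constant (~-poly e pM zero zero))
  where
  tail : (M″ w″ : ℕ → Mat (suc k) (suc s)) (h : ℕ → ℤ) → M ~ M″ → IsPolyMat w″ → (∀ n → corner w″ n ≡ 1ℤ) →
    (∀ n i j → M″ n i j ≡ w″ n i j * h n) → Eventually (λ n → 0ℤ ℤ.≤ h n) → Split NonNegDivided M
  -- The modulus is 1: this splitting only discards the arguments below N.
  tail M″ w″ h e p w₁ div (N , nonneg) = node 0 N λ i → leaf (restrict (N ℕ.+ toℕ i) (ℕₚ.m≤m+n N (toℕ i)))
    where
    restrict : ∀ r → N ℕ.≤ r → NonNegDivided (λ n → M (1 ℕ.* n ℕ.+ r))
    restrict r N≤r = (λ n → h (1 ℕ.* n ℕ.+ r)) , (λ n → nonneg _ (ℕₚ.≤-trans N≤r (ℕₚ.m≤n+m r (1 ℕ.* n)))) ,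
      (λ n → w″ (1 ℕ.* n ℕ.+ r)) , IsPolyMat-stable w″ 0 r p , (λ n → w₁ _) ,
      ~-trans (~-reindex e 1 r) (~-reflexive λ n → div _)
  -- Row 0 of the matrix is negated and the common factor changes sign. So row 0 of w, with its
  -- corner 1, stays, and all other rows of w change sign.
  w⁻ : ℕ → Mat (suc k) (suc s)
  w⁻ n zero    j = w n zero j
  w⁻ n (suc i) j = - w n (suc i) j
  w⁻-poly : IsPolyMat w⁻
  w⁻-poly zero    j = pw zero j
  w⁻-poly (suc i) j = IsPoly-neg (pw (suc i) j)
  id₁ : ∀ w h → w * h + 1ℤ * (- (+ 2) * (w * h)) ≡ w * - h
  id₁ = solve-∀
  id₂ : ∀ w h → w * h + 0ℤ ≡ - w * - h
  id₂ = solve-∀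
  negated : ∀ n i j → rowAdd zero zero (- (+ 2)) (M′ n) i j ≡ w⁻ n i j * - corner M′ n
  negated n zero    j = trans (cong (λ x → x + 1ℤ * (- (+ 2) * x)) (div n zero j)) (id₁ (w n zero j) (corner M′ n))
  negated n (suc i) j = trans (cong (λ x → x + 0ℤ) (div n (suc i) j)) (id₂ (w n (suc i) j) (corner M′ n))
  by-sign : Eventually (λ n → 0ℤ ℤ.≤ corner M′ n) ⊎ Eventually (λ n → 0ℤ ℤ.≤ - corner M′ n) → Split NonNegDivided M
  by-sign (inj₁ nonneg) = tail M′ w (corner M′) e pw w₁ div nonneg
  by-sign (inj₂ nonneg) = tail _ w⁻ (λ n → - corner M′ n)
    (~-trans e (~-rowAdd zero zero (IsPoly-const (- (+ 2))) λ _ → inj₂ (refl , refl))) w⁻-poly w₁ negated nonneg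

-- The map `f` keeps k fixed while the induction runs over the number of additions. Row 0 never
-- changes, so the additions do not interact.
~-addRows : ∀ {k s m} (f : Fin m → Fin k) {c : Fin m → ℕ → ℤ} → (∀ x → IsPoly (c x)) → (M : ℕ → Mat (suc k) s) →
  M ~ (λ n p q → M n p q + sumℤ (λ x → δ p (suc (f x)) * (c x n * M n zero q)))
~-addRows {m = zero} f pc M = ~-reflexive λ n p q → sym (ℤₚ.+-identityʳ (M n p q))
~-addRows {m = suc m} f {c} pc M = ~-trans (~-addRows (λ x → f (suc x)) (λ x → pc (suc x)) M)
  (~-trans (~-rowAdd (suc (f zero)) zero (pc zero) λ _ → inj₁ λ ()) (~-reflexive λ n p q →
    trans (cong (λ y → M n p q + rest n p q + δ p (suc (f zero)) * (c zero n * y)) (row-zero n q))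
      (id (M n p q) (rest n p q) (δ p (suc (f zero)) * (c zero n * M n zero q)))))
  where
  rest : ∀ n p q → ℤ
  rest n p q = sumℤ (λ x → δ p (suc (f (suc x))) * (c (suc x) n * M n zero q))
  row-zero : ∀ n q → M n zero q + rest n zero q ≡ M n zero q
  row-zero n q = trans (cong (λ x → M n zero q + x) (sum-zero {m} {λ x → 0ℤ * (c (suc x) n * M n zero q)} λ x → refl))
    (ℤₚ.+-identityʳ (M n zero q))
  id : ∀ a r d → a + r + d ≡ a + (d + r)
  id = solve-∀

clearColumn : ∀ {k s} → (Fin k → ℤ) → Mat (suc k) s → Mat (suc k) s
clearColumn c A zero    q = A zero q
clearColumn c A (suc i) q = A (suc i) q + c i * A zero q

~-clearColumn : ∀ {k s} {c : ℕ → Fin k → ℤ} → (∀ i → IsPoly (λ n → c n i)) → (M : ℕ → Mat (suc k) s) →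
  M ~ (λ n → clearColumn (c n) (M n))
~-clearColumn {k} {c = c} pc M = ~-trans (~-addRows (λ x → x) pc M) (~-reflexive λ where
  n zero    q → trans (cong (λ x → M n zero q + x) (sum-zero {k} {λ x → 0ℤ * (c n x * M n zero q)} λ x → refl))
    (ℤₚ.+-identityʳ (M n zero q))
  n (suc i) q → cong (λ x → M n (suc i) q + x) (sum-δˡ i (λ x → c n x * M n zero q)))

-- The Schur complement of the corner, in the case that the corner is 1.
complement : ∀ {k s} → Mat (suc k) (suc s) → Mat k s
complement w i j = w (suc i) (suc j) - w (suc i) zero * w zero (suc j)

~-complement : ∀ {k s} (h : ℕ → ℤ) (w : ℕ → Mat (suc k) (suc s)) → IsPolyMat w → (∀ n → corner w n ≡ 1ℤ) →
  (λ n i j → w n i j * h n) ~ (λ n → block (h n) (λ i j → complement (w n) i j * h n))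
~-complement h w pw w₁ =
  ~-trans (~-clearColumn (λ i → IsPoly-neg (pw (suc i) zero)) M)
  (~-trans (~-ᵀ (~-clearColumn (λ j → IsPoly-neg (pw zero (suc j))) (λ n → M₁ n ᵀ))) (~-reflexive cleared))
  where
  M M₁ : ℕ → Mat _ _
  M n i j = w n i j * h n
  M₁ n = clearColumn (λ i → - w n (suc i) zero) (M n)
  id₁ : ∀ x h → x * h + - x * (1ℤ * h) ≡ 0ℤ
  id₁ = solve-∀
  id₂ : ∀ x y z h → x * h + - y * (z * h) + - z * 0ℤ ≡ (x - y * z) * h
  id₂ = solve-∀
  column : ∀ n i → M₁ n (suc i) zero ≡ 0ℤ
  column n i = trans (cong (λ x → w n (suc i) zero * h n + - w n (suc i) zero * (x * h n)) (w₁ n)) (id₁ (w n (suc i) zero) (h n))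
  cleared : ∀ n → (clearColumn (λ j → - w n zero (suc j)) (M₁ n ᵀ) ᵀ) ≈ block (h n) (λ i j → complement (w n) i j * h n)
  cleared n zero    zero    = trans (cong (_* h n) (w₁ n)) (ℤₚ.*-identityˡ (h n))
  cleared n zero    (suc j) = trans (cong (λ x → w n zero (suc j) * h n + - w n zero (suc j) * (x * h n)) (w₁ n)) (id₁ (w n zero (suc j)) (h n))
  cleared n (suc i) zero    = column n i
  cleared n (suc i) (suc j) = trans (cong (λ x → M₁ n (suc i) (suc j) + - w n zero (suc j) * x) (column n i))
    (id₂ (w n (suc i) (suc j)) (w n (suc i) zero) (w n zero (suc j)) (h n))

-- No rank is recorded: since 0 divides only 0, the zeros come last.
Chain : (ℕ → ℤ) → Set
Chain d = (∀ p → 0ℤ ℤ.≤ d p) × (∀ p → d p ∣ d (suc p))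

Smith : ∀ {k s} → (ℕ → Mat k s) → Set
Smith M = Σ (ℕ → ℕ → ℤ) λ d → (∀ n → Chain (d n)) × (M ~ λ n → diag (d n))

diag-scale : ∀ {k s} d h (i : Fin k) (j : Fin s) → diag d i j * h ≡ diag (λ p → d p * h) i j
diag-scale d h zero    zero    = refl
diag-scale d h zero    (suc j) = refl
diag-scale d h (suc i) zero    = refl
diag-scale d h (suc i) (suc j) = diag-scale (λ p → d (suc p)) h i j

diag-zero : ∀ {k s} (i : Fin k) (j : Fin s) → diag (λ _ → 0ℤ) i j ≡ 0ℤ
diag-zero zero    zero    = refl
diag-zero zero    (suc j) = refl
diag-zero (suc i) zero    = refl
diag-zero (suc i) (suc j) = diag-zero i j

Smith-zero : ∀ {k s} {M : ℕ → Mat k s} → (∀ n i j → M n i j ≡ 0ℤ) → Smith M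
Smith-zero z = (λ _ _ → 0ℤ) , (λ n → (λ p → ℤₚ.≤-refl) , λ p → divides 0ℤ refl) ,
  ~-reflexive λ n i j → trans (z n i j) (sym (diag-zero i j))

0≤* : ∀ {a b} → 0ℤ ℤ.≤ a → 0ℤ ℤ.≤ b → 0ℤ ℤ.≤ a * b
0≤* {a} {b} 0≤a 0≤b = subst (ℤ._≤ a * b) (ℤₚ.*-zeroʳ a) (ℤₚ.*-monoˡ-≤-nonNeg a {{ℤ.nonNegative 0≤a}} 0≤b)

Bordered : ∀ {k s} → (ℕ → Mat k s) → (ℕ → Mat (suc k) (suc s)) → Set
Bordered F G = Σ (ℕ → ℤ) λ h → (∀ n → 0ℤ ℤ.≤ h n) × (G ~ λ n → block (h n) (λ i j → F n i j * h n))

-- The recursion is applied to F and the factor h restored afterwards, so that h divides all later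
-- diagonal entries by construction.
Smith-bordered : ∀ {k s} (F : ℕ → Mat k s) (G : ℕ → Mat (suc k) (suc s)) → Bordered F G → Smith F → Smith G
Smith-bordered {k} {s} F G (h , 0≤h , e) (d , chain , mk~ {U} {V} pU pV gU gV eF) =
  d′ , (λ n → (nonneg n , dvd n)) , ~-trans e (~-trans (~-block h scaled) (~-reflexive bordered))
  where
  d′ : ℕ → ℕ → ℤ
  d′ n zero    = h n
  d′ n (suc p) = d n p * h n
  nonneg : ∀ n p → 0ℤ ℤ.≤ d′ n p
  nonneg n zero    = 0≤h n
  nonneg n (suc p) = 0≤* (proj₁ (chain n) p) (0≤h n)
  dvd : ∀ n p → d′ n p ∣ d′ n (suc p)
  dvd n zero    = divides (d n 0) refl
  dvd n (suc p) = *-monoˡ-∣ (h n) (proj₂ (chain n) p)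
  scaled : (λ n i j → F n i j * h n) ~ (λ n i j → diag (d n) i j * h n)
  scaled = mk~ {U = U} {V} pU pV gU gV λ n i j → trans (sym (ℤₚ.*-identityˡ _))
    (trans (scalar-· 1ℤ (h n) (U n) (V n) {λ i j → F n i j * h n} {F n} (λ a b → ℤₚ.*-identityˡ (F n a b * h n)) i j)
      (cong (_* h n) (eF n i j)))
  bordered : ∀ n → block (h n) (λ i j → diag (d n) i j * h n) ≈ diag (d′ n)
  bordered n zero    zero    = refl
  bordered n zero    (suc j) = refl
  bordered n (suc i) zero    = refl
  bordered n (suc i) (suc j) = diag-scale (d n) (h n) i j

find : ∀ {m} {A : Set} {P : Fin m → Set} → (∀ i → P i ⊎ A) → (∀ i → P i) ⊎ A
find {zero}  h = inj₁ λ ()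
find {suc m} h with h zero | find (λ i → h (suc i))
... | inj₂ a | _      = inj₂ a
... | inj₁ p | inj₂ a = inj₂ a
... | inj₁ p | inj₁ q = inj₁ λ { zero → p ; (suc i) → q i }

to-first-row : ∀ {k s} i (M : ℕ → Mat (suc k) s) → Σ (ℕ → Mat (suc k) s) λ M′ → M ~ M′ × (∀ n j → M′ n zero j ≡ M n i j)
to-first-row zero    M = M , ~-reflexive (λ n i j → refl) , λ n j → refl
to-first-row (suc i) M = _ , ~-rowSwap {i = zero} {suc i} (λ ()) , λ n j → rowSwap-fst {i = zero} {suc i} (λ ()) (M n) j

to-corner : ∀ {k s} i j (M : ℕ → Mat (suc k) (suc s)) → Σ (ℕ → Mat (suc k) (suc s)) λ M′ → M ~ M′ × (∀ n → corner M′ n ≡ M n i j)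
to-corner {k} {s} i j M = second (to-first-row i M)
  where
  second : (Σ (ℕ → Mat (suc k) (suc s)) λ M′ → M ~ M′ × (∀ n j → M′ n zero j ≡ M n i j)) →
    Σ (ℕ → Mat (suc k) (suc s)) λ M′ → M ~ M′ × (∀ n → corner M′ n ≡ M n i j)
  second (M₁ , e₁ , r₁) = let M₂ , e₂ , r₂ = to-first-row j (λ n → M₁ n ᵀ) in
    (λ n → M₂ n ᵀ) , ~-trans e₁ (~-ᵀ e₂) , λ n → trans (r₂ n zero) (r₁ n j)

smith : ∀ k s (M : ℕ → Mat k s) → IsPolyMat M → Split Smith M
smith zero    s       M p = leaf (Smith-zero λ n ())
smith (suc k) zero    M p = leaf (Smith-zero λ n i ())
smith (suc k) (suc s) M p = by-cases (find λ i → find λ j → vanishing? i j)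
  where
  Nonvanishing : Set
  Nonvanishing = Σ (Fin (suc k)) λ i → Σ (Fin (suc s)) λ j → Σ ℕ λ d → HasDegree d (λ n → M n i j)
  vanishing? : ∀ i j → (∀ n → M n i j ≡ 0ℤ) ⊎ Nonvanishing
  vanishing? i j with degree? (proj₂ (p i j))
  ... | inj₁ z           = inj₁ z
  ... | inj₂ (d , _ , h) = inj₂ (i , j , d , h)
  nonNeg-step : ∀ G → IsPolyMat G → NonNegDivided G → Split Smith G
  nonNeg-step G pG (h , 0≤h , w , pw , w₁ , e) = split-transfer Bordered
    (λ { F G S N (h , 0≤h , r) → _ , (λ n → 0≤h _) , ~-reindex r (suc S) N }) Smith-bordered
    (h , 0≤h , ~-trans e (~-complement h w pw w₁))
    (smith k s (λ n → complement (w n)) λ i j →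
      IsPoly-+ (pw (suc i) (suc j)) (IsPoly-neg (IsPoly-* (pw (suc i) zero) (pw zero (suc j)))))
  pivot-step : ∀ {d} G → IsPolyMat G → HasDegree d (corner G) → Split Smith G
  pivot-step G pG h = split-bind IsPolyMat-stable pG (divide-entries G pG h) λ G₁ p₁ divided →
    split-bind IsPolyMat-stable p₁ (make-nonNeg G₁ p₁ divided) nonNeg-step
  by-cases : (∀ i j n → M n i j ≡ 0ℤ) ⊎ Nonvanishing → Split Smith M
  by-cases (inj₁ z) = leaf (Smith-zero λ n i j → z i j n)
  by-cases (inj₂ (i , j , d , h)) = let M₁ , e₁ , c₁ = to-corner i j M in
    split-transfer (λ F K → K ~ F) (λ F K S N r → ~-reindex r (suc S) N) (λ { F K r (d , ch , e) → d , ch , ~-trans r e })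
      e₁ (pivot-step M₁ (~-poly e₁ p) (HasDegree-cong c₁ h))

-- Quasi-polynomials and splittings

eventually-all : ∀ {n} {P : Fin n → ℕ → Set} → (∀ i → Eventually (P i)) → Eventually (λ m → ∀ i → P i m)
eventually-all {zero}  h = 0 , λ m _ ()
eventually-all {suc n} h with h zero | eventually-all (λ i → h (suc i))
... | N , p | N′ , q = N ℕ.+ N′ , λ where
  m le zero    → p m (ℕₚ.≤-trans (ℕₚ.m≤m+n N N′) le)
  m le (suc i) → q m (ℕₚ.≤-trans (ℕₚ.m≤n+m N′ N) le) i

PolyOn : ℕ → (ℕ → ℤ) → Set
PolyOn S f = ∀ i → Eventually λ N → IsPoly (λ m → f (S ℕ.* (m ℕ.+ N) ℕ.+ i))

PolyOn-mult : ∀ k S f → PolyOn S f → PolyOn (k ℕ.* S) f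
PolyOn-mult zero    S f h i = 0 , λ N _ → IsPoly-const (f i)
PolyOn-mult (suc k) S f h i with h i
... | N₀ , p = N₀ , λ N N₀≤N → IsPoly-cong (λ m → cong f (arith k S m N i))
  (IsPoly-affine (suc k) 0 (p (suc k ℕ.* N) (ℕₚ.≤-trans N₀≤N (ℕₚ.m≤m+n N (k ℕ.* N)))))
  where
  arith : ∀ k S m N i → (suc k ℕ.* S) ℕ.* (m ℕ.+ N) ℕ.+ i ≡ S ℕ.* (suc k ℕ.* m ℕ.+ 0 ℕ.+ suc k ℕ.* N) ℕ.+ i
  arith = solveℕ-∀

-- The coefficients are integers because denominators are absorbed into the period |v|. The period
-- is stored as a nonzero integer so that `common-multiple` serves for periods as well as for
-- denominators.
QuasiPoly : (ℕ → ℤ) → Set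
QuasiPoly f = Σ ℤ λ v → v ≢ 0ℤ × PolyOn ∣ v ∣ f

PolyOn-multℤ : ∀ f v w → PolyOn ∣ v ∣ f → PolyOn ∣ w * v ∣ f
PolyOn-multℤ f v w h = subst (λ x → PolyOn x f) (sym (ℤₚ.abs-* w v)) (PolyOn-mult ∣ w ∣ ∣ v ∣ f h)

abs-suc : ∀ {v} → v ≢ 0ℤ → Σ ℕ λ S → ∣ v ∣ ≡ suc S
abs-suc {+ zero}    v≢0 = ⊥-elim (v≢0 refl)
abs-suc {+ suc S}   _   = S , refl
abs-suc { -[1+ S ]} _   = S , refl

residue : ∀ S N n → N ℕ.≤ n → n ≡ suc S ℕ.* ((n ℕ.∸ N) / suc S) ℕ.+ (N ℕ.+ toℕ ((n ℕ.∸ N) mod suc S))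
residue S N n N≤n = begin
  n ≡⟨ sym (ℕₚ.m+[n∸m]≡n N≤n) ⟩
  N ℕ.+ x ≡⟨ cong (N ℕ.+_) (m≡m%n+[m/n]*n x (suc S)) ⟩
  N ℕ.+ (x % suc S ℕ.+ x / suc S ℕ.* suc S) ≡⟨ arith N (x % suc S) (x / suc S) S ⟩
  suc S ℕ.* (x / suc S) ℕ.+ (N ℕ.+ x % suc S) ≡⟨ cong (λ r → suc S ℕ.* (x / suc S) ℕ.+ (N ℕ.+ r)) (sym (toℕ-fromℕ< (m%n<n x (suc S)))) ⟩
  suc S ℕ.* (x / suc S) ℕ.+ (N ℕ.+ toℕ (x mod suc S)) ∎
  where
  open ≡-Reasoning
  x = n ℕ.∸ N
  arith : ∀ N r q S → N ℕ.+ (r ℕ.+ q ℕ.* suc S) ≡ suc S ℕ.* q ℕ.+ (N ℕ.+ r)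
  arith = solveℕ-∀

split⇒QuasiPoly : ∀ {f} → Split IsPoly f → QuasiPoly f
split⇒QuasiPoly {f} (leaf p) = 1ℤ , (λ ()) , λ i → 0 , λ N _ →
  IsPoly-cong (λ m → cong f (arith m N i)) (IsPoly-affine 1 (N ℕ.+ i) p)
  where
  arith : ∀ m N i → 1 ℕ.* (m ℕ.+ N) ℕ.+ i ≡ 1 ℕ.* m ℕ.+ (N ℕ.+ i)
  arith = solveℕ-∀
split⇒QuasiPoly {f} (node S N t) = merge (common-multiple (λ i → PolyOn-multℤ (λ m → f (suc S ℕ.* m ℕ.+ (N ℕ.+ toℕ i)))) λ i → split⇒QuasiPoly (t i))
  where
  merge : (Σ ℤ λ v → v ≢ 0ℤ × (∀ i → PolyOn ∣ v ∣ (λ m → f (suc S ℕ.* m ℕ.+ (N ℕ.+ toℕ i))))) → QuasiPoly f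
  merge (v , v≢0 , h) = + suc S * v , *-nonzero {+ suc S} (λ ()) v≢0 ,
    subst (λ x → PolyOn x f) (sym (ℤₚ.abs-* (+ suc S) v)) on
    where
    T : ℕ
    T = ∣ v ∣
    T≥1 : 1 ℕ.≤ T
    T≥1 = subst (1 ℕ.≤_) (sym (proj₂ (abs-suc v≢0))) (ℕ.s≤s ℕ.z≤n)
    on : PolyOn (suc S ℕ.* T) f
    on l = shifted (h i e)
      where
      -- A representative of the class of l that is at least N, which makes `y ∸ N` a true
      -- difference. It lies in child i at position e; having used up N periods, it turns the shift
      -- N′ into N′ ∸ N.
      y : ℕ
      y = l ℕ.+ suc S ℕ.* T ℕ.* N
      N≤y : N ℕ.≤ y
      N≤y = ℕₚ.≤-trans (subst (ℕ._≤ suc S ℕ.* T ℕ.* N) (ℕₚ.*-identityˡ N)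
        (ℕₚ.*-monoˡ-≤ N {1} {suc S ℕ.* T} (ℕₚ.≤-trans T≥1 (ℕₚ.m≤m+n T (S ℕ.* T))))) (ℕₚ.m≤n+m _ l)
      i : Fin (suc S)
      i = (y ℕ.∸ N) mod suc S
      e : ℕ
      e = (y ℕ.∸ N) / suc S
      shifted : Eventually (λ N′ → IsPoly (λ m → f (suc S ℕ.* (T ℕ.* (m ℕ.+ N′) ℕ.+ e) ℕ.+ (N ℕ.+ toℕ i)))) →
        Eventually (λ N′ → IsPoly (λ m → f (suc S ℕ.* T ℕ.* (m ℕ.+ N′) ℕ.+ l)))
      shifted (N₀ , p) = N₀ ℕ.+ N , λ N′ le → IsPoly-cong (λ m → cong f (reparam N′ le m))
          (p (N′ ℕ.∸ N) (subst (ℕ._≤ N′ ℕ.∸ N) (ℕₚ.m+n∸n≡m N₀ N) (ℕₚ.∸-monoˡ-≤ N le)))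
        where
        arith₁ : ∀ S T m k N l → suc S ℕ.* T ℕ.* (m ℕ.+ (k ℕ.+ N)) ℕ.+ l ≡ suc S ℕ.* T ℕ.* (m ℕ.+ k) ℕ.+ (l ℕ.+ suc S ℕ.* T ℕ.* N)
        arith₁ = solveℕ-∀
        arith₂ : ∀ S T x e r → suc S ℕ.* T ℕ.* x ℕ.+ (suc S ℕ.* e ℕ.+ r) ≡ suc S ℕ.* (T ℕ.* x ℕ.+ e) ℕ.+ r
        arith₂ = solveℕ-∀
        reparam : ∀ N′ → N₀ ℕ.+ N ℕ.≤ N′ → ∀ m →
          suc S ℕ.* T ℕ.* (m ℕ.+ N′) ℕ.+ l ≡ suc S ℕ.* (T ℕ.* (m ℕ.+ (N′ ℕ.∸ N)) ℕ.+ e) ℕ.+ (N ℕ.+ toℕ i)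
        reparam N′ le m = begin
          suc S ℕ.* T ℕ.* (m ℕ.+ N′) ℕ.+ l
            ≡⟨ cong (λ x → suc S ℕ.* T ℕ.* (m ℕ.+ x) ℕ.+ l) (sym (ℕₚ.m∸n+n≡m (ℕₚ.≤-trans (ℕₚ.m≤n+m N N₀) le))) ⟩
          suc S ℕ.* T ℕ.* (m ℕ.+ (N′ ℕ.∸ N ℕ.+ N)) ℕ.+ l
            ≡⟨ arith₁ S T m (N′ ℕ.∸ N) N l ⟩
          suc S ℕ.* T ℕ.* (m ℕ.+ (N′ ℕ.∸ N)) ℕ.+ y
            ≡⟨ cong (λ x → suc S ℕ.* T ℕ.* (m ℕ.+ (N′ ℕ.∸ N)) ℕ.+ x) (residue S N y N≤y) ⟩
          suc S ℕ.* T ℕ.* (m ℕ.+ (N′ ℕ.∸ N)) ℕ.+ (suc S ℕ.* e ℕ.+ (N ℕ.+ toℕ i))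
            ≡⟨ arith₂ S T (m ℕ.+ (N′ ℕ.∸ N)) e (N ℕ.+ toℕ i) ⟩
          suc S ℕ.* (T ℕ.* (m ℕ.+ (N′ ℕ.∸ N)) ℕ.+ e) ℕ.+ (N ℕ.+ toℕ i) ∎
          where open ≡-Reasoning

QuasiPolyMat⇒split : ∀ {k s} {M : ℕ → Mat k s} → (∀ i j → QuasiPoly (λ n → M n i j)) → Split IsPolyMat M
QuasiPolyMat⇒split {M = M} q = merge (common-multiple (λ i v w h j → PolyOn-multℤ (λ n → M n i j) v w (h j))
    λ i → common-multiple (λ j → PolyOn-multℤ (λ n → M n i j)) (q i))
  where
  merge : (Σ ℤ λ v → v ≢ 0ℤ × (∀ i j → PolyOn ∣ v ∣ (λ n → M n i j))) → Split IsPolyMat M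
  merge (v , v≢0 , h) with abs-suc v≢0
  ... | S , S≡ = node S 0 λ l → restrict (toℕ l)
      (eventually-all λ i → eventually-all λ j → subst (λ T → PolyOn T (λ n → M n i j)) S≡ (h i j) (toℕ l))
    where
    arith : ∀ S m N l → suc S ℕ.* (1 ℕ.* m ℕ.+ (N ℕ.+ 0)) ℕ.+ l ≡ suc S ℕ.* (m ℕ.+ N) ℕ.+ l
    arith = solveℕ-∀
    restrict : ∀ l → Eventually (λ N → ∀ i j → IsPoly (λ m → M (suc S ℕ.* (m ℕ.+ N) ℕ.+ l) i j)) →
      Split IsPolyMat (λ m → M (suc S ℕ.* m ℕ.+ l))
    restrict l (N , p) = node 0 N λ { zero → leaf λ i j →
      IsPoly-cong (λ m → cong (λ x → M x i j) (arith S m N l)) (p N ℕₚ.≤-refl i j) }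

split-eventually : ∀ {X : Set} {P : X → Set} {F : ℕ → X} → Split (λ G → ∀ n → P (G n)) F → Eventually (λ n → P (F n))
split-eventually (leaf h) = 0 , λ n _ → h n
split-eventually {P = P} {F} (node S N t) = merge (eventually-all λ i → split-eventually {P = P} (t i))
  where
  merge : Eventually (λ m → ∀ i → P (F (suc S ℕ.* m ℕ.+ (N ℕ.+ toℕ i)))) → Eventually (λ n → P (F n))
  merge (N′ , h) = N′ ℕ.* suc S ℕ.+ N , λ n le → subst (λ x → P (F x)) (sym (residue S N n (ℕₚ.≤-trans (ℕₚ.m≤n+m N _) le)))
    (h ((n ℕ.∸ N) / suc S) (subst (ℕ._≤ (n ℕ.∸ N) / suc S) (m*n/n≡m N′ (suc S))
      (/-monoˡ-≤ (suc S) (subst (ℕ._≤ n ℕ.∸ N) (ℕₚ.m+n∸n≡m (N′ ℕ.* suc S) N) (ℕₚ.∸-monoˡ-≤ N le)))) ((n ℕ.∸ N) mod suc S))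

-- The progressions are disjoint, so choices made on the leaves glue to one function on ℕ. Its
-- restrictions agree with these choices only pointwise, and `ext` bridges the difference.
split-choice : ∀ {X Y : Set} {K : (ℕ → X × Y) → Set} → (∀ P P′ → (∀ m → P m ≡ P′ m) → K P → K P′) →
  ∀ {F} → Split (λ G → Σ (ℕ → Y) λ y → K (λ n → G n , y n)) F → Σ (ℕ → Y) λ y → Split K (λ n → F n , y n)
split-choice ext (leaf (y , k)) = y , leaf k
split-choice {X} {Y} {K} ext {F} (node S N t) = y , node S N λ i →
    split-transfer (λ P P′ → ∀ m → P m ≡ P′ m) (λ P P′ S N r m → r _) ext
      (λ m → cong (λ z → F (suc S ℕ.* m ℕ.+ (N ℕ.+ toℕ i)) , z) (sym (y-on i m))) (proj₂ (child i))
  where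
  child : ∀ i → Σ (ℕ → Y) λ y → Split K (λ n → F (suc S ℕ.* n ℕ.+ (N ℕ.+ toℕ i)) , y n)
  child i = split-choice ext (t i)
  y : ℕ → Y
  -- For n < N the truncated difference is 0 and the value is an arbitrary one, which no leaf sees.
  y n = proj₁ (child ((n ℕ.∸ N) mod suc S)) ((n ℕ.∸ N) / suc S)
  arith : ∀ S N m i → suc S ℕ.* m ℕ.+ (N ℕ.+ i) ≡ i ℕ.+ m ℕ.* suc S ℕ.+ N
  arith = solveℕ-∀
  y-on : ∀ i m → y (suc S ℕ.* m ℕ.+ (N ℕ.+ toℕ i)) ≡ proj₁ (child i) m
  y-on i m = trans (cong (λ x → proj₁ (child (x mod suc S)) (x / suc S)) diff)
    (cong₂ (λ a b → proj₁ (child a) b) same-residue same-quotient)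
    where
    diff : suc S ℕ.* m ℕ.+ (N ℕ.+ toℕ i) ℕ.∸ N ≡ toℕ i ℕ.+ m ℕ.* suc S
    diff = trans (cong (ℕ._∸ N) (arith S N m (toℕ i))) (ℕₚ.m+n∸n≡m (toℕ i ℕ.+ m ℕ.* suc S) N)
    same-residue : (toℕ i ℕ.+ m ℕ.* suc S) mod suc S ≡ i
    same-residue = toℕ-injective (trans (toℕ-fromℕ< (m%n<n (toℕ i ℕ.+ m ℕ.* suc S) (suc S)))
      (trans ([m+kn]%n≡m%n (toℕ i) m (suc S)) (m<n⇒m%n≡m (toℕ<n i))))
    same-quotient : (toℕ i ℕ.+ m ℕ.* suc S) / suc S ≡ m
    same-quotient = trans (+-distrib-/-∣ʳ (toℕ i) (divides-refl m)) (cong₂ ℕ._+_ (m<n⇒m/n≡0 (toℕ<n i)) (m*n/n≡m m (suc S)))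

-- Rational polynomials

private
  module ℚS = Data.Rational.Solver.+-*-Solver

fromℚᵘ-+ : ∀ p q → ℚ.fromℚᵘ (p ℚᵘ.+ q) ≡ ℚ.fromℚᵘ p ℚ.+ ℚ.fromℚᵘ q
fromℚᵘ-+ p q = ℚₚ.toℚᵘ-injective (ℚᵘₚ.≃-trans (ℚₚ.toℚᵘ-fromℚᵘ (p ℚᵘ.+ q)) (ℚᵘₚ.≃-sym
  (ℚᵘₚ.≃-trans (ℚₚ.toℚᵘ-homo-+ (ℚ.fromℚᵘ p) (ℚ.fromℚᵘ q)) (ℚᵘₚ.+-cong (ℚₚ.toℚᵘ-fromℚᵘ p) (ℚₚ.toℚᵘ-fromℚᵘ q)))))

fromℚᵘ-* : ∀ p q → ℚ.fromℚᵘ (p ℚᵘ.* q) ≡ ℚ.fromℚᵘ p ℚ.* ℚ.fromℚᵘ q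
fromℚᵘ-* p q = ℚₚ.toℚᵘ-injective (ℚᵘₚ.≃-trans (ℚₚ.toℚᵘ-fromℚᵘ (p ℚᵘ.* q)) (ℚᵘₚ.≃-sym
  (ℚᵘₚ.≃-trans (ℚₚ.toℚᵘ-homo-* (ℚ.fromℚᵘ p) (ℚ.fromℚᵘ q)) (ℚᵘₚ.*-cong (ℚₚ.toℚᵘ-fromℚᵘ p) (ℚₚ.toℚᵘ-fromℚᵘ q)))))

ℤ→ℚ-+ : ∀ a b → ℤ→ℚ (a + b) ≡ ℤ→ℚ a ℚ.+ ℤ→ℚ b
ℤ→ℚ-+ a b = trans (ℚₚ.fromℚᵘ-cong {mkℚᵘ (a + b) 0} {mkℚᵘ a 0 ℚᵘ.+ mkℚᵘ b 0} (ℚᵘ.*≡* (id a b))) (fromℚᵘ-+ (mkℚᵘ a 0) (mkℚᵘ b 0))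
  where
  id : ∀ a b → (a + b) * 1ℤ ≡ (a * 1ℤ + b * 1ℤ) * 1ℤ
  id = solve-∀

ℤ→ℚ-* : ∀ a b → ℤ→ℚ (a * b) ≡ ℤ→ℚ a ℚ.* ℤ→ℚ b
ℤ→ℚ-* a b = trans (ℚₚ.fromℚᵘ-cong {mkℚᵘ (a * b) 0} {mkℚᵘ a 0 ℚᵘ.* mkℚᵘ b 0} (ℚᵘ.*≡* refl)) (fromℚᵘ-* (mkℚᵘ a 0) (mkℚᵘ b 0))

ℤ→ℚ-injective : ∀ {a b} → ℤ→ℚ a ≡ ℤ→ℚ b → a ≡ b
ℤ→ℚ-injective {a} {b} e with ℚₚ.fromℚᵘ-injective {mkℚᵘ a 0} {mkℚᵘ b 0} e
... | ℚᵘ.*≡* eq = trans (sym (ℤₚ.*-identityʳ a)) (trans eq (ℤₚ.*-identityʳ b))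

clear-denominator : ∀ c → ℤ→ℚ (+ ℚ.↧ₙ c) ℚ.* c ≡ ℤ→ℚ (ℚ.↥ c)
clear-denominator c@(ℚ.mkℚ num den-1 _) = trans (cong (ℤ→ℚ (+ suc den-1) ℚ.*_) (sym (ℚₚ.fromℚᵘ-toℚᵘ c)))
  (trans (sym (fromℚᵘ-* (mkℚᵘ (+ suc den-1) 0) (mkℚᵘ num den-1)))
    (ℚₚ.fromℚᵘ-cong {mkℚᵘ (+ suc den-1) 0 ℚᵘ.* mkℚᵘ num den-1} {mkℚᵘ num 0}
      (ℚᵘ.*≡* (trans (ℤₚ.*-identityʳ (+ suc den-1 * num)) (trans (ℤₚ.*-comm (+ suc den-1) num) (cong (λ x → num * + x) (sym (ℕₚ.+-identityʳ (suc den-1)))))))))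

clear-denominators : ∀ p → Σ ℤ λ v → v ≢ 0ℤ × Σ (ℕ → ℤ) λ g → IsPoly g ×
  (∀ n → ℤ→ℚ v ℚ.* evalPoly p (ℤ→ℚ (+ n)) ≡ ℤ→ℚ (g n))
clear-denominators []       = 1ℤ , (λ ()) , (λ _ → 0ℤ) , IsPoly-const 0ℤ , λ n → refl
clear-denominators (c ∷ cs) with clear-denominators cs
... | v , v≢0 , g , pg , e = den * v , *-nonzero {den} (λ ()) v≢0 , (λ n → v * num + (+ n) ^ 1 * (den * g n)) ,
  IsPoly-+ (IsPoly-const (v * num)) (IsPoly-monomial* 1 (IsPoly-scale den pg)) , λ n →
    let x = ℤ→ℚ (+ n) ; y = evalPoly cs x in begin
    ℤ→ℚ (den * v) ℚ.* (c ℚ.+ x ℚ.* y)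
      ≡⟨ cong (ℚ._* (c ℚ.+ x ℚ.* y)) (ℤ→ℚ-* den v) ⟩
    (ℤ→ℚ den ℚ.* ℤ→ℚ v) ℚ.* (c ℚ.+ x ℚ.* y)
      ≡⟨ ℚS.solve 5 (λ d v c x y → (d ℚS.:* v) ℚS.:* (c ℚS.:+ x ℚS.:* y) ℚS.:= v ℚS.:* (d ℚS.:* c) ℚS.:+ x ℚS.:* (d ℚS.:* (v ℚS.:* y))) refl
           (ℤ→ℚ den) (ℤ→ℚ v) c x y ⟩
    ℤ→ℚ v ℚ.* (ℤ→ℚ den ℚ.* c) ℚ.+ x ℚ.* (ℤ→ℚ den ℚ.* (ℤ→ℚ v ℚ.* y))
      ≡⟨ cong₂ (λ a b → ℤ→ℚ v ℚ.* a ℚ.+ x ℚ.* (ℤ→ℚ den ℚ.* b)) (clear-denominator c) (e n) ⟩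
    ℤ→ℚ v ℚ.* ℤ→ℚ num ℚ.+ x ℚ.* (ℤ→ℚ den ℚ.* ℤ→ℚ (g n))
      ≡⟨ cong₂ (λ a b → a ℚ.+ x ℚ.* b) (sym (ℤ→ℚ-* v num)) (sym (ℤ→ℚ-* den (g n))) ⟩
    ℤ→ℚ (v * num) ℚ.+ x ℚ.* ℤ→ℚ (den * g n)
      ≡⟨ cong (ℤ→ℚ (v * num) ℚ.+_) (sym (ℤ→ℚ-* (+ n) (den * g n))) ⟩
    ℤ→ℚ (v * num) ℚ.+ ℤ→ℚ (+ n * (den * g n))
      ≡⟨ sym (ℤ→ℚ-+ (v * num) (+ n * (den * g n))) ⟩
    ℤ→ℚ (v * num + + n * (den * g n))
      ≡⟨ cong (λ z → ℤ→ℚ (v * num + z * (den * g n))) (sym (ℤₚ.*-identityʳ (+ n))) ⟩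
    ℤ→ℚ (v * num + (+ n) ^ 1 * (den * g n)) ∎
  where
  open ≡-Reasoning
  den num : ℤ
  den = + ℚ.↧ₙ c
  num = ℚ.↥ c

addP : Poly → Poly → Poly
addP []      q       = q
addP (a ∷ p) []      = a ∷ p
addP (a ∷ p) (b ∷ q) = (a ℚ.+ b) ∷ addP p q

evalPoly-add : ∀ p q x → evalPoly (addP p q) x ≡ evalPoly p x ℚ.+ evalPoly q x
evalPoly-add []      q       x = sym (ℚₚ.+-identityˡ (evalPoly q x))
evalPoly-add (a ∷ p) []      x = sym (ℚₚ.+-identityʳ (evalPoly (a ∷ p) x))
evalPoly-add (a ∷ p) (b ∷ q) x = trans (cong (λ z → a ℚ.+ b ℚ.+ x ℚ.* z) (evalPoly-add p q x))
  (ℚS.solve 5 (λ a b x p q → a ℚS.:+ b ℚS.:+ x ℚS.:* (p ℚS.:+ q) ℚS.:= (a ℚS.:+ x ℚS.:* p) ℚS.:+ (b ℚS.:+ x ℚS.:* q)) refl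
    a b x (evalPoly p x) (evalPoly q x))

scaleP : ℚ.ℚ → Poly → Poly
scaleP c []      = []
scaleP c (a ∷ p) = (c ℚ.* a) ∷ scaleP c p

evalPoly-scale : ∀ c p x → evalPoly (scaleP c p) x ≡ c ℚ.* evalPoly p x
evalPoly-scale c []      x = sym (ℚₚ.*-zeroʳ c)
evalPoly-scale c (a ∷ p) x = trans (cong (λ z → c ℚ.* a ℚ.+ x ℚ.* z) (evalPoly-scale c p x))
  (ℚS.solve 4 (λ c a x p → c ℚS.:* a ℚS.:+ x ℚS.:* (c ℚS.:* p) ℚS.:= c ℚS.:* (a ℚS.:+ x ℚS.:* p)) refl c a x (evalPoly p x))

linearPow : ℚ.ℚ → ℚ.ℚ → ℕ → Poly
linearPow α β zero    = ℚ.1ℚ ∷ []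
linearPow α β (suc d) = addP (scaleP α (ℚ.0ℚ ∷ linearPow α β d)) (scaleP β (linearPow α β d))

evalPoly-linearPow : ∀ α β d {m x} → ℤ→ℚ m ≡ α ℚ.* x ℚ.+ β → evalPoly (linearPow α β d) x ≡ ℤ→ℚ (m ^ d)
evalPoly-linearPow α β zero    {m} {x} e = trans (cong (ℚ.1ℚ ℚ.+_) (ℚₚ.*-zeroʳ x)) (ℚₚ.+-identityʳ ℚ.1ℚ)
evalPoly-linearPow α β (suc d) {m} {x} e = begin
  evalPoly (linearPow α β (suc d)) x
    ≡⟨ evalPoly-add (scaleP α (ℚ.0ℚ ∷ L)) (scaleP β L) x ⟩
  evalPoly (scaleP α (ℚ.0ℚ ∷ L)) x ℚ.+ evalPoly (scaleP β L) x
    ≡⟨ cong₂ ℚ._+_ (evalPoly-scale α (ℚ.0ℚ ∷ L) x) (evalPoly-scale β L x) ⟩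
  α ℚ.* (ℚ.0ℚ ℚ.+ x ℚ.* evalPoly L x) ℚ.+ β ℚ.* evalPoly L x
    ≡⟨ cong (λ z → α ℚ.* z ℚ.+ β ℚ.* evalPoly L x) (ℚₚ.+-identityˡ (x ℚ.* evalPoly L x)) ⟩
  α ℚ.* (x ℚ.* evalPoly L x) ℚ.+ β ℚ.* evalPoly L x
    ≡⟨ ℚS.solve 4 (λ a x y b → a ℚS.:* (x ℚS.:* y) ℚS.:+ b ℚS.:* y ℚS.:= (a ℚS.:* x ℚS.:+ b) ℚS.:* y) refl α x (evalPoly L x) β ⟩
  (α ℚ.* x ℚ.+ β) ℚ.* evalPoly L x
    ≡⟨ cong₂ ℚ._*_ (sym e) (evalPoly-linearPow α β d e) ⟩
  ℤ→ℚ m ℚ.* ℤ→ℚ (m ^ d)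
    ≡⟨ sym (ℤ→ℚ-* m (m ^ d)) ⟩
  ℤ→ℚ (m * m ^ d) ∎
  where
  open ≡-Reasoning
  L = linearPow α β d

-- On a progression the function is a polynomial in the position m, but `IsQP` demands one in the
-- argument x. Substituting m = α x + β is built into the induction.
Deg<⇒Poly : ∀ {d g} α β → Deg< d g → Σ Poly λ p → ∀ {m x} → ℤ→ℚ (+ m) ≡ α ℚ.* x ℚ.+ β → evalPoly p x ≡ ℤ→ℚ (g m)
Deg<⇒Poly α β (null z) = [] , λ {m} e → sym (cong ℤ→ℚ (z m))
Deg<⇒Poly {suc d} {g} α β (lead c r pr ex) with Deg<⇒Poly α β pr
... | p , h = addP (scaleP (ℤ→ℚ c) (linearPow α β d)) p , λ {m} {x} e → begin
    evalPoly (addP (scaleP (ℤ→ℚ c) (linearPow α β d)) p) x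
      ≡⟨ evalPoly-add (scaleP (ℤ→ℚ c) (linearPow α β d)) p x ⟩
    evalPoly (scaleP (ℤ→ℚ c) (linearPow α β d)) x ℚ.+ evalPoly p x
      ≡⟨ cong₂ ℚ._+_ (trans (evalPoly-scale (ℤ→ℚ c) (linearPow α β d) x) (cong (ℤ→ℚ c ℚ.*_) (evalPoly-linearPow α β d {+ m} e))) (h e) ⟩
    ℤ→ℚ c ℚ.* ℤ→ℚ ((+ m) ^ d) ℚ.+ ℤ→ℚ (r m)
      ≡⟨ cong (ℚ._+ ℤ→ℚ (r m)) (sym (ℤ→ℚ-* c ((+ m) ^ d))) ⟩
    ℤ→ℚ (c * (+ m) ^ d) ℚ.+ ℤ→ℚ (r m)
      ≡⟨ sym (ℤ→ℚ-+ (c * (+ m) ^ d) (r m)) ⟩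
    ℤ→ℚ (c * (+ m) ^ d + r m)
      ≡⟨ cong ℤ→ℚ (sym (ex m)) ⟩
    ℤ→ℚ (g m) ∎
  where open ≡-Reasoning

QuasiPoly⇒IsQP : ∀ {f} → QuasiPoly f → IsQP f
QuasiPoly⇒IsQP {f} (v , v≢0 , on) with abs-suc v≢0
... | S , S≡ = suc S , ℕ.s≤s ℕ.z≤n , (λ ρ → proj₁ (poly ρ)) ,
    map₂ (λ h n le → agrees n (h n le (n mod suc S))) (eventually-all λ ρ → large ρ)
  where
  on′ : PolyOn (suc S) f
  on′ = subst (λ T → PolyOn T f) S≡ on
  K α : ℚ.ℚ
  K = ℤ→ℚ (+ suc S)
  α = ℚ.fromℚᵘ (mkℚᵘ 1ℤ S)
  αK : α ℚ.* K ≡ ℚ.1ℚ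
  αK = trans (sym (fromℚᵘ-* (mkℚᵘ 1ℤ S) (mkℚᵘ (+ suc S) 0)))
    (ℚₚ.fromℚᵘ-cong {mkℚᵘ 1ℤ S ℚᵘ.* mkℚᵘ (+ suc S) 0} {mkℚᵘ 1ℤ 0} (ℚᵘ.*≡* (id S)))
    where
    id : ∀ S → 1ℤ * + suc S * 1ℤ ≡ 1ℤ * + (suc S ℕ.* 1)
    id S = trans (ℤₚ.*-identityʳ (1ℤ * + suc S)) (cong (λ x → 1ℤ * + x) (sym (ℕₚ.*-identityʳ (suc S))))
  shift : Fin (suc S) → ℕ
  shift ρ = proj₁ (on′ (toℕ ρ))
  -- Solving x = `suc S` (m + `shift ρ`) + ρ for m gives m = α x + `β ρ` with α = 1 / `suc S`.
  β : Fin (suc S) → ℚ.ℚ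
  β ρ = ℚ.- (α ℚ.* ℤ→ℚ (+ toℕ ρ) ℚ.+ ℤ→ℚ (+ shift ρ))
  g : Fin (suc S) → ℕ → ℤ
  g ρ m = f (suc S ℕ.* (m ℕ.+ shift ρ) ℕ.+ toℕ ρ)
  poly : ∀ ρ → Σ Poly λ p → ∀ {m x} → ℤ→ℚ (+ m) ≡ α ℚ.* x ℚ.+ β ρ → evalPoly p x ≡ ℤ→ℚ (g ρ m)
  poly ρ = Deg<⇒Poly α (β ρ) (proj₂ (proj₂ (on′ (toℕ ρ)) (shift ρ) ℕₚ.≤-refl))
  large : ∀ ρ → Eventually (λ n → shift ρ ℕ.≤ n / suc S)
  large ρ = shift ρ ℕ.* suc S , λ n le → subst (ℕ._≤ n / suc S) (m*n/n≡m (shift ρ) (suc S)) (/-monoˡ-≤ (suc S) le)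
  affine : ∀ ρ m → ℤ→ℚ (+ m) ≡ α ℚ.* ℤ→ℚ (+ (suc S ℕ.* (m ℕ.+ shift ρ) ℕ.+ toℕ ρ)) ℚ.+ β ρ
  affine ρ m = sym (begin
    α ℚ.* ℤ→ℚ (+ (suc S ℕ.* (m ℕ.+ shift ρ) ℕ.+ toℕ ρ)) ℚ.+ β ρ
      ≡⟨ cong (λ x → α ℚ.* x ℚ.+ β ρ) expand ⟩
    α ℚ.* (K ℚ.* (a ℚ.+ b) ℚ.+ c) ℚ.+ ℚ.- (α ℚ.* c ℚ.+ b)
      ≡⟨ ℚS.solve 5 (λ α K a b c → α ℚS.:* (K ℚS.:* (a ℚS.:+ b) ℚS.:+ c) ℚS.:+ ℚS.:- (α ℚS.:* c ℚS.:+ b) ℚS.:= α ℚS.:* K ℚS.:* (a ℚS.:+ b) ℚS.:- b) refl α K a b c ⟩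
    α ℚ.* K ℚ.* (a ℚ.+ b) ℚ.- b
      ≡⟨ cong (λ x → x ℚ.* (a ℚ.+ b) ℚ.- b) αK ⟩
    ℚ.1ℚ ℚ.* (a ℚ.+ b) ℚ.- b
      ≡⟨ cong (ℚ._- b) (ℚₚ.*-identityˡ (a ℚ.+ b)) ⟩
    (a ℚ.+ b) ℚ.- b
      ≡⟨ ℚS.solve 2 (λ a b → (a ℚS.:+ b) ℚS.:- b ℚS.:= a) refl a b ⟩
    a ∎)
    where
    open ≡-Reasoning
    a b c : ℚ.ℚ
    a = ℤ→ℚ (+ m)
    b = ℤ→ℚ (+ shift ρ)
    c = ℤ→ℚ (+ toℕ ρ)
    expand : ℤ→ℚ (+ (suc S ℕ.* (m ℕ.+ shift ρ) ℕ.+ toℕ ρ)) ≡ K ℚ.* (a ℚ.+ b) ℚ.+ c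
    expand = trans (cong ℤ→ℚ (pos-affine (suc S) (m ℕ.+ shift ρ) (toℕ ρ))) (trans (ℤ→ℚ-+ (+ suc S * + (m ℕ.+ shift ρ)) (+ toℕ ρ))
      (cong (ℚ._+ c) (trans (ℤ→ℚ-* (+ suc S) (+ (m ℕ.+ shift ρ))) (cong (K ℚ.*_) (trans (cong ℤ→ℚ (ℤₚ.pos-+ m (shift ρ))) (ℤ→ℚ-+ (+ m) (+ shift ρ)))))))
  agrees : ∀ n → shift (n mod suc S) ℕ.≤ n / suc S → ℤ→ℚ (f n) ≡ evalPoly (proj₁ (poly (n mod suc S))) (ℤ→ℚ (+ n))
  agrees n le = subst (λ x → ℤ→ℚ (f x) ≡ evalPoly (proj₁ (poly ρ)) (ℤ→ℚ (+ x))) decomposition (sym (proj₂ (poly ρ) {m} (affine ρ m)))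
    where
    ρ = n mod suc S
    m = n / suc S ℕ.∸ shift ρ
    decomposition : suc S ℕ.* (m ℕ.+ shift ρ) ℕ.+ toℕ ρ ≡ n
    decomposition = trans (cong (λ x → suc S ℕ.* x ℕ.+ toℕ ρ) (ℕₚ.m∸n+n≡m le)) (sym (residue S 0 n ℕ.z≤n))

-- Let v clear all denominators, so that v f is an integer polynomial g on each class. Along T m +
-- n₀ with T = `suc s` |v|, g differs from g(n₀) = v f(n₀) by T times an integer polynomial. As v
-- divides T and f(n₀) is an integer, division by v leaves integer coefficients.
IsQP⇒QuasiPoly : ∀ {f} → IsQP f → QuasiPoly f
IsQP⇒QuasiPoly {f} (suc s , s≥1 , polys , N , ev) = merge (common-multiple mult cleared)
  where
  Cleared : Fin (suc s) → ℤ → Set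
  Cleared ρ v = Σ (ℕ → ℤ) λ g → IsPoly g × (∀ n → N ℕ.≤ n → n mod suc s ≡ ρ → v * f n ≡ g n)
  mult : ∀ ρ v w → Cleared ρ v → Cleared ρ (w * v)
  mult ρ v w (g , pg , e) = _ , IsPoly-scale w pg , λ n le r → trans (ℤₚ.*-assoc w v (f n)) (cong (w *_) (e n le r))
  cleared : ∀ ρ → Σ ℤ λ v → v ≢ 0ℤ × Cleared ρ v
  cleared ρ with clear-denominators (polys ρ)
  ... | v , v≢0 , g , pg , e = v , v≢0 , g , pg , λ { n le refl →
    ℤ→ℚ-injective (trans (ℤ→ℚ-* v (f n)) (trans (cong (ℤ→ℚ v ℚ.*_) (ev n le)) (e n))) }
  merge : (Σ ℤ λ v → v ≢ 0ℤ × (∀ ρ → Cleared ρ v)) → QuasiPoly f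
  merge (v , v≢0 , h) with abs-suc v≢0
  ... | V , V≡ = + suc s * v , *-nonzero {+ suc s} (λ ()) v≢0 ,
      subst (λ T → PolyOn T f) (sym (trans (ℤₚ.abs-* (+ suc s) v) (cong (suc s ℕ.*_) V≡))) on
    where
    σ-factor : Σ ℤ λ σ → + suc V ≡ σ * v
    σ-factor with ℤₚ.+∣i∣≡i⊎+∣i∣≡-i v
    ... | inj₁ e = 1ℤ , trans (cong +_ (sym V≡)) (trans e (sym (ℤₚ.*-identityˡ v)))
    ... | inj₂ e = -1ℤ , trans (cong +_ (sym V≡)) (trans e (sym (ℤₚ.-1*i≡-i v)))
    T : ℕ
    T = suc s ℕ.* suc V
    on : PolyOn T f
    on i = N , λ N′ N≤N′ → by-expansion N′ N≤N′ (h (i mod suc s))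
      where
      by-expansion : ∀ N′ → N ℕ.≤ N′ → Cleared (i mod suc s) v → IsPoly (λ m → f (T ℕ.* (m ℕ.+ N′) ℕ.+ i))
      by-expansion N′ N≤N′ (g , pg , e) with affine-expansion T (T ℕ.* N′ ℕ.+ i) pg
      ... | k , pk , ek = IsPoly-cong expansion (IsPoly-+ (IsPoly-const (f n₀)) (IsPoly-scale (+ suc s * proj₁ σ-factor) pk))
        where
        n₀ : ℕ
        n₀ = T ℕ.* N′ ℕ.+ i
        N≤n : ∀ m → N ℕ.≤ T ℕ.* m ℕ.+ n₀
        N≤n m = ℕₚ.≤-trans N≤N′ (ℕₚ.≤-trans (ℕₚ.m≤m+n N′ ((V ℕ.+ s ℕ.* suc V) ℕ.* N′)) (ℕₚ.≤-trans (ℕₚ.m≤m+n (T ℕ.* N′) i) (ℕₚ.m≤n+m n₀ (T ℕ.* m))))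
        arith₁ : ∀ s V m N′ i → suc s ℕ.* suc V ℕ.* m ℕ.+ (suc s ℕ.* suc V ℕ.* N′ ℕ.+ i) ≡ i ℕ.+ (suc V ℕ.* (m ℕ.+ N′)) ℕ.* suc s
        arith₁ = solveℕ-∀
        arith₂ : ∀ T m N′ i → T ℕ.* (m ℕ.+ N′) ℕ.+ i ≡ T ℕ.* m ℕ.+ (T ℕ.* N′ ℕ.+ i)
        arith₂ = solveℕ-∀
        residue≡ : ∀ m → (T ℕ.* m ℕ.+ n₀) mod suc s ≡ i mod suc s
        residue≡ m = toℕ-injective (trans (toℕ-fromℕ< (m%n<n (T ℕ.* m ℕ.+ n₀) (suc s)))
          (trans (cong (_% suc s) (arith₁ s V m N′ i)) (trans ([m+kn]%n≡m%n i (suc V ℕ.* (m ℕ.+ N′)) (suc s)) (sym (toℕ-fromℕ< (m%n<n i (suc s)))))))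
        vf : ∀ m → v * f (T ℕ.* m ℕ.+ n₀) ≡ g (T ℕ.* m ℕ.+ n₀)
        vf m = e _ (N≤n m) (residue≡ m)
        vf₀ : v * f n₀ ≡ g n₀
        vf₀ = e n₀ (subst (λ x → N ℕ.≤ x ℕ.+ n₀) (ℕₚ.*-zeroʳ T) (N≤n 0))
          (subst (λ x → (x ℕ.+ n₀) mod suc s ≡ i mod suc s) (ℕₚ.*-zeroʳ T) (residue≡ 0))
        id : ∀ v f₀ s σ k → v * f₀ + s * (σ * v) * k ≡ v * (f₀ + s * σ * k)
        id = solve-∀
        expansion : ∀ m → f (T ℕ.* (m ℕ.+ N′) ℕ.+ i) ≡ f n₀ + + suc s * proj₁ σ-factor * k m
        expansion m = trans (cong f (arith₂ T m N′ i)) (*-cancelˡ v≢0 (begin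
          v * f (T ℕ.* m ℕ.+ n₀) ≡⟨ trans (vf m) (ek m) ⟩
          g n₀ + + T * k m ≡⟨ cong₂ (λ x y → x + y * k m) (sym vf₀) (trans (ℤₚ.pos-* (suc s) (suc V)) (cong (+ suc s *_) (proj₂ σ-factor))) ⟩
          v * f n₀ + + suc s * (proj₁ σ-factor * v) * k m ≡⟨ id v (f n₀) (+ suc s) (proj₁ σ-factor) (k m) ⟩
          v * (f n₀ + + suc s * proj₁ σ-factor * k m) ∎))
          where open ≡-Reasoning

IsQP-cong : ∀ {f g} → Eventually (λ n → g n ≡ f n) → IsQP f → IsQP g
IsQP-cong (N , e) (s , s≥1 , polys , N′ , h) = s , s≥1 , polys , N ℕ.+ N′ , λ n le →
  trans (cong ℤ→ℚ (e n (ℕₚ.≤-trans (ℕₚ.m≤m+n N N′) le))) (h n (ℕₚ.≤-trans (ℕₚ.m≤n+m N′ N) le))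

Solution : ∀ {k s} → Mat k s × (Mat k k × Mat s s × (ℕ → ℤ)) → Set
Solution (M , U , V , d) = GL U × GL V × Chain d × ((U · M) · V) ≈ diag d

smith-quasiPoly : ∀ {k s} (M : ℕ → Mat k s) → (∀ i j → QuasiPoly (λ n → M n i j)) →
  Σ (ℕ → Mat k k) λ U → Σ (ℕ → Mat s s) λ V → Σ (ℕ → ℕ → ℤ) λ d →
    IsQPMat U × IsQPMat V × IsQPMat {k} {s} (λ n → diag (d n)) × Eventually (λ n → Solution (M n , U n , V n , d n))
smith-quasiPoly {k} {s} M q = assemble (split-choice Leaf-cong leaves)
  where
  Data : Set
  Data = Mat k k × Mat s s × (ℕ → ℤ)
  PolyPart : ∀ {a b} → (Data → Mat a b) → (ℕ → Mat k s × Data) → Set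
  PolyPart π P = IsPolyMat (λ n → π (proj₂ (P n)))
  πU : Data → Mat k k
  πU (U , _) = U
  πV : Data → Mat s s
  πV (_ , V , _) = V
  πD : Data → Mat k s
  πD (_ , _ , d) = diag d
  Leaf : (ℕ → Mat k s × Data) → Set
  Leaf P = PolyPart πU P × PolyPart πV P × PolyPart πD P × (∀ n → Solution (P n))
  Leaf-cong : ∀ P P′ → (∀ m → P m ≡ P′ m) → Leaf P → Leaf P′
  Leaf-cong P P′ e (u , v , d , sol) = part πU u , part πV v , part πD d , λ n → subst Solution (e n) (sol n)
    where
    part : ∀ {a b} (π : Data → Mat a b) → PolyPart π P → PolyPart π P′
    part π p i j = IsPoly-cong (λ n → cong (λ x → π (proj₂ x) i j) (sym (e n))) (p i j)
  leaves : Split (λ G → Σ (ℕ → Data) λ y → Leaf (λ n → G n , y n)) M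
  leaves = split-bind {H = λ _ → ⊤} (λ _ _ _ _ → tt) tt (QuasiPolyMat⇒split q) λ G _ p →
    split-bind IsPolyMat-stable p (smith k s G p) λ { K pK (d , ch , e@(mk~ {U} {V} pU pV gU gV eq)) →
      -- `Smith` does not record that the diagonal is polynomial; this is inherited from the product
      -- U M V.
      leaf ((λ n → U n , V n , d n) , pU , pV , ~-poly e pK , λ n → gU n , gV n , ch n , eq n) }
  assemble : (Σ (ℕ → Data) λ y → Split Leaf (λ n → M n , y n)) → _
  assemble (y , t) = (λ n → πU (y n)) , (λ n → πV (y n)) , (λ n → proj₂ (proj₂ (y n))) ,
      part πU (λ _ l → proj₁ l) , part πV (λ _ l → proj₁ (proj₂ l)) , part πD (λ _ l → proj₁ (proj₂ (proj₂ l))) ,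
      split-eventually {P = Solution} (split-map (λ _ l → proj₂ (proj₂ (proj₂ l))) t)
    where
    part : ∀ {a b} (π : Data → Mat a b) → (∀ P → Leaf P → PolyPart π P) → IsQPMat (λ n → π (y n))
    part π f i j = QuasiPoly⇒IsQP {λ n → π (y n) i j} (split⇒QuasiPoly (split-transfer (λ P g → g ≡ λ n → π (proj₂ (P n)) i j)
      (λ { P g S N refl → refl }) (λ { P g refl l → f P l i j }) refl t))

-- Unimodular matrices over ℤ are invertible

GL-det : ∀ {n} {G : Mat n n} → GL G → ∀ A → det (G · A) ≡ det A ⊎ det (G · A) ≡ - det A
GL-det (identity e) A = inj₁ (det-cong (≈-trans (·-congʳ A e) (·-identityˡ A)))
GL-det (rowOp {G} {H} i j c E g e) A = compose E (GL-det g A)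
  where
  expand : det (H · A) ≡ det (rowAdd i j c (G · A))
  expand = det-cong (≈-trans (·-congʳ A e) (rowAdd-· i j c G A))
  compose : Elementary i j c → det (G · A) ≡ det A ⊎ det (G · A) ≡ - det A → det (H · A) ≡ det A ⊎ det (H · A) ≡ - det A
  compose (inj₁ i≢j) (inj₁ h) = inj₁ (trans expand (trans (det-rowAdd i j c (G · A) i≢j) h))
  compose (inj₁ i≢j) (inj₂ h) = inj₂ (trans expand (trans (det-rowAdd i j c (G · A) i≢j) h))
  compose (inj₂ (refl , refl)) (inj₁ h) = inj₂ (trans expand (trans (det-negate-row i (G · A)) (cong -_ h)))
  compose (inj₂ (refl , refl)) (inj₂ h) = inj₁ (trans expand (trans (det-negate-row i (G · A)) (trans (cong -_ h) (ℤₚ.neg-involutive (det A)))))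

diag-· : ∀ {n s} d (W : Mat n s) i j → (diag {n} {n} d · W) i j ≡ d (toℕ i) * W i j
diag-· {suc n} d W zero j = trans (cong (λ x → d 0 * W zero j + x) (sum-zero {n} {λ l → 0ℤ * W (suc l) j} λ l → refl)) (ℤₚ.+-identityʳ (d 0 * W zero j))
diag-· {suc n} d W (suc i) j = trans (ℤₚ.+-identityˡ _) (diag-· (λ p → d (suc p)) (λ l → W (suc l)) i j)

∣-prodUpTo : ∀ n d p → p ℕ.< n → d p ∣ prodUpTo n d
∣-prodUpTo (suc n) d zero    _           = ∣m⇒∣m*n (prodUpTo n (λ p → d (suc p))) ∣-refl
∣-prodUpTo (suc n) d (suc p) (ℕ.s≤s p<n) = ∣n⇒∣m*n (d 0) (∣-prodUpTo n (λ p → d (suc p)) p p<n)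

diag-cong : ∀ {k s} {d e : ℕ → ℤ} → (∀ p → p ℕ.< k → p ℕ.< s → d p ≡ e p) → diag {k} {s} d ≈ diag e
diag-cong h zero    zero    = h 0 (ℕ.s≤s ℕ.z≤n) (ℕ.s≤s ℕ.z≤n)
diag-cong h zero    (suc j) = refl
diag-cong h (suc i) zero    = refl
diag-cong h (suc i) (suc j) = diag-cong (λ p a b → h (suc p) (ℕ.s≤s a) (ℕ.s≤s b)) i j

∣-antisym-nonNeg : ∀ {a b} → 0ℤ ℤ.≤ a → 0ℤ ℤ.≤ b → a ∣ b → b ∣ a → a ≡ b
∣-antisym-nonNeg 0≤a 0≤b ab ba = trans (sym (ℤₚ.0≤i⇒+∣i∣≡i 0≤a))
  (trans (cong +_ (ℕ∣.∣-antisym (∣⇒∣ᵤ ab) (∣⇒∣ᵤ ba))) (ℤₚ.0≤i⇒+∣i∣≡i 0≤b))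

Unimodular⇒det∣1 : ∀ {n} {A : Mat n n} → Unimodular A → det A ∣ 1ℤ
Unimodular⇒det∣1 (inj₁ e) = divides 1ℤ (cong (1ℤ *_) (sym e))
Unimodular⇒det∣1 (inj₂ e) = divides -1ℤ (cong (-1ℤ *_) (sym e))

module _ {k s : ℕ} (U : Mat k k) (V : Mat s s) (gU : GL U) (gV : GL V) where

  undo : ∀ (M D : Mat k s) → ((U · M) · V) ≈ D →
    (M ≈ (proj₁ (GL-inverse gU) · (D · proj₁ (GL-inverse gV))))
  undo M D e with GL-inverse gU | GL-inverse gV
  ... | U′ , _ , _ , U′U | V′ , _ , VV′ , _ = ≈-sym
    (≈-trans (·-congˡ U′ (·-congʳ V′ (≈-sym e)))
    (≈-trans (·-congˡ U′ (≈-trans (·-assoc (U · M) V V′) (≈-trans (·-congˡ (U · M) VV′) (·-identityʳ (U · M)))))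
    (≈-trans (≈-sym (·-assoc U′ U M)) (≈-trans (·-congʳ M U′U) (·-identityˡ M)))))

-- The Smith algorithm for the constant family A gives A = U′ · diag d · V′ with U′ and V′ in `GL`.
-- Each d p is nonnegative and divides det A = ±1, so the diagonal matrix is the identity. This
-- makes the transformations contained in `IsSNFOf` invertible.
Unimodular⇒GL : ∀ {n} {A : Mat n n} → Unimodular A → GL A
Unimodular⇒GL {n} {A} uni = diagonalise (smith-quasiPoly (λ _ → A) λ i j → split⇒QuasiPoly (leaf (IsPoly-const (A i j))))
  where
  invert : ∀ U V d → Solution (A , U , V , d) → GL A
  invert U V d (gU , gV , (nonneg , _) , e) = GL-cong A≈ (GL-· gU′ gV′)
    where
    U′ = proj₁ (GL-inverse gU)
    V′ = proj₁ (GL-inverse gV)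
    gU′ = proj₁ (proj₂ (GL-inverse gU))
    gV′ = proj₁ (proj₂ (GL-inverse gV))
    factor : A ≈ (U′ · (diag d · V′))
    factor = undo U V gU gV A (diag d) e
    det-diag : det (diag d · V′) ≡ prodUpTo n d * det V′
    det-diag = trans (det-cong (diag-· d V′)) (det-scale-rows d V′)
    divides-det : ∀ p → p ℕ.< n → d p ∣ det A
    divides-det p p<n = transport (GL-det gU′ (diag d · V′))
      where
      h : d p ∣ det (diag d · V′)
      h = subst (d p ∣_) (sym det-diag) (∣m⇒∣m*n (det V′) (∣-prodUpTo n d p p<n))
      transport : det (U′ · (diag d · V′)) ≡ det (diag d · V′) ⊎ det (U′ · (diag d · V′)) ≡ - det (diag d · V′) → d p ∣ det A
      transport (inj₁ x) = subst (d p ∣_) (sym (trans (det-cong factor) x)) h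
      transport (inj₂ x) = subst (d p ∣_) (sym (trans (det-cong factor) x)) (∣m⇒∣-m h)
    one : ∀ p → p ℕ.< n → d p ≡ 1ℤ
    one p p<n = ∣-antisym-nonNeg (nonneg p) (ℤ.+≤+ ℕ.z≤n)
      (∣-trans (divides-det p p<n) (Unimodular⇒det∣1 {A = A} uni)) (divides (d p) (sym (ℤₚ.*-identityʳ (d p))))
    A≈ : A ≈ (U′ · V′)
    A≈ = ≈-trans factor (·-congˡ U′ (≈-trans (·-congʳ V′ (diag-cong λ p p<n _ → one p p<n)) (·-identityˡ V′)))
  diagonalise : (Σ (ℕ → Mat n n) λ U → Σ (ℕ → Mat n n) λ V → Σ (ℕ → ℕ → ℤ) λ d →
    IsQPMat U × IsQPMat V × IsQPMat {n} {n} (λ m → diag (d m)) × Eventually (λ m → Solution (A , U m , V m , d m))) → GL A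
  diagonalise (U , V , d , _ , _ , _ , N , sol) = invert (U N) (V N) (d N) (sol N ℕₚ.≤-refl)

-- Uniqueness of the Smith normal form

Chain-≤ : ∀ {d} → Chain d → ∀ {p q} → p ℕ.≤ q → d p ∣ d q
Chain-≤ {d} (_ , dvd) {p} {q} p≤q = subst (λ x → d p ∣ d x) (ℕₚ.m∸n+n≡m p≤q) (go (q ℕ.∸ p))
  where
  go : ∀ k → d p ∣ d (k ℕ.+ p)
  go zero    = ∣-refl
  go (suc k) = ∣-trans (go k) (dvd (k ℕ.+ p))

diag-entry : ∀ {k s} d (i : Fin k) (j : Fin s) → toℕ i ≡ toℕ j → diag d i j ≡ d (toℕ i)
diag-entry d zero    zero    e = refl
diag-entry d (suc i) (suc j) e = diag-entry (λ p → d (suc p)) i j (ℕₚ.suc-injective e)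

diag-off : ∀ {k s} d (i : Fin k) (j : Fin s) → toℕ i ≢ toℕ j → diag d i j ≡ 0ℤ
diag-off d zero    zero    i≢j = ⊥-elim (i≢j refl)
diag-off d zero    (suc j) i≢j = refl
diag-off d (suc i) zero    i≢j = refl
diag-off d (suc i) (suc j) i≢j = diag-off (λ p → d (suc p)) i j λ e → i≢j (cong suc e)

∣-diag : ∀ {k s m} d (i : Fin k) (j : Fin s) → m ∣ d (toℕ i) → m ∣ diag d i j
∣-diag {m = m} d i j h with toℕ i ℕ.≟ toℕ j
... | yes e = subst (m ∣_) (sym (diag-entry d i j e)) h
... | no ne = subst (m ∣_) (sym (diag-off d i j ne)) (divides 0ℤ refl)

sum-diag : ∀ {k s} d (f : Fin k → ℤ) (l : Fin k) (j : Fin s) → toℕ l ≡ toℕ j → sumℤ (λ x → f x * diag d x j) ≡ f l * d (toℕ l)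
sum-diag d f zero    zero    e = trans (cong (λ x → f zero * d 0 + x) (sum-zero λ x → ℤₚ.*-zeroʳ (f (suc x)))) (ℤₚ.+-identityʳ (f zero * d 0))
sum-diag d f (suc l) (suc j) e = trans (cong₂ _+_ (ℤₚ.*-zeroʳ (f zero)) (sum-diag (λ p → d (suc p)) (λ x → f (suc x)) l j (ℕₚ.suc-injective e)))
  (ℤₚ.+-identityˡ (f (suc l) * d (suc (toℕ l))))

intertwined⇒∣ : ∀ {k s} {P : Mat k k} {Q : Mat s s} {d e} → Unimodular P → Chain d → Chain e →
  (P · diag {k} {s} e) ≈ (diag {k} {s} d · Q) → ∀ p → p ℕ.< k → p ℕ.< s → d p ∣ e p
intertwined⇒∣ {k} {s} {P} {Q} {d} {e} uni chd che eq p p<k p<s = strip uni (∣-det-block (e p) p P p<k block-∣)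
  where
  block-∣ : ∀ i l → p ℕ.≤ toℕ i → toℕ l ℕ.≤ p → d p ∣ e p * P i l
  block-∣ i l p≤i l≤p = from-chain (Chain-≤ che l≤p)
    where
    -- The entry P i l is read off from column l of P · diag e, which exists since l ≤ p < s.
    l<s : toℕ l ℕ.< s
    l<s = ℕₚ.≤-<-trans l≤p p<s
    j : Fin s
    j = Fin.fromℕ< l<s
    entry : P i l * e (toℕ l) ≡ (diag d · Q) i j
    entry = trans (sym (sum-diag e (P i) l j (sym (toℕ-fromℕ< l<s)))) (eq i j)
    dp∣ : d p ∣ (diag {k} {s} d · Q) i j
    dp∣ = ∣-sum λ x → ∣m⇒∣m*n (Q x j) (∣-diag d i x (Chain-≤ chd p≤i))
    id : ∀ t x e → t * (x * e) ≡ t * e * x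
    id = solve-∀
    from-chain : e (toℕ l) ∣ e p → d p ∣ e p * P i l
    from-chain (divides t ep) = subst (d p ∣_)
      (trans (cong (t *_) (sym entry)) (trans (id t (P i l) (e (toℕ l))) (cong (_* P i l) (sym ep)))) (∣n⇒∣m*n t dp∣)
  strip : Unimodular P → d p ∣ e p * det P → d p ∣ e p
  strip (inj₁ h) x = subst (d p ∣_) (trans (cong (e p *_) h) (ℤₚ.*-identityʳ (e p))) x
  strip (inj₂ h) x = subst (d p ∣_) (trans (cong (λ y → - (e p * y)) h) (id (e p))) (∣m⇒∣-m x)
    where
    id : ∀ x → - (x * -1ℤ) ≡ x
    id = solve-∀

-- Take P = U U′⁻¹ and Q = V⁻¹ V′: both P · diag e and diag d · Q are equal to U M V′.
invariant-∣ : ∀ {k s} {M : Mat k s} {U V d U′ V′ e} → Solution (M , U , V , d) → Solution (M , U′ , V′ , e) →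
  ∀ p → p ℕ.< k → p ℕ.< s → d p ∣ e p
invariant-∣ {k} {s} {M} {U} {V} {d} {U′} {V′} {e} (gU , gV , chd , eqd) (gU′ , gV′ , che , eqe) =
  intertwined⇒∣ (GL⇒Unimodular (GL-· gU gX)) chd che intertwine
  where
  X = proj₁ (GL-inverse gU′)
  gX = proj₁ (proj₂ (GL-inverse gU′))
  XU′ : (X · U′) ≈ δ
  XU′ = proj₂ (proj₂ (proj₂ (GL-inverse gU′)))
  Y = proj₁ (GL-inverse gV)
  VY : (V · Y) ≈ δ
  VY = proj₁ (proj₂ (proj₂ (GL-inverse gV)))
  left : ((U · X) · diag e) ≈ ((U · M) · V′)
  left = ≈-trans (·-congˡ (U · X) (≈-sym eqe))
    (≈-trans (≈-sym (·-assoc (U · X) (U′ · M) V′)) (·-congʳ V′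
      (≈-trans (·-assoc U X (U′ · M)) (·-congˡ U
        (≈-trans (≈-sym (·-assoc X U′ M)) (≈-trans (·-congʳ M XU′) (·-identityˡ M)))))))
  right : (diag d · (Y · V′)) ≈ ((U · M) · V′)
  right = ≈-trans (·-congʳ (Y · V′) (≈-sym eqd))
    (≈-trans (·-assoc (U · M) V (Y · V′)) (·-congˡ (U · M)
      (≈-trans (≈-sym (·-assoc V Y V′)) (≈-trans (·-congʳ V′ VY) (·-identityˡ V′)))))
  intertwine : ((U · X) · diag e) ≈ (diag d · (Y · V′))
  intertwine = ≈-trans left (≈-sym right)

-- From the rank r on, the values of d are arbitrary; replacing them by 0 turns the rank conditions
-- into a `Chain`.
SmithForm⇒diag : ∀ {k s} {D : Mat k s} → IsSmithForm D → Σ (ℕ → ℤ) λ e → Chain e × D ≈ diag e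
SmithForm⇒diag {k} {s} {D} (r , _ , _ , d , pos , dvd , on , off) = e , (nonneg , chain) , agree
  where
  e : ℕ → ℤ
  e p with p ℕ.<? r
  ... | yes _ = d p
  ... | no _  = 0ℤ
  nonneg : ∀ p → 0ℤ ℤ.≤ e p
  nonneg p with p ℕ.<? r
  ... | yes p<r = ℤₚ.<⇒≤ (pos p p<r)
  ... | no _    = ℤₚ.≤-refl
  chain : ∀ p → e p ∣ e (suc p)
  chain p with p ℕ.<? r | suc p ℕ.<? r
  ... | yes _   | yes 1+p<r = ∣ᵤ⇒∣ (dvd p 1+p<r)
  ... | no p≮r  | yes 1+p<r = ⊥-elim (p≮r (ℕₚ.<-trans (ℕₚ.n<1+n p) 1+p<r))
  ... | _       | no _      = divides 0ℤ refl
  on-diagonal : ∀ i j → toℕ i ≡ toℕ j → D i j ≡ e (toℕ i)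
  on-diagonal i j i≡j with toℕ i ℕ.<? r
  ... | yes i<r = on i j i≡j i<r
  ... | no i≮r  = off i j λ h → i≮r (proj₂ h)
  agree : D ≈ diag e
  agree i j with toℕ i ℕ.≟ toℕ j
  ... | yes i≡j = trans (on-diagonal i j i≡j) (sym (diag-entry e i j i≡j))
  ... | no i≢j  = trans (off i j λ h → i≢j (proj₁ h)) (sym (diag-off e i j i≢j))

SNF-unique : ∀ {k s} {M D : Mat k s} {U V d} → Solution (M , U , V , d) → IsSNFOf M D → D ≈ diag d
SNF-unique {k} {s} {M} {D} {U} {V} {d} sol@(_ , _ , chd , _) (form , U′ , V′ , uU , uV , eq) = compare (SmithForm⇒diag form)
  where
  compare : (Σ (ℕ → ℤ) λ e → Chain e × D ≈ diag e) → D ≈ diag d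
  compare (e , che , D≈) = ≈-trans D≈ (diag-cong λ p p<k p<s →
      ∣-antisym-nonNeg (proj₁ che p) (proj₁ chd p) (invariant-∣ sol′ sol p p<k p<s) (invariant-∣ sol sol′ p p<k p<s))
    where
    sol′ : Solution (M , U′ , V′ , e)
    sol′ = Unimodular⇒GL uU , Unimodular⇒GL uV , che , ≈-trans eq D≈

theorem4p6 : (k s : ℕ) (M : ℕ → Mat k s) (D : ℕ → Mat k s) →
    IsQPMat M →
    (∀ n → IsSNFOf (M n) (D n)) →
    IsQPMat D ×
    Σ (ℕ → Mat k k) λ U → Σ (ℕ → Mat s s) λ V →
    IsQPMat U × IsQPMat V ×
    Eventually (λ n → Unimodular (U n) × Unimodular (V n) × ((U n · M n) · V n) ≈M D n)
theorem4p6 k s M D qpM snf = conclude (smith-quasiPoly M λ i j → IsQP⇒QuasiPoly {λ n → M n i j} (qpM i j))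
  where
  conclude : (Σ (ℕ → Mat k k) λ U → Σ (ℕ → Mat s s) λ V → Σ (ℕ → ℕ → ℤ) λ d →
      IsQPMat U × IsQPMat V × IsQPMat {k} {s} (λ n → diag (d n)) × Eventually (λ n → Solution (M n , U n , V n , d n))) →
    IsQPMat D × Σ (ℕ → Mat k k) λ U → Σ (ℕ → Mat s s) λ V → IsQPMat U × IsQPMat V ×
      Eventually (λ n → Unimodular (U n) × Unimodular (V n) × ((U n · M n) · V n) ≈M D n)
  conclude (U , V , d , qU , qV , qD , N , sol) =
    (λ i j → IsQP-cong (N , λ n le → D≈ n le i j) (qD i j)) , U , V , qU , qV , N , λ n le →
      let gU , gV , _ , eq = sol n le in GL⇒Unimodular gU , GL⇒Unimodular gV , ≈-trans eq (≈-sym (D≈ n le))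
    where
    D≈ : ∀ n → N ℕ.≤ n → D n ≈ diag (d n)
    D≈ n le = SNF-unique (sol n le) (snf n)
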